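{- There is an absolute constant $C>0$ such that the following holds. Let $G$ be a weighted undirected graph with $n\ge 2$ vertices and $dn/2$ edges (where $d>0$ is a real number), and let $\lambda_1\le \lambda_2\le\cdots\le\lambda_n$ be the eigenvalues of the non-normalized Laplacian matrix of $G$. If the girth of $G$ is at least $2d^{1/8}+1$, then $$\frac{\lambda_n}{\lambda_2}\;\ge\; 1+\frac{4}{\sqrt d}-\frac{C}{d^{5/8}}-\frac{C}{n}.$$
   Context: A weighted undirected graph $G=(V,E)$ is a finite simple undirected graph in which each edge $\{u,v\}\in E$ carries a weight $w(u,v)=w(v,u)>0$; set $w(u,v)=0$ for non-edges. The number of edges is the number of pairs of nonzero weight, so $d$ is the average combinatorial degree. The weighted degree of $u$ is $w(u)=\sum_v w(u,v)$. Let $W$ be the matrix with entries $W_{u,v}=w(u,v)$ and $D$ the diagonal matrix with $D_{v,v}=w(v)$. The (non-normalized) Laplacian of $G$ is $L=D-W$; its eigenvalues are listed with multiplicity in nondecreasing order. The girth of $G$ is the number of edges of the shortest simple cycle in $G$ ($+\infty$ if $G$ has no cycle). If $\lambda_2=0$, the ratio $\lambda_n/\lambda_2$ is interpreted as $+\infty$. -}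

module Defs where

open import Algebra.Bundles using (RawRing; CommutativeMonoid)
import Algebra.Definitions.RawSemiring as RawSemiringDefs
open import Data.Empty using (⊥)
open import Data.Fin as Fin using (Fin; zero; suc; toℕ; inject₁; punchIn)
open import Data.Integer as ℤ using (+_)
open import Data.List using (allFin; cartesianProduct; filter; length)
open import Data.Nat as ℕ using (ℕ; zero; suc)
import Data.Nat.Properties as ℕ
open import Data.Product using (∃-syntax; _×_; _,_)
open import Data.Rational as ℚ using (ℚ; 0ℚ; 1ℚ; ½; ∣_∣)
import Data.Rational.Properties as ℚ
open import Algebra.Properties.AbelianGroup ℚ.+-0-abelianGroup using (⁻¹-involutive)
open import Algebra.Properties.CommutativeSemigroup (CommutativeMonoid.commutativeSemigroup ℚ.+-0-commutativeMonoid) using (interchange)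
open import Data.Unit using (⊤)
open import Data.Bool using (if_then_else_)
open import Function.Definitions using (Injective)
open import Level using (0ℓ)
open import Relation.Binary using (Rel; Decidable; Symmetric; Irreflexive)
open import Relation.Binary.PropositionalEquality
open import Relation.Nullary using (¬_; does)
open import Relation.Nullary.Construct.Add.Supremum using (_⁺; [_]; ⊤⁺)
open import Relation.Nullary.Decidable using (_×-dec_)

-- The real numbers, as Cauchy sequences of rationals up to _≈_.

IsCauchy : (ℕ → ℚ) → Set
IsCauchy s = ∀ ε → 0ℚ ℚ.< ε → ∃[ N ] ∀ m n → N ℕ.≤ m → N ℕ.≤ n → ∣ s m ℚ.- s n ∣ ℚ.< ε

record ℝ : Set where
  constructor mkℝ
  field
    seq    : ℕ → ℚ
    cauchy : IsCauchy seq

open ℝ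

infix 4 _≈_ _<_ _≤_

record _≈_ (x y : ℝ) : Set where
  constructor mk≈
  field
    close : ∀ ε → 0ℚ ℚ.< ε → ∃[ N ] ∀ n → N ℕ.≤ n → ∣ seq x n ℚ.- seq y n ∣ ℚ.< ε

record _<_ (x y : ℝ) : Set where
  constructor mk<
  field
    gap       : ℚ
    gap>0     : 0ℚ ℚ.< gap
    threshold : ℕ
    separated : ∀ n → threshold ℕ.≤ n → seq x n ℚ.+ gap ℚ.≤ seq y n

_≤_ : Rel ℝ 0ℓ
x ≤ y = ¬ (y < x)

telescope : ∀ a b c → a ℚ.- c ≡ (a ℚ.- b) ℚ.+ (b ℚ.- c)
telescope a b c = sym (begin
  (a ℚ.- b) ℚ.+ (b ℚ.- c)          ≡⟨ ℚ.+-assoc a (ℚ.- b) (b ℚ.- c) ⟩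
  a ℚ.+ (ℚ.- b ℚ.+ (b ℚ.- c))      ≡⟨ cong (a ℚ.+_) (sym (ℚ.+-assoc (ℚ.- b) b (ℚ.- c))) ⟩
  a ℚ.+ ((ℚ.- b ℚ.+ b) ℚ.- c)      ≡⟨ cong (λ z → a ℚ.+ (z ℚ.- c)) (ℚ.+-inverseˡ b) ⟩
  a ℚ.+ (0ℚ ℚ.- c)                 ≡⟨ cong (a ℚ.+_) (ℚ.+-identityˡ (ℚ.- c)) ⟩
  a ℚ.- c                          ∎)
  where open ≡-Reasoning

-+-cancel : ∀ a b → (a ℚ.- b) ℚ.+ b ≡ a
-+-cancel a b = trans (ℚ.+-assoc a (ℚ.- b) b) (trans (cong (a ℚ.+_) (ℚ.+-inverseˡ b)) (ℚ.+-identityʳ a))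

+-differences : ∀ a b c d → (a ℚ.+ b) ℚ.- (c ℚ.+ d) ≡ (a ℚ.- c) ℚ.+ (b ℚ.- d)
+-differences a b c d =
  trans (cong (a ℚ.+ b ℚ.+_) (ℚ.neg-distrib-+ c d)) (interchange a b (ℚ.- c) (ℚ.- d))

neg-differences : ∀ a b → b ℚ.- a ≡ ℚ.- a ℚ.- ℚ.- b
neg-differences a b =
  trans (ℚ.+-comm b (ℚ.- a)) (cong (ℚ.- a ℚ.+_) (sym (⁻¹-involutive b)))

*-distribˡ-- : ∀ a b c → a ℚ.* (b ℚ.- c) ≡ a ℚ.* b ℚ.- a ℚ.* c
*-distribˡ-- a b c = trans (ℚ.*-distribˡ-+ a b (ℚ.- c)) (cong (a ℚ.* b ℚ.+_) (sym (ℚ.neg-distribʳ-* a c)))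

*-differences : ∀ a b c d → a ℚ.* b ℚ.- c ℚ.* d ≡ a ℚ.* (b ℚ.- d) ℚ.+ d ℚ.* (a ℚ.- c)
*-differences a b c d = begin
  a ℚ.* b ℚ.- c ℚ.* d                                    ≡⟨ telescope (a ℚ.* b) (a ℚ.* d) (c ℚ.* d) ⟩
  (a ℚ.* b ℚ.- a ℚ.* d) ℚ.+ (a ℚ.* d ℚ.- c ℚ.* d)        ≡⟨ cong₂ (λ y z → (a ℚ.* b ℚ.- a ℚ.* d) ℚ.+ (y ℚ.- z)) (ℚ.*-comm a d) (ℚ.*-comm c d) ⟩
  (a ℚ.* b ℚ.- a ℚ.* d) ℚ.+ (d ℚ.* a ℚ.- d ℚ.* c)        ≡⟨ cong₂ ℚ._+_ (sym (*-distribˡ-- a b d)) (sym (*-distribˡ-- d a c)) ⟩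
  a ℚ.* (b ℚ.- d) ℚ.+ d ℚ.* (a ℚ.- c)                    ∎
  where open ≡-Reasoning

half-pos : ∀ {ε} → 0ℚ ℚ.< ε → 0ℚ ℚ.< ½ ℚ.* ε
half-pos {ε} p = subst (ℚ._< ½ ℚ.* ε) (ℚ.*-zeroʳ ½) (ℚ.*-monoʳ-<-pos ½ p)

half+half : ∀ ε → ½ ℚ.* ε ℚ.+ ½ ℚ.* ε ≡ ε
half+half ε = trans (sym (ℚ.*-distribʳ-+ ε ½ ½)) (ℚ.*-identityˡ ε)

*-<-bound : ∀ {p q A ε} → 0ℚ ℚ.< A → ∣ p ∣ ℚ.≤ A → A ℚ.* ∣ q ∣ ℚ.< ε → ∣ p ℚ.* q ∣ ℚ.< ε
*-<-bound {p} {q} {A} {ε} A>0 p≤A h = begin-strict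
  ∣ p ℚ.* q ∣       ≡⟨ ℚ.∣p*q∣≡∣p∣*∣q∣ p q ⟩
  ∣ p ∣ ℚ.* ∣ q ∣   ≤⟨ ℚ.*-monoʳ-≤-nonNeg ∣ q ∣ {{ℚ.∣-∣-nonNeg q}} p≤A ⟩
  A ℚ.* ∣ q ∣       <⟨ h ⟩
  ε                 ∎
  where open ℚ.≤-Reasoning

shrink : ∀ {A ε} → 0ℚ ℚ.< A → 0ℚ ℚ.< ε →
         ∃[ δ ] 0ℚ ℚ.< δ × (∀ q → q ℚ.< δ → A ℚ.* q ℚ.< ε)
shrink {A} {ε} A>0 ε>0 = A⁻¹ ℚ.* ε , δ>0 , λ q q<δ → subst (A ℚ.* q ℚ.<_) cancel (ℚ.*-monoʳ-<-pos A q<δ)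
  where
  instance
    A-pos : ℚ.Positive A
    A-pos = ℚ.positive A>0
    A-nonZero : ℚ.NonZero A
    A-nonZero = ℚ.pos⇒nonZero A
  A⁻¹ : ℚ
  A⁻¹ = ℚ.1/ A
  instance
    A⁻¹-pos : ℚ.Positive A⁻¹
    A⁻¹-pos = ℚ.1/pos⇒pos A
  δ>0 : 0ℚ ℚ.< A⁻¹ ℚ.* ε
  δ>0 = subst (ℚ._< A⁻¹ ℚ.* ε) (ℚ.*-zeroʳ A⁻¹) (ℚ.*-monoʳ-<-pos A⁻¹ ε>0)
  cancel : A ℚ.* (A⁻¹ ℚ.* ε) ≡ ε
  cancel = trans (sym (ℚ.*-assoc A A⁻¹ ε)) (trans (cong (ℚ._* ε) (ℚ.*-inverseʳ A)) (ℚ.*-identityˡ ε))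

sum-< : ∀ {r} p q {ε} → r ≡ p ℚ.+ q → ∣ p ∣ ℚ.< ½ ℚ.* ε → ∣ q ∣ ℚ.< ½ ℚ.* ε → ∣ r ∣ ℚ.< ε
sum-< {r} p q {ε} eq hp hq = begin-strict
  ∣ r ∣                    ≡⟨ cong ∣_∣ eq ⟩
  ∣ p ℚ.+ q ∣              ≤⟨ ℚ.∣p+q∣≤∣p∣+∣q∣ p q ⟩
  ∣ p ∣ ℚ.+ ∣ q ∣          <⟨ ℚ.+-mono-< hp hq ⟩
  ½ ℚ.* ε ℚ.+ ½ ℚ.* ε      ≡⟨ half+half ε ⟩
  ε                        ∎
  where open ℚ.≤-Reasoning

eventually-bounded : ∀ x → ∃[ A ] 0ℚ ℚ.< A × (∃[ N ] ∀ n → N ℕ.≤ n → ∣ seq x n ∣ ℚ.≤ A)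
eventually-bounded x with cauchy x 1ℚ (ℚ.*<* (ℤ.+<+ (ℕ.s≤s ℕ.z≤n)))
... | N , h = A , A>0 , N , bound
  where
  open ℚ.≤-Reasoning
  A = 1ℚ ℚ.+ ∣ seq x N ∣
  A>0 : 0ℚ ℚ.< A
  A>0 = ℚ.+-mono-<-≤ {0ℚ} {1ℚ} {0ℚ} (ℚ.*<* (ℤ.+<+ (ℕ.s≤s ℕ.z≤n))) (ℚ.0≤∣p∣ (seq x N))
  bound : ∀ n → N ℕ.≤ n → ∣ seq x n ∣ ℚ.≤ A
  bound n N≤n = begin
    ∣ seq x n ∣                                    ≡⟨ cong ∣_∣ (sym (-+-cancel (seq x n) (seq x N))) ⟩
    ∣ (seq x n ℚ.- seq x N) ℚ.+ seq x N ∣          ≤⟨ ℚ.∣p+q∣≤∣p∣+∣q∣ (seq x n ℚ.- seq x N) (seq x N) ⟩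
    ∣ seq x n ℚ.- seq x N ∣ ℚ.+ ∣ seq x N ∣        ≤⟨ ℚ.+-monoˡ-≤ ∣ seq x N ∣ (ℚ.<⇒≤ (h n N N≤n ℕ.≤-refl)) ⟩
    A                                              ∎

fromℚ : ℚ → ℝ
fromℚ q = mkℝ (λ _ → q) λ ε ε>0 → 0 , λ _ _ _ _ → subst (ℚ._< ε) (sym (cong ∣_∣ (ℚ.+-inverseʳ q))) ε>0

toℝ : ℕ → ℝ
toℝ n = fromℚ (+ n ℚ./ 1)

0ℝ 1ℝ : ℝ
0ℝ = fromℚ 0ℚ
1ℝ = fromℚ 1ℚ

infixl 6 _+_ _-_
infixl 7 _*_
infix  8 -_

_+_ : ℝ → ℝ → ℝ
x + y = mkℝ (λ n → seq x n ℚ.+ seq y n) prf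
  where
  abstract
    prf : IsCauchy (λ n → seq x n ℚ.+ seq y n)
    prf ε ε>0 with cauchy x (½ ℚ.* ε) (half-pos ε>0) | cauchy y (½ ℚ.* ε) (half-pos ε>0)
    ... | M , hx | N , hy = M ℕ.⊔ N , λ m n m≥ n≥ →
      sum-< (seq x m ℚ.- seq x n) (seq y m ℚ.- seq y n)
        (+-differences (seq x m) (seq y m) (seq x n) (seq y n))
        (hx m n (ℕ.m⊔n≤o⇒m≤o M N m≥) (ℕ.m⊔n≤o⇒m≤o M N n≥))
        (hy m n (ℕ.m⊔n≤o⇒n≤o M N m≥) (ℕ.m⊔n≤o⇒n≤o M N n≥))

-_ : ℝ → ℝ
- x = mkℝ (λ n → ℚ.- seq x n) prf
  where
  abstract
    prf : IsCauchy (λ n → ℚ.- seq x n)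
    prf ε ε>0 with cauchy x ε ε>0
    ... | N , h = N , λ m n m≥ n≥ →
      subst (λ z → ∣ z ∣ ℚ.< ε) (neg-differences (seq x m) (seq x n)) (h n m n≥ m≥)

_-_ : ℝ → ℝ → ℝ
x - y = x + - y

_*_ : ℝ → ℝ → ℝ
x * y = mkℝ (λ n → seq x n ℚ.* seq y n) prf
  where
  abstract
    prf : IsCauchy (λ n → seq x n ℚ.* seq y n)
    prf ε ε>0 with eventually-bounded x | eventually-bounded y
    ... | A , A>0 , N₁ , hA | B , B>0 , N₂ , hB
      with shrink A>0 (half-pos ε>0) | shrink B>0 (half-pos ε>0)
    ... | δ , δ>0 , hδ | η , η>0 , hη
      with cauchy y δ δ>0 | cauchy x η η>0
    ... | N₃ , hy | N₄ , hx = (N₁ ℕ.⊔ N₂) ℕ.⊔ (N₃ ℕ.⊔ N₄) , λ m n m≥ n≥ →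
      let m≥₁₂ = ℕ.m⊔n≤o⇒m≤o (N₁ ℕ.⊔ N₂) (N₃ ℕ.⊔ N₄) m≥
          n≥₁₂ = ℕ.m⊔n≤o⇒m≤o (N₁ ℕ.⊔ N₂) (N₃ ℕ.⊔ N₄) n≥
          m≥₃₄ = ℕ.m⊔n≤o⇒n≤o (N₁ ℕ.⊔ N₂) (N₃ ℕ.⊔ N₄) m≥
          n≥₃₄ = ℕ.m⊔n≤o⇒n≤o (N₁ ℕ.⊔ N₂) (N₃ ℕ.⊔ N₄) n≥
      in sum-< (seq x m ℚ.* (seq y m ℚ.- seq y n)) (seq y n ℚ.* (seq x m ℚ.- seq x n))
        (*-differences (seq x m) (seq y m) (seq x n) (seq y n))
        (*-<-bound {seq x m} A>0 (hA m (ℕ.m⊔n≤o⇒m≤o N₁ N₂ m≥₁₂))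
          (hδ _ (hy m n (ℕ.m⊔n≤o⇒m≤o N₃ N₄ m≥₃₄) (ℕ.m⊔n≤o⇒m≤o N₃ N₄ n≥₃₄))))
        (*-<-bound {seq y n} B>0 (hB n (ℕ.m⊔n≤o⇒n≤o N₁ N₂ n≥₁₂))
          (hη _ (hx m n (ℕ.m⊔n≤o⇒n≤o N₃ N₄ m≥₃₄) (ℕ.m⊔n≤o⇒n≤o N₃ N₄ n≥₃₄))))

-- The truncation x n ⊔ ε changes only finitely many terms and keeps every term invertible.
recip : (x : ℝ) → 0ℝ < x → ℝ
recip x (mk< ε ε>0 N ε≤x) = mkℝ inv prf
  where
  ⊔-pos : ∀ n → ℚ.Positive (seq x n ℚ.⊔ ε)
  ⊔-pos n = ℚ.positive (ℚ.<-≤-trans ε>0 (ℚ.p≤q⊔p (seq x n) ε))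

  instance
    ε-pos : ℚ.Positive ε
    ε-pos = ℚ.positive ε>0
    ε-nonZero : ℚ.NonZero ε
    ε-nonZero = ℚ.pos⇒nonZero ε
    ⊔-nonZero : ∀ {n} → ℚ.NonZero (seq x n ℚ.⊔ ε)
    ⊔-nonZero {n} = ℚ.pos⇒nonZero (seq x n ℚ.⊔ ε) {{⊔-pos n}}

  inv : ℕ → ℚ
  inv n = ℚ.1/ (seq x n ℚ.⊔ ε)

  E : ℚ
  E = ℚ.1/ ε

  E-pos : ℚ.Positive E
  E-pos = ℚ.1/pos⇒pos ε

  inv-pos : ∀ n → ℚ.Positive (inv n)
  inv-pos n = ℚ.1/pos⇒pos (seq x n ℚ.⊔ ε) {{⊔-pos n}}

  inv≤E : ∀ n → ∣ inv n ∣ ℚ.≤ E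
  inv≤E n = begin
    ∣ inv n ∣                                  ≡⟨ ℚ.0≤p⇒∣p∣≡p (ℚ.<⇒≤ (ℚ.positive⁻¹ (inv n) {{inv-pos n}})) ⟩
    inv n                                      ≡⟨ sym (ℚ.*-identityʳ (inv n)) ⟩
    inv n ℚ.* 1ℚ                               ≡⟨ cong (inv n ℚ.*_) (sym (ℚ.*-inverseʳ ε)) ⟩
    inv n ℚ.* (ε ℚ.* E)                        ≤⟨ ℚ.*-monoˡ-≤-nonNeg (inv n) {{ℚ.pos⇒nonNeg (inv n) {{inv-pos n}}}}
                                                    (ℚ.*-monoʳ-≤-nonNeg E {{ℚ.pos⇒nonNeg E {{E-pos}}}} (ℚ.p≤q⊔p (seq x n) ε)) ⟩
    inv n ℚ.* ((seq x n ℚ.⊔ ε) ℚ.* E)          ≡⟨ sym (ℚ.*-assoc (inv n) (seq x n ℚ.⊔ ε) E) ⟩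
    (inv n ℚ.* (seq x n ℚ.⊔ ε)) ℚ.* E          ≡⟨ cong (ℚ._* E) (ℚ.*-inverseˡ (seq x n ℚ.⊔ ε)) ⟩
    1ℚ ℚ.* E                                   ≡⟨ ℚ.*-identityˡ E ⟩
    E                                          ∎
    where open ℚ.≤-Reasoning

  inv-difference : ∀ m n → inv m ℚ.* (inv n ℚ.* ((seq x n ℚ.⊔ ε) ℚ.- (seq x m ℚ.⊔ ε))) ≡ inv m ℚ.- inv n
  inv-difference m n = begin
    inv m ℚ.* (inv n ℚ.* (b ℚ.- a))                           ≡⟨ cong (inv m ℚ.*_) (*-distribˡ-- (inv n) b a) ⟩
    inv m ℚ.* (inv n ℚ.* b ℚ.- inv n ℚ.* a)                   ≡⟨ *-distribˡ-- (inv m) (inv n ℚ.* b) (inv n ℚ.* a) ⟩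
    inv m ℚ.* (inv n ℚ.* b) ℚ.- inv m ℚ.* (inv n ℚ.* a)       ≡⟨ cong₂ ℚ._-_ eq₁ eq₂ ⟩
    inv m ℚ.- inv n                                           ∎
    where
    open ≡-Reasoning
    a b : ℚ
    a = seq x m ℚ.⊔ ε
    b = seq x n ℚ.⊔ ε
    eq₁ : inv m ℚ.* (inv n ℚ.* b) ≡ inv m
    eq₁ = trans (cong (inv m ℚ.*_) (ℚ.*-inverseˡ b)) (ℚ.*-identityʳ (inv m))
    eq₂ : inv m ℚ.* (inv n ℚ.* a) ≡ inv n
    eq₂ = begin
      inv m ℚ.* (inv n ℚ.* a)    ≡⟨ cong (inv m ℚ.*_) (ℚ.*-comm (inv n) a) ⟩
      inv m ℚ.* (a ℚ.* inv n)    ≡⟨ sym (ℚ.*-assoc (inv m) a (inv n)) ⟩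
      (inv m ℚ.* a) ℚ.* inv n    ≡⟨ cong (ℚ._* inv n) (ℚ.*-inverseˡ a) ⟩
      1ℚ ℚ.* inv n               ≡⟨ ℚ.*-identityˡ (inv n) ⟩
      inv n                      ∎

  untruncated : ∀ n → N ℕ.≤ n → seq x n ℚ.⊔ ε ≡ seq x n
  untruncated n N≤n = ℚ.p≥q⇒p⊔q≡p (subst (ℚ._≤ seq x n) (ℚ.+-identityˡ ε) (ε≤x n N≤n))

  abstract
    prf : IsCauchy inv
    prf η η>0 with shrink (ℚ.positive⁻¹ E {{E-pos}}) η>0
    ... | δ , δ>0 , hδ with shrink (ℚ.positive⁻¹ E {{E-pos}}) δ>0
    ... | θ , θ>0 , hθ with cauchy x θ θ>0
    ... | M , hM = N ℕ.⊔ M , λ m n m≥ n≥ →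
      subst (λ z → ∣ z ∣ ℚ.< η) (inv-difference m n)
        (*-<-bound {inv m} (ℚ.positive⁻¹ E {{E-pos}}) (inv≤E m)
          (hδ _ (*-<-bound {inv n} (ℚ.positive⁻¹ E {{E-pos}}) (inv≤E n)
            (hθ _ (subst (λ z → ∣ z ∣ ℚ.< θ)
              (sym (cong₂ ℚ._-_ (untruncated n (ℕ.m⊔n≤o⇒m≤o N M n≥)) (untruncated m (ℕ.m⊔n≤o⇒m≤o N M m≥))))
              (hM n m (ℕ.m⊔n≤o⇒n≤o N M n≥) (ℕ.m⊔n≤o⇒n≤o N M m≥)))))))

infixl 7 _/_⟨_⟩

_/_⟨_⟩ : (x y : ℝ) → 0ℝ < y → ℝ
x / y ⟨ y>0 ⟩ = x * recip y y>0

toℝ-pos : ∀ n → 0ℝ < toℝ (suc n)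
toℝ-pos n = mk< ε (ℚ.positive⁻¹ ε {{ℚ.normalize-pos (suc n) 1}}) 0 λ _ _ → ℚ.≤-reflexive (ℚ.+-identityˡ ε)
  where
  ε : ℚ
  ε = + suc n ℚ./ 1

ℝ-rawRing : RawRing 0ℓ 0ℓ
ℝ-rawRing = record
  { Carrier = ℝ ; _≈_ = _≈_ ; _+_ = _+_ ; _*_ = _*_ ; -_ = -_ ; 0# = 0ℝ ; 1# = 1ℝ }

open RawSemiringDefs (RawRing.rawSemiring ℝ-rawRing) public using (sum; product; _^_)

-- For x > 0, the value is the unique positive real x^(p/q).
record RationalPower (x : ℝ) (p q : ℕ) .{{_ : ℕ.NonZero q}} : Set where
  field
    value    : ℝ
    positive : 0ℝ < value
    power    : value ^ q ≈ x ^ p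

Matrix : ℕ → Set
Matrix n = Fin n → Fin n → ℝ

diagonal : ∀ {n} → (Fin n → ℝ) → Matrix n
diagonal a i j = if does (i Fin.≟ j) then a i else 0ℝ

_⊖_ : ∀ {n} → Matrix n → Matrix n → Matrix n
(A ⊖ B) i j = A i j - B i j

-- Laplace expansion along the first row.
det : ∀ {n} → Matrix n → ℝ
det {zero}  A = 1ℝ
det {suc n} A = sum λ j → (- 1ℝ) ^ toℕ j * A zero j * det (λ i k → A (suc i) (punchIn j k))

-- The eigenvalues with multiplicity are the roots of the characteristic polynomial
-- det (t I - A); over ℝ, equality of polynomials is equality at every t.
record IsSpectrum {n} (A : Matrix n) (μ : Fin n → ℝ) : Set where
  field
    nondecreasing : ∀ {i j} → i Fin.≤ j → μ i ≤ μ j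
    charpoly      : ∀ t → det (diagonal (λ _ → t) ⊖ A) ≈ product (λ i → t - μ i)

record WeightedGraph (n : ℕ) : Set₁ where
  field
    _∼_      : Rel (Fin n) 0ℓ
    _∼?_     : Decidable _∼_
    ∼-sym    : Symmetric _∼_
    ∼-irrefl : Irreflexive _≡_ _∼_
    weight   : Fin n → Fin n → ℝ
    weight-sym     : ∀ u v → weight u v ≈ weight v u
    weight-edge    : ∀ {u v} → u ∼ v → 0ℝ < weight u v
    weight-nonEdge : ∀ {u v} → ¬ (u ∼ v) → weight u v ≈ 0ℝ

module _ {n} (G : WeightedGraph n) where
  open WeightedGraph G

  edgeCount : ℕ
  edgeCount = length (filter (λ (u , v) → (u Fin.<? v) ×-dec (u ∼? v)) (cartesianProduct (allFin n) (allFin n)))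

  weightedDegree : Fin n → ℝ
  weightedDegree u = sum (weight u)

  laplacian : Matrix n
  laplacian = diagonal weightedDegree ⊖ weight

  -- A simple cycle with suc k vertices, hence suc k edges.
  record IsCycle {k} (c : Fin (suc k) → Fin n) : Set where
    field
      length≥3 : 3 ℕ.≤ suc k
      distinct : Injective _≡_ _≡_ c
      step     : ∀ i → c (inject₁ i) ∼ c (suc i)
      closing  : c (Fin.fromℕ k) ∼ c zero

  HasCycle : ℕ → Set
  HasCycle zero    = ⊥
  HasCycle (suc k) = ∃[ c ] IsCycle {k} c

  -- ⊤⁺ is girth +∞.
  IsGirth : ℕ ⁺ → Set
  IsGirth [ g ] = HasCycle g × (∀ k → HasCycle k → g ℕ.≤ k)
  IsGirth ⊤⁺    = ∀ k → ¬ HasCycle k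

infix 4 _≤⁺_

_≤⁺_ : ℝ → ℕ ⁺ → Set
x ≤⁺ [ k ] = x ≤ toℝ k
x ≤⁺ ⊤⁺    = ⊤

{-# OPTIONS --safe #-}
module Submission where

-- Suppose the bound fails, and scale the weights so that λ₂ = 1. Then the Rayleigh quotients on 1^⊥ lie between 1 and
-- 1 + 4/√d, so every weighted degree is at least 1 - 1/n and every single weight is O(1/√d). For a vertex r let f_r map v to
-- the sum, over the simple paths of length at most K ≈ d^⅛ from r to v, of the product of the square roots of their weights;
-- by the girth hypothesis there is at most one such path. Split f_r = p + q by the parity of the length. The Rayleigh quotients
-- at p + q and p - q bound 4 ⟨p, W q⟩ by (λₙ - 1)(|p|² + |q|²) plus a small term coming from ⟨f_r, 1⟩; the degrees cancel.
-- Summed over r, |p|² + |q|² is about (K + 1) n, and ⟨p, W q⟩ is about K Σ w^(3/2), at least K n/√d by convexity.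
--
-- The spectrum is accessible only through det (t I - L). If L - t is positive semidefinite on 1^⊥ and x·(L - t)x is small, then
-- (L - t)x is small, and Cramer's rule makes det (L - t) small. Hence semidefiniteness persists while t runs through a fine mesh
-- of points at which the determinant, known from the eigenvalues, is large. As a mesh is finite, all of this takes place at one
-- large index of the Cauchy sequences, where every quantity is rational.

open import Algebra.Bundles using (CommutativeRing)
open import Data.Bool using (if_then_else_; true; false)
open import Data.Bool.Properties using (∧-zeroʳ)
open import Data.Empty using (⊥; ⊥-elim)
open import Data.Fin as Fin using (Fin; zero; suc; toℕ; fromℕ; inject₁; punchIn; lift)
import Data.Fin.Properties as Fin
import Data.Integer as ℤ
import Data.Integer.Properties as ℤ
open import Data.List using (List; []; _∷_; _++_; _∷ʳ_; length; map; filter; tabulate; allFin; cartesianProduct)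
open import Data.List.Membership.Propositional using (_∈_; _∉_)
open import Data.List.Properties using (∷-injectiveˡ; ∷-injectiveʳ)
open import Data.List.Relation.Unary.Any using (here; there; any?)
open import Data.Nat as ℕ using (ℕ; zero; suc; z≤n; s≤s)
import Data.Nat.Properties as ℕ
open import Data.Product using (∃-syntax; _×_; _,_; proj₁; proj₂)
import Data.Rational.Unnormalised as ℚᵘ
import Data.Rational.Unnormalised.Properties as ℚᵘ
open import Data.Sum using (_⊎_; inj₁; inj₂)
open import Data.Vec.Functional using (updateAt)
open import Data.Vec.Functional.Properties using (updateAt-updates; updateAt-minimal)
open import Function using (_∘_; id; Injective)
open import Relation.Binary.Definitions using (tri<; tri≈; tri>)
open import Relation.Binary.PropositionalEquality
open import Relation.Nullary using (¬_; Dec; yes; no; does; contradiction)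
open import Relation.Nullary.Construct.Add.Supremum using (_⁺; [_]; ⊤⁺)
open import Relation.Nullary.Decidable using (_×-dec_; dec-true; dec-false)
import Defs as R

-- The error d^(-5/8) is 4/√d times d^(-1/8). It comes from counting: a path function with `K + 1`
-- levels has only `K` layers of edges between them, and the girth keeps `K` near d^(1/8). The
-- remaining losses are of no larger order. Keeping paths simple excludes at most `K + 1` vertices
-- at each step, each of weight O(1/√d). The inner product with the constant vector is controlled
-- one level beyond the test vector: from level to level the sums of the entries grow by a factor of
-- order d^(1/4), while the squared norm of level `K + 1` stays bounded, so Cauchy-Schwarz on that
-- level bounds all earlier sums. Hence paths of length `K + 1` must be unique too, which is why
-- cycles of length up to 2(K + 1) are excluded. In the rational computation `y = 1 / (K + 3)` takes
-- the place of d^(-1/8), so that y⁴ is close to 1/√d and y⁵ to d^(-5/8). Such a replacement is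
-- accurate only for large d. For small d a violation is impossible, because λ₂ ≤ λₙ and the claimed
-- lower bound is below 1.

-- Ordered-field arithmetic of the rationals, finite sums and powers.

module Rationals where

  open import Data.Rational public
    using (ℚ; mkℚ; 0ℚ; 1ℚ; ½; _+_; _*_; _-_; -_; _/_; 1/_; ∣_∣; _⊔_; _⊓_; _≤_; _<_; *≤*; *<*; NonZero; Positive; positive; nonNegative; toℚᵘ; +-*-rawSemiring)
  open import Data.Rational.Properties public
  open import Data.Rational.Solver
  open +-*-Solver public using (solve; _:=_; _:+_; _:*_; _:-_; :-_; con; Polynomial)
  open import Algebra.Properties.Semiring.Sum (CommutativeRing.semiring +-*-commutativeRing) public
    using (sum-cong-≗; ∑-distrib-+; ∑-comm; *-distribˡ-sum; *-distribʳ-sum)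
  open import Algebra.Definitions.RawSemiring +-*-rawSemiring public using (sum; product; _^_)

  -- Opaque, so that type checking never unfolds the gcd normalisation inside `_/_` on open terms;
  -- `ι-def` gives access to the value where a literal is wanted.
  abstract
    ι : ℕ → ℚ
    ι n = ℤ.+ n / 1

    ι-def : ∀ n → ι n ≡ ℤ.+ n / 1
    ι-def n = refl

  0≤1 : 0ℚ ≤ 1ℚ
  0≤1 = *≤* (ℤ.+≤+ z≤n)

  0≤½ : 0ℚ ≤ ½
  0≤½ = *≤* (ℤ.+≤+ z≤n)

  0<1 : 0ℚ < 1ℚ
  0<1 = *<* (ℤ.+<+ (s≤s z≤n))

  -- The form of almost every estimate below: the slack `e` is written down explicitly as a sum of
  -- products of nonnegative quantities, and the ring solver checks the identity.
  ≤-by : ∀ {p q} e → 0ℚ ≤ e → q ≡ p + e → p ≤ q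
  ≤-by {p} e h eq = subst₂ _≤_ (+-identityʳ p) (sym eq) (+-monoʳ-≤ p h)

  <-by : ∀ {p q} e → 0ℚ < e → q ≡ p + e → p < q
  <-by {p} e h eq = subst₂ _<_ (+-identityʳ p) (sym eq) (+-monoʳ-< p h)

  0≤Δ : ∀ {p q} → p ≤ q → 0ℚ ≤ q - p
  0≤Δ {p} {q} h = subst (_≤ q - p) (+-inverseʳ p) (+-monoˡ-≤ (- p) h)

  0≤+ : ∀ {p q} → 0ℚ ≤ p → 0ℚ ≤ q → 0ℚ ≤ p + q
  0≤+ = +-mono-≤

  0≤* : ∀ {p q} → 0ℚ ≤ p → 0ℚ ≤ q → 0ℚ ≤ p * q
  0≤* {p} {q} h k = subst (_≤ p * q) (*-zeroʳ p) (*-monoˡ-≤-nonNeg p {{nonNegative h}} k)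

  0<* : ∀ {p q} → 0ℚ < p → 0ℚ < q → 0ℚ < p * q
  0<* {p} {q} h k = subst (_< p * q) (*-zeroʳ p) (*-monoʳ-<-pos p {{positive h}} k)

  *-monoˡ : ∀ {p q} r → 0ℚ ≤ r → p ≤ q → r * p ≤ r * q
  *-monoˡ r h = *-monoˡ-≤-nonNeg r {{nonNegative h}}

  *-monoʳ : ∀ {p q} r → 0ℚ ≤ r → p ≤ q → p * r ≤ q * r
  *-monoʳ r h = *-monoʳ-≤-nonNeg r {{nonNegative h}}

  *-mono : ∀ {p q r s} → 0ℚ ≤ p → p ≤ q → 0ℚ ≤ r → r ≤ s → p * r ≤ q * s
  *-mono {p} {q} {r} {s} 0≤p p≤q 0≤r r≤s =
    ≤-trans (*-monoˡ p 0≤p r≤s) (*-monoʳ s (≤-trans 0≤r r≤s) p≤q)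

  0≤-square : ∀ p → 0ℚ ≤ p * p
  0≤-square p with ≤-total 0ℚ p
  ... | inj₁ h = 0≤* h h
  ... | inj₂ h = subst (0ℚ ≤_) (solve 1 (λ p → :- p :* :- p := p :* p) refl p)
    (0≤* (neg-antimono-≤ h) (neg-antimono-≤ h))

  ∣∣*∣∣ : ∀ p → ∣ p ∣ * ∣ p ∣ ≡ p * p
  ∣∣*∣∣ p = trans (sym (∣p*q∣≡∣p∣*∣q∣ p p)) (0≤p⇒∣p∣≡p (0≤-square p))

  p≤∣p∣ : ∀ p → p ≤ ∣ p ∣
  p≤∣p∣ p with ≤-total 0ℚ p
  ... | inj₁ h = ≤-reflexive (sym (0≤p⇒∣p∣≡p h))
  ... | inj₂ h = ≤-trans h (0≤∣p∣ p)

  -p≤∣p∣ : ∀ p → - p ≤ ∣ p ∣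
  -p≤∣p∣ p = subst (- p ≤_) (∣-p∣≡∣p∣ p) (p≤∣p∣ (- p))

  square-≤⁻¹ : ∀ {p q} → 0ℚ ≤ q → p * p ≤ q * q → p ≤ q
  square-≤⁻¹ {p} {q} 0≤q h with p ≤? q
  ... | yes p≤q = p≤q
  ... | no p≰q = contradiction (≤-<-trans h q²<p²) (<-irrefl refl)
    where
    q<p = ≰⇒> p≰q
    q²<p² : q * q < p * p
    q²<p² = ≤-<-trans (*-monoˡ q 0≤q (<⇒≤ q<p)) (*-monoˡ-<-pos p {{positive (≤-<-trans 0≤q q<p)}} q<p)

  0<-square : ∀ {p} → 0ℚ < p → 0ℚ < p * p
  0<-square h = 0<* h h

  inverse : ∀ a → 0ℚ < a → ∃[ b ] 0ℚ < b × a * b ≡ 1ℚ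
  inverse a h = b , positive⁻¹ b {{1/pos⇒pos a {{positive h}}}} , *-inverseʳ a {{nz}}
    where
    nz : NonZero a
    nz = pos⇒nonZero a {{positive h}}
    b = (1/ a) {{nz}}

  *-cancelʳ-≤ : ∀ {p q} r → 0ℚ < r → p * r ≤ q * r → p ≤ q
  *-cancelʳ-≤ r h = *-cancelʳ-≤-pos r {{positive h}}

  *-cancelˡ-≤ : ∀ {p q} r → 0ℚ < r → r * p ≤ r * q → p ≤ q
  *-cancelˡ-≤ r h = *-cancelˡ-≤-pos r {{positive h}}

  *-cancelʳ-< : ∀ {p q} r → 0ℚ ≤ r → p * r < q * r → p < q
  *-cancelʳ-< r h = *-cancelʳ-<-nonNeg r {{nonNegative h}}

  p*p≡0 : ∀ p → p * p ≡ 0ℚ → p ≡ 0ℚ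
  p*p≡0 p h = ≤-antisym (square-≤⁻¹ ≤-refl (≤-reflexive h))
    (subst (0ℚ ≤_) (solve 1 (λ p → :- (:- p) := p) refl p)
      (neg-antimono-≤ (square-≤⁻¹ { - p} ≤-refl (≤-reflexive (trans (solve 1 (λ p → :- p :* :- p := p :* p) refl p) h)))))

  private
    fromℚᵘ-homo : ∀ m n k (_∙_ : ℚ → ℚ → ℚ) (_∙ᵘ_ : ℚᵘ.ℚᵘ → ℚᵘ.ℚᵘ → ℚᵘ.ℚᵘ) →
      (∀ p q → toℚᵘ (p ∙ q) ℚᵘ.≃ (toℚᵘ p ∙ᵘ toℚᵘ q)) →
      (∀ {p q r s} → p ℚᵘ.≃ q → r ℚᵘ.≃ s → (p ∙ᵘ r) ℚᵘ.≃ (q ∙ᵘ s)) →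
      ℚᵘ.mkℚᵘ (ℤ.+ k) 0 ℚᵘ.≃ (ℚᵘ.mkℚᵘ (ℤ.+ m) 0 ∙ᵘ ℚᵘ.mkℚᵘ (ℤ.+ n) 0) →
      ℤ.+ k / 1 ≡ (ℤ.+ m / 1) ∙ (ℤ.+ n / 1)
    fromℚᵘ-homo m n k _∙_ _∙ᵘ_ homo ∙-cong eq = toℚᵘ-injective
      (ℚᵘ.≃-trans (toℚᵘ-fromℚᵘ (ℚᵘ.mkℚᵘ (ℤ.+ k) 0)) (ℚᵘ.≃-trans eq (ℚᵘ.≃-sym
        (ℚᵘ.≃-trans (homo (ℤ.+ m / 1) (ℤ.+ n / 1))
          (∙-cong (toℚᵘ-fromℚᵘ (ℚᵘ.mkℚᵘ (ℤ.+ m) 0)) (toℚᵘ-fromℚᵘ (ℚᵘ.mkℚᵘ (ℤ.+ n) 0)))))))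

  abstract
    ι-+ : ∀ m n → ι (m ℕ.+ n) ≡ ι m + ι n
    ι-+ m n = fromℚᵘ-homo m n (m ℕ.+ n) _+_ ℚᵘ._+_ toℚᵘ-homo-+ ℚᵘ.+-cong
      (ℚᵘ.*≡* (cong (ℤ._* ℤ.+ 1) (sym (cong₂ ℤ._+_ (ℤ.*-identityʳ (ℤ.+ m)) (ℤ.*-identityʳ (ℤ.+ n))))))

    0≤ι : ∀ n → 0ℚ ≤ ι n
    0≤ι n = nonNegative⁻¹ (ℤ.+ n / 1) {{normalize-nonNeg n 1}}

    0<ι-suc : ∀ n → 0ℚ < ι (suc n)
    0<ι-suc n = positive⁻¹ (ℤ.+ suc n / 1) {{normalize-pos (suc n) 1}}

  ι-suc : ∀ n → ι (suc n) ≡ 1ℚ + ι n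
  ι-suc n = trans (ι-+ 1 n) (cong (_+ ι n) (ι-def 1))

  ι-mono : ∀ {m n} → m ℕ.≤ n → ι m ≤ ι n
  ι-mono {m} {n} h = ≤-by (ι (n ℕ.∸ m)) (0≤ι (n ℕ.∸ m)) (trans (cong ι (sym (ℕ.m+[n∸m]≡n h))) (ι-+ m (n ℕ.∸ m)))

  archimedean : ∀ p → ∃[ n ] p ≤ ι n
  archimedean p@(mkℚ k d _) = ℤ.∣ k ∣ , subst (p ≤_) (sym (ι-def ℤ.∣ k ∣)) (toℚᵘ-cancel-≤
      (ℚᵘ.≤-respʳ-≃ (ℚᵘ.≃-sym (toℚᵘ-fromℚᵘ (ℚᵘ.mkℚᵘ (ℤ.+ ℤ.∣ k ∣) 0))) (ℚᵘ.*≤* (bound k))))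
    where
    bound : ∀ k → k ℤ.* ℤ.+ 1 ℤ.≤ ℤ.+ ℤ.∣ k ∣ ℤ.* ℤ.+ suc d
    bound (ℤ.+ n) = subst₂ ℤ._≤_ (ℤ.pos-* n 1) (ℤ.pos-* n (suc d)) (ℤ.+≤+ (ℕ.*-monoʳ-≤ n (s≤s z≤n)))
    bound ℤ.-[1+ n ] = ℤ.-≤+

  ∑-mono : ∀ {n} {f g : Fin n → ℚ} → (∀ i → f i ≤ g i) → sum f ≤ sum g
  ∑-mono {zero} h = ≤-refl
  ∑-mono {suc n} h = +-mono-≤ (h zero) (∑-mono (λ i → h (suc i)))

  ∑-zero : ∀ {n} {f : Fin n → ℚ} → (∀ i → f i ≡ 0ℚ) → sum f ≡ 0ℚ
  ∑-zero {zero} h = refl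
  ∑-zero {suc n} h = cong₂ _+_ (h zero) (∑-zero (λ i → h (suc i)))

  0≤∑ : ∀ {n} {f : Fin n → ℚ} → (∀ i → 0ℚ ≤ f i) → 0ℚ ≤ sum f
  0≤∑ {zero} h = ≤-refl
  0≤∑ {suc n} h = 0≤+ (h zero) (0≤∑ (λ i → h (suc i)))

  ∑-const : ∀ n c → sum {n} (λ _ → c) ≡ ι n * c
  ∑-const zero c = sym (trans (cong (_* c) (ι-def 0)) (*-zeroˡ c))
  ∑-const (suc n) c = trans (cong (λ s → c + s) (∑-const n c))
    (trans (solve 2 (λ c n → c :+ n :* c := (con 1ℚ :+ n) :* c) refl c (ι n)) (cong (_* c) (sym (ι-suc n))))

  term≤∑ : ∀ {n} {f : Fin n → ℚ} → (∀ i → 0ℚ ≤ f i) → ∀ i → f i ≤ sum f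
  term≤∑ {f = f} h zero = ≤-by (sum (λ i → f (suc i))) (0≤∑ (λ i → h (suc i))) refl
  term≤∑ {f = f} h (suc i) = ≤-trans (term≤∑ (λ i → h (suc i)) i)
    (≤-by (f zero) (h zero) (+-comm (f zero) _))

  ∑-linear : ∀ {n} a b (f g : Fin n → ℚ) → sum (λ i → a * f i + b * g i) ≡ a * sum f + b * sum g
  ∑-linear a b f g = trans (∑-distrib-+ (λ i → a * f i) (λ i → b * g i))
    (sym (cong₂ _+_ (*-distribˡ-sum a f) (*-distribˡ-sum b g)))

  ∑-distrib-- : ∀ {n} (f g : Fin n → ℚ) → sum (λ i → f i - g i) ≡ sum f - sum g
  ∑-distrib-- f g = trans (sum-cong-≗ (λ i → cong₂ _+_ (sym (*-identityˡ (f i))) (neg-as-* (g i))))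
    (trans (∑-linear 1ℚ (- 1ℚ) f g) (cong₂ _+_ (*-identityˡ (sum f)) (sym (neg-as-* (sum g)))))
    where
    neg-as-* : ∀ p → - p ≡ - 1ℚ * p
    neg-as-* = solve 1 (λ p → :- p := con (- 1ℚ) :* p) refl

  δ : ∀ {n} → Fin n → Fin n → ℚ
  δ i j = if does (i Fin.≟ j) then 1ℚ else 0ℚ

  δ-refl : ∀ {n} (i : Fin n) → δ i i ≡ 1ℚ
  δ-refl i with i Fin.≟ i
  ... | yes _ = refl
  ... | no i≢i = contradiction refl i≢i

  δ-≢ : ∀ {n} {i j : Fin n} → i ≢ j → δ i j ≡ 0ℚ
  δ-≢ {i = i} {j} i≢j with i Fin.≟ j
  ... | yes i≡j = contradiction i≡j i≢j
  ... | no _ = refl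

  δ-sym : ∀ {n} (i j : Fin n) → δ i j ≡ δ j i
  δ-sym i j with i Fin.≟ j
  ... | yes refl = sym (δ-refl i)
  ... | no i≢j = sym (δ-≢ (λ eq → i≢j (sym eq)))

  ∑-single : ∀ {n} {f : Fin n → ℚ} i → (∀ j → j ≢ i → f j ≡ 0ℚ) → sum f ≡ f i
  ∑-single {f = f} zero h = trans (cong (_+_ (f zero)) (∑-zero (λ j → h (suc j) (λ ())))) (+-identityʳ _)
  ∑-single {f = f} (suc i) h = trans (cong₂ _+_ (h zero (λ ())) (∑-single i (λ j j≢i → h (suc j) (λ eq → j≢i (Fin.suc-injective eq))))) (+-identityˡ _)

  ∑-δ : ∀ {n} (f : Fin n → ℚ) i → sum (λ j → δ i j * f j) ≡ f i
  ∑-δ f i = trans (∑-single i (λ j j≢i → trans (cong (_* f j) (δ-≢ (λ eq → j≢i (sym eq)))) (*-zeroˡ (f j))))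
    (trans (cong (_* f i) (δ-refl i)) (*-identityˡ (f i)))

  ∣∑∣≤ : ∀ {n} (f : Fin n → ℚ) → ∣ sum f ∣ ≤ sum (λ i → ∣ f i ∣)
  ∣∑∣≤ {zero} f = ≤-refl
  ∣∑∣≤ {suc n} f = ≤-trans (∣p+q∣≤∣p∣+∣q∣ (f zero) _) (+-monoʳ-≤ ∣ f zero ∣ (∣∑∣≤ (λ i → f (suc i))))

  0≤^ : ∀ {p} n → 0ℚ ≤ p → 0ℚ ≤ p ^ n
  0≤^ zero h = 0≤1
  0≤^ (suc n) h = 0≤* h (0≤^ n h)

  0<^ : ∀ {p} n → 0ℚ < p → 0ℚ < p ^ n
  0<^ zero h = 0<1
  0<^ (suc n) h = 0<* h (0<^ n h)

  ^-mono : ∀ {p q} n → 0ℚ ≤ p → p ≤ q → p ^ n ≤ q ^ n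
  ^-mono zero h k = ≤-refl
  ^-mono (suc n) h k = *-mono h k (0≤^ n h) (^-mono n h k)

  ^-cancel-≤ : ∀ {p q} n → 0ℚ ≤ q → p ^ suc n ≤ q ^ suc n → p ≤ q
  ^-cancel-≤ {p} {q} n h k with p ≤? q
  ... | yes p≤q = p≤q
  ... | no p≰q = contradiction (≤-<-trans k lt) (<-irrefl refl)
    where
    q<p = ≰⇒> p≰q
    0<p = ≤-<-trans h q<p
    lt : q * q ^ n < p * p ^ n
    lt = ≤-<-trans (*-monoˡ q h (^-mono n h (<⇒≤ q<p))) (*-monoˡ-<-pos (p ^ n) {{positive (0<^ n 0<p)}} q<p)

  ^-+ : ∀ p m n → p ^ (m ℕ.+ n) ≡ p ^ m * p ^ n
  ^-+ p zero n = sym (*-identityˡ (p ^ n))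
  ^-+ p (suc m) n = trans (cong (p *_) (^-+ p m n)) (sym (*-assoc p (p ^ m) (p ^ n)))

-- Determinants by Laplace expansion: multilinearity, alternation, a size bound.

module Determinants where

  open Rationals

  Mat : ℕ → Set
  Mat n = Fin n → Fin n → ℚ

  sgn : ∀ {n} → Fin n → ℚ
  sgn j = (- 1ℚ) ^ toℕ j

  minor : ∀ {n} → Mat (suc n) → Fin (suc n) → Mat n
  minor A j i k = A (suc i) (punchIn j k)

  detℚ : ∀ {n} → Mat n → ℚ
  detℚ {zero}  A = 1ℚ
  detℚ {suc n} A = sum λ j → sgn j * A zero j * detℚ (minor A j)

  det-cong : ∀ {n} {A B : Mat n} → (∀ i j → A i j ≡ B i j) → detℚ A ≡ detℚ B
  det-cong {zero} h = refl
  det-cong {suc n} h = sum-cong-≗ λ j → cong₂ _*_ (cong (sgn j *_) (h zero j)) (det-cong (λ i k → h (suc i) (punchIn j k)))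

  det-linear : ∀ {n} {A B C : Mat n} i a b →
    (∀ k → k ≢ i → ∀ j → A k j ≡ B k j) → (∀ k → k ≢ i → ∀ j → A k j ≡ C k j) →
    (∀ j → A i j ≡ a * B i j + b * C i j) → detℚ A ≡ a * detℚ B + b * detℚ C
  det-linear {suc n} {A} {B} {C} zero a b hB hC h = trans (sum-cong-≗ λ j → begin
      sgn j * A zero j * detℚ (minor A j)
        ≡⟨ cong (λ z → sgn j * z * detℚ (minor A j)) (h j) ⟩
      sgn j * (a * B zero j + b * C zero j) * detℚ (minor A j)
        ≡⟨ solve 6 (λ s a x b y d → s :* (a :* x :+ b :* y) :* d := a :* (s :* x :* d) :+ b :* (s :* y :* d)) refl
             (sgn j) a (B zero j) b (C zero j) (detℚ (minor A j)) ⟩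
      a * (sgn j * B zero j * detℚ (minor A j)) + b * (sgn j * C zero j * detℚ (minor A j))
        ≡⟨ cong₂ (λ y z → a * (sgn j * B zero j * y) + b * (sgn j * C zero j * z))
             (det-cong (λ i k → hB (suc i) (λ ()) (punchIn j k))) (det-cong (λ i k → hC (suc i) (λ ()) (punchIn j k))) ⟩
      a * (sgn j * B zero j * detℚ (minor B j)) + b * (sgn j * C zero j * detℚ (minor C j)) ∎)
    (∑-linear a b (λ j → sgn j * B zero j * detℚ (minor B j)) (λ j → sgn j * C zero j * detℚ (minor C j)))
    where open ≡-Reasoning
  det-linear {suc n} {A} {B} {C} (suc i) a b hB hC h = trans (sum-cong-≗ λ j → begin
      sgn j * A zero j * detℚ (minor A j)
        ≡⟨ cong (sgn j * A zero j *_) (det-linear i a b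
             (λ k k≢i l → hB (suc k) (k≢i ∘ Fin.suc-injective) (punchIn j l))
             (λ k k≢i l → hC (suc k) (k≢i ∘ Fin.suc-injective) (punchIn j l))
             (λ l → h (punchIn j l))) ⟩
      sgn j * A zero j * (a * detℚ (minor B j) + b * detℚ (minor C j))
        ≡⟨ solve 6 (λ s x a y b z → s :* x :* (a :* y :+ b :* z) := a :* (s :* x :* y) :+ b :* (s :* x :* z)) refl
             (sgn j) (A zero j) a (detℚ (minor B j)) b (detℚ (minor C j)) ⟩
      a * (sgn j * A zero j * detℚ (minor B j)) + b * (sgn j * A zero j * detℚ (minor C j))
        ≡⟨ cong₂ (λ y z → a * (sgn j * y * detℚ (minor B j)) + b * (sgn j * z * detℚ (minor C j)))
             (hB zero (λ ()) j) (hC zero (λ ()) j) ⟩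
      a * (sgn j * B zero j * detℚ (minor B j)) + b * (sgn j * C zero j * detℚ (minor C j)) ∎)
    (∑-linear a b (λ j → sgn j * B zero j * detℚ (minor B j)) (λ j → sgn j * C zero j * detℚ (minor C j)))
    where open ≡-Reasoning

  -- Both expansion steps of a determinant whose first two rows are u; T is the remaining minor as a function of the columns kept.
  twoRows : ∀ n (u : Fin (suc (suc n)) → ℚ) (T : (Fin n → Fin (suc (suc n))) → ℚ) → Fin (suc (suc n)) → ℚ
  twoRows n u T j = sum λ k → sgn k * u (punchIn j k) * T (λ l → punchIn j (punchIn k l))

  -- Column 0 in the first row with column `suc j` in the second gives the same product as the
  -- reverse choice, with the opposite sign. The choices avoiding column 0 form a sum of the same
  -- shape over the other columns; column 0 is then always among the columns kept, which is what
  -- `lift 1` expresses.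
  twoRows-cancel : ∀ n (u : Fin (suc (suc n)) → ℚ) (T : (Fin n → Fin (suc (suc n))) → ℚ) →
    (∀ φ ψ → (∀ l → φ l ≡ ψ l) → T φ ≡ T ψ) →
    sum (λ j → sgn j * u j * twoRows n u T j) ≡ 0ℚ
  twoRows-cancel n u T T-cong = begin
    1ℚ * u zero * first + sum (λ j → (- 1ℚ * sgn j) * u (suc j) * (1ℚ * u zero * T (λ l → suc (punchIn j l)) + inner j))
      ≡⟨ cong (1ℚ * u zero * first +_) (sum-cong-≗ (λ j → solve 6 (λ s x e y t r →
           (con (- 1ℚ) :* s) :* x :* (e :* y :* t :+ r) := (:- (e :* y)) :* (s :* x :* t) :+ con (- 1ℚ) :* (s :* x :* r)) refl
           (sgn j) (u (suc j)) 1ℚ (u zero) (T (λ l → suc (punchIn j l))) (inner j))) ⟩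
    1ℚ * u zero * first + sum (λ j → (- (1ℚ * u zero)) * (sgn j * u (suc j) * T (λ l → suc (punchIn j l))) + - 1ℚ * (sgn j * u (suc j) * inner j))
      ≡⟨ cong (1ℚ * u zero * first +_) (∑-linear (- (1ℚ * u zero)) (- 1ℚ) (λ j → sgn j * u (suc j) * T (λ l → suc (punchIn j l))) (λ j → sgn j * u (suc j) * inner j)) ⟩
    1ℚ * u zero * first + (- (1ℚ * u zero) * first + - 1ℚ * sum (λ j → sgn j * u (suc j) * inner j))
      ≡⟨ solve 3 (λ e x r → e :* x :+ ((:- e) :* x :+ con (- 1ℚ) :* r) := con (- 1ℚ) :* r) refl (1ℚ * u zero) first (sum (λ j → sgn j * u (suc j) * inner j)) ⟩
    - 1ℚ * sum (λ j → sgn j * u (suc j) * inner j)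
      ≡⟨ cong (- 1ℚ *_) (rest n u T T-cong) ⟩
    - 1ℚ * 0ℚ ∎
    where
    open ≡-Reasoning
    first = sum (λ k → sgn k * u (suc k) * T (λ l → suc (punchIn k l)))
    inner : Fin (suc n) → ℚ
    inner j = sum (λ k → sgn (suc k) * u (suc (punchIn j k)) * T (λ l → punchIn (suc j) (punchIn (suc k) l)))
    rest : ∀ n (u : Fin (suc (suc n)) → ℚ) (T : (Fin n → Fin (suc (suc n))) → ℚ) → (∀ φ ψ → (∀ l → φ l ≡ ψ l) → T φ ≡ T ψ) →
      sum (λ j → sgn j * u (suc j) * sum (λ k → sgn (suc k) * u (suc (punchIn j k)) * T (λ l → punchIn (suc j) (punchIn (suc k) l)))) ≡ 0ℚ
    rest zero u T T-cong = ∑-zero (λ j → *-zeroʳ (sgn j * u (suc j)))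
    rest (suc n) u T T-cong = begin
      sum (λ j → sgn j * u (suc j) * sum (λ k → sgn (suc k) * u (suc (punchIn j k)) * T (λ l → punchIn (suc j) (punchIn (suc k) l))))
        ≡⟨ sum-cong-≗ (λ j → cong (sgn j * u (suc j) *_) (trans (sum-cong-≗ (λ k → trans
             (cong (sgn (suc k) * u (suc (punchIn j k)) *_) (T-cong (λ l → punchIn (suc j) (punchIn (suc k) l)) (lift 1 (λ l → punchIn j (punchIn k l))) (λ { zero → refl ; (suc l) → refl })))
             (solve 3 (λ s x t → (con (- 1ℚ) :* s) :* x :* t := con (- 1ℚ) :* (s :* x :* t)) refl (sgn k) (u (suc (punchIn j k))) (T′ (λ l → punchIn j (punchIn k l))))))
             (sym (*-distribˡ-sum (- 1ℚ) (λ k → sgn k * u (suc (punchIn j k)) * T′ (λ l → punchIn j (punchIn k l))))))) ⟩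
      sum (λ j → sgn j * u (suc j) * (- 1ℚ * twoRows n (u ∘ suc) T′ j))
        ≡⟨ trans (sum-cong-≗ (λ j → solve 2 (λ x y → x :* (con (- 1ℚ) :* y) := con (- 1ℚ) :* (x :* y)) refl (sgn j * u (suc j)) (twoRows n (u ∘ suc) T′ j)))
             (sym (*-distribˡ-sum (- 1ℚ) (λ j → sgn j * u (suc j) * twoRows n (u ∘ suc) T′ j))) ⟩
      - 1ℚ * sum (λ j → sgn j * u (suc j) * twoRows n (u ∘ suc) T′ j)
        ≡⟨ cong (- 1ℚ *_) (twoRows-cancel n (u ∘ suc) T′ (λ φ ψ h → T-cong (lift 1 φ) (lift 1 ψ) λ { zero → refl ; (suc l) → cong suc (h l) })) ⟩
      - 1ℚ * 0ℚ ∎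
      where
      T′ : (Fin n → Fin (suc (suc n))) → ℚ
      T′ φ = T (lift 1 φ)

  infix 9 _[_≔_]

  _[_≔_] : ∀ {n} → Mat n → Fin n → (Fin n → ℚ) → Mat n
  A [ i ≔ r ] = updateAt A i (λ _ → r)

  ≔-same : ∀ {n} {A : Mat n} i r j → (A [ i ≔ r ]) i j ≡ r j
  ≔-same {A = A} i r j = cong (λ f → f j) (updateAt-updates i A)

  ≔-other : ∀ {n} {A : Mat n} {r} i k → k ≢ i → ∀ j → (A [ i ≔ r ]) k j ≡ A k j
  ≔-other {A = A} i k k≢i j = cong (λ f → f j) (updateAt-minimal k i A k≢i)

  det-≔-linear : ∀ {n} {A : Mat n} i a b u v → detℚ (A [ i ≔ (λ j → a * u j + b * v j) ]) ≡ a * detℚ (A [ i ≔ u ]) + b * detℚ (A [ i ≔ v ])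
  det-≔-linear {A = A} i a b u v = det-linear i a b
    (λ k k≢i j → trans (≔-other {A = A} i k k≢i j) (sym (≔-other {A = A} i k k≢i j)))
    (λ k k≢i j → trans (≔-other {A = A} i k k≢i j) (sym (≔-other {A = A} i k k≢i j)))
    (λ j → trans (≔-same {A = A} i _ j) (cong₂ (λ y z → a * y + b * z) (sym (≔-same {A = A} i u j)) (sym (≔-same {A = A} i v j))))

  ≔-cong : ∀ {n} {A B : Mat n} i {r s : Fin n → ℚ} → (∀ k → k ≢ i → ∀ j → A k j ≡ B k j) → (∀ j → r j ≡ s j) →
    ∀ k j → (A [ i ≔ r ]) k j ≡ (B [ i ≔ s ]) k j
  ≔-cong {A = A} {B} i {r} {s} h h′ k j with k Fin.≟ i
  ... | yes refl = trans (≔-same {A = A} i r j) (trans (h′ j) (sym (≔-same {A = B} i s j)))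
  ... | no k≢i = trans (≔-other {A = A} i k k≢i j) (trans (h k k≢i j) (sym (≔-other {A = B} i k k≢i j)))

  ≔-self : ∀ {n} {A : Mat n} i {r} → (∀ j → r j ≡ A i j) → ∀ k j → (A [ i ≔ r ]) k j ≡ A k j
  ≔-self {A = A} i {r} h k j with k Fin.≟ i
  ... | yes refl = trans (≔-same {A = A} i r j) (h j)
  ... | no k≢i = ≔-other {A = A} i k k≢i j

  det-≔-sum : ∀ {m n} {A : Mat n} i (c : Fin m → ℚ) (R : Fin m → Fin n → ℚ) →
    detℚ (A [ i ≔ (λ j → sum λ k → c k * R k j) ]) ≡ sum λ k → c k * detℚ (A [ i ≔ R k ])
  -- The empty sum is the zero row, written as a combination with both coefficients zero.
  det-≔-sum {zero} {A = A} i c R = trans (det-cong (≔-cong i {r = λ _ → 0ℚ} {s = λ j → 0ℚ * 0ℚ + 0ℚ * 0ℚ} (λ _ _ _ → refl) (λ _ → refl)))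
    (trans (det-≔-linear {A = A} i 0ℚ 0ℚ (λ _ → 0ℚ) (λ _ → 0ℚ)) (cong₂ _+_ (*-zeroˡ d) (*-zeroˡ d)))
    where d = detℚ (A [ i ≔ (λ _ → 0ℚ) ])
  det-≔-sum {suc m} {A = A} i c R = begin
    detℚ (A [ i ≔ (λ j → c zero * R zero j + S j) ])
      ≡⟨ det-cong (≔-cong {A = A} i (λ _ _ _ → refl) (λ j → cong (c zero * R zero j +_) (sym (*-identityˡ (S j))))) ⟩
    detℚ (A [ i ≔ (λ j → c zero * R zero j + 1ℚ * S j) ])
      ≡⟨ det-≔-linear i (c zero) 1ℚ (R zero) S ⟩
    c zero * detℚ (A [ i ≔ R zero ]) + 1ℚ * detℚ (A [ i ≔ S ])
      ≡⟨ cong (c zero * detℚ (A [ i ≔ R zero ]) +_) (trans (*-identityˡ _) (det-≔-sum i (c ∘ suc) (R ∘ suc))) ⟩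
    c zero * detℚ (A [ i ≔ R zero ]) + sum (λ k → c (suc k) * detℚ (A [ i ≔ R (suc k) ])) ∎
    where
    open ≡-Reasoning
    S : Fin _ → ℚ
    S j = sum λ k → c (suc k) * R (suc k) j

  Alternating : ℕ → Set
  Alternating n = ∀ (A : Mat n) i j → i ≢ j → (∀ k → A i k ≡ A j k) → detℚ A ≡ 0ℚ

  -- Polarization: the determinant with `u + v` in both rows vanishes, and so do the two terms of
  -- its expansion in which the rows agree.
  det-swap : ∀ {n} → Alternating n → ∀ (A : Mat n) i j → i ≢ j → ∀ u v →
    detℚ (A [ i ≔ u ] [ j ≔ v ]) ≡ - detℚ (A [ i ≔ v ] [ j ≔ u ])
  det-swap {n} alt A i j i≢j u v = begin
    D u v  ≡⟨ solve 2 (λ x y → x := (con 0ℚ :+ x :+ y :+ con 0ℚ) :- y) refl (D u v) (D v u) ⟩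
    0ℚ + D u v + D v u + 0ℚ - D v u  ≡⟨ cong (_- D v u) (sym expand) ⟩
    D (w 1ℚ 1ℚ) (w 1ℚ 1ℚ) - D v u    ≡⟨ cong (_- D v u) (D-alt _) ⟩
    0ℚ - D v u  ≡⟨ +-identityˡ _ ⟩
    - D v u  ∎
    where
    open ≡-Reasoning
    D : (Fin n → ℚ) → (Fin n → ℚ) → ℚ
    D u v = detℚ (A [ i ≔ u ] [ j ≔ v ])
    w : ℚ → ℚ → Fin n → ℚ
    w a b k = a * u k + b * v k
    D-alt : ∀ u → D u u ≡ 0ℚ
    D-alt u = alt _ i j i≢j (λ k → trans (≔-other {A = A [ i ≔ u ]} j i i≢j k) (trans (≔-same {A = A} i u k) (sym (≔-same {A = A [ i ≔ u ]} j u k))))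
    row-i : ∀ x y l → (A [ i ≔ x ] [ j ≔ y ]) i l ≡ x l
    row-i x y l = trans (≔-other {A = A [ i ≔ x ]} j i i≢j l) (≔-same {A = A} i x l)
    other-rows : ∀ x x′ y k → k ≢ i → ∀ l → (A [ i ≔ x ] [ j ≔ y ]) k l ≡ (A [ i ≔ x′ ] [ j ≔ y ]) k l
    other-rows x x′ y k k≢i l with k Fin.≟ j
    ... | yes refl = trans (≔-same {A = A [ i ≔ x ]} j y l) (sym (≔-same {A = A [ i ≔ x′ ]} j y l))
    ... | no k≢j = trans (trans (≔-other {A = A [ i ≔ x ]} j k k≢j l) (≔-other {A = A} i k k≢i l))
                    (sym (trans (≔-other {A = A [ i ≔ x′ ]} j k k≢j l) (≔-other {A = A} i k k≢i l)))
    linˡ : ∀ y → D (w 1ℚ 1ℚ) y ≡ 1ℚ * D u y + 1ℚ * D v y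
    linˡ y = det-linear i 1ℚ 1ℚ (other-rows _ u y) (other-rows _ v y)
      (λ l → trans (row-i _ y l) (sym (cong₂ (λ p q → 1ℚ * p + 1ℚ * q) (row-i u y l) (row-i v y l))))
    expand : D (w 1ℚ 1ℚ) (w 1ℚ 1ℚ) ≡ 0ℚ + D u v + D v u + 0ℚ
    expand = begin
      D (w 1ℚ 1ℚ) (w 1ℚ 1ℚ)
        ≡⟨ linˡ _ ⟩
      1ℚ * D u (w 1ℚ 1ℚ) + 1ℚ * D v (w 1ℚ 1ℚ)
        ≡⟨ cong₂ (λ y z → 1ℚ * y + 1ℚ * z) (det-≔-linear {A = A [ i ≔ u ]} j 1ℚ 1ℚ u v) (det-≔-linear {A = A [ i ≔ v ]} j 1ℚ 1ℚ u v) ⟩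
      1ℚ * (1ℚ * D u u + 1ℚ * D u v) + 1ℚ * (1ℚ * D v u + 1ℚ * D v v)
        ≡⟨ cong₂ (λ y z → 1ℚ * (1ℚ * y + 1ℚ * D u v) + 1ℚ * (1ℚ * D v u + 1ℚ * z)) (D-alt u) (D-alt v) ⟩
      1ℚ * (1ℚ * 0ℚ + 1ℚ * D u v) + 1ℚ * (1ℚ * D v u + 1ℚ * 0ℚ)
        ≡⟨ solve 2 (λ x y → con 1ℚ :* (con 1ℚ :* con 0ℚ :+ con 1ℚ :* x) :+ con 1ℚ :* (con 1ℚ :* y :+ con 1ℚ :* con 0ℚ)
             := con 0ℚ :+ x :+ y :+ con 0ℚ) refl (D u v) (D v u) ⟩
      0ℚ + D u v + D v u + 0ℚ ∎

  det-firstRows : ∀ {n} (A : Mat (suc (suc n))) → (∀ k → A zero k ≡ A (suc zero) k) → detℚ A ≡ 0ℚ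
  det-firstRows {n} A h = trans
    (sum-cong-≗ (λ j → cong (sgn j * A zero j *_) (sum-cong-≗ (λ k → cong (λ z → sgn k * z * T (λ l → punchIn j (punchIn k l))) (sym (h (punchIn j k)))))))
    (twoRows-cancel n (A zero) T (λ φ ψ eq → det-cong (λ i k → cong (A (suc (suc i))) (eq k))))
    where
    T : (Fin n → Fin (suc (suc n))) → ℚ
    T φ = detℚ (λ i k → A (suc (suc i)) (φ k))

  -- Swapping row 1 with the row equal to row 0 reduces to `det-firstRows`. The swap takes place
  -- inside every minor along row 0, so alternation is needed in the smaller size only.
  det-firstRow : ∀ {n} → Alternating (suc n) → ∀ (A : Mat (suc (suc n))) j → (∀ k → A zero k ≡ A (suc j) k) → detℚ A ≡ 0ℚ
  det-firstRow alt A zero h = det-firstRows A h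
  det-firstRow {suc n} alt A (suc j) h = begin
    detℚ A   ≡⟨ sum-cong-≗ (λ k → trans (cong (sgn k * A zero k *_) (minor-swap k))
                  (solve 2 (λ x y → x :* (:- y) := con (- 1ℚ) :* (x :* y)) refl (sgn k * A zero k) (detℚ (minor B k)))) ⟩
    sum (λ k → - 1ℚ * (sgn k * A zero k * detℚ (minor B k)))
             ≡⟨ sym (*-distribˡ-sum (- 1ℚ) (λ k → sgn k * A zero k * detℚ (minor B k))) ⟩
    - 1ℚ * detℚ B
             ≡⟨ cong (- 1ℚ *_) (det-firstRows B h) ⟩
    - 1ℚ * 0ℚ ∎
    where
    open ≡-Reasoning
    S : Fin (suc (suc n)) → Fin (suc (suc (suc n))) → ℚ
    S zero = A (suc (suc j))
    S (suc i) with i Fin.≟ j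
    ... | yes _ = A (suc zero)
    ... | no _ = A (suc (suc i))
    B : Mat (suc (suc (suc n)))
    B zero = A zero
    B (suc i) = S i
    minor-swap : ∀ k → detℚ (minor A k) ≡ - detℚ (minor B k)
    minor-swap k = trans (det-cong as-A) (trans (det-swap alt M zero (suc j) (λ ()) (M zero) (M (suc j))) (cong -_ (det-cong as-B)))
      where
      M = minor A k
      as-A : ∀ i l → M i l ≡ (M [ zero ≔ M zero ] [ suc j ≔ M (suc j) ]) i l
      as-A i l = sym (trans (≔-self {A = M [ zero ≔ M zero ]} (suc j) (λ m → sym (≔-self {A = M} zero (λ _ → refl) (suc j) m)) i l) (≔-self {A = M} zero (λ _ → refl) i l))
      as-B : ∀ i l → (M [ zero ≔ M (suc j) ] [ suc j ≔ M zero ]) i l ≡ minor B k i l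
      as-B zero l = refl
      as-B (suc i) l with i Fin.≟ j
      ... | yes refl = ≔-same {A = M [ zero ≔ M (suc j) ]} (suc j) (M zero) l
      ... | no i≢j = ≔-other {A = M [ zero ≔ M (suc j) ]} (suc j) (suc i) (i≢j ∘ Fin.suc-injective) l

  det-alternating : ∀ n → Alternating n
  det-alternating (suc n) A zero zero 0≢0 h = contradiction refl 0≢0
  det-alternating (suc (suc n)) A zero (suc j) _ h = det-firstRow (det-alternating (suc n)) A j h
  det-alternating (suc (suc n)) A (suc i) zero _ h = det-firstRow (det-alternating (suc n)) A i (λ k → sym (h k))
  det-alternating (suc (suc n)) A (suc i) (suc j) i≢j h = ∑-zero (λ k →
    trans (cong (sgn k * A zero k *_) (det-alternating (suc n) (minor A k) i j (i≢j ∘ cong suc) (λ l → h (punchIn k l)))) (*-zeroʳ (sgn k * A zero k)))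

  -- Only the summand `k = i` survives: every other one puts a second copy of row `k` in place of
  -- row `i`. This is the source of Cramer's rule in `det-differences`.
  det-combination : ∀ {n} (A : Mat n) i (c : Fin n → ℚ) → detℚ (A [ i ≔ (λ j → sum λ k → c k * A k j) ]) ≡ c i * detℚ A
  det-combination {n} A i c = trans (det-≔-sum {A = A} i c A) (trans (∑-single i other) (cong (c i *_) (det-cong (≔-self {A = A} i (λ _ → refl)))))
    where
    other : ∀ k → k ≢ i → c k * detℚ (A [ i ≔ A k ]) ≡ 0ℚ
    other k k≢i = trans (cong (c k *_) (det-alternating n _ i k (k≢i ∘ sym)
      (λ j → trans (≔-same {A = A} i (A k) j) (sym (≔-other {A = A} i k k≢i j))))) (*-zeroʳ (c k))

  ∣sgn∣ : ∀ {n} (j : Fin n) → ∣ sgn j ∣ ≡ 1ℚ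
  ∣sgn∣ j = go (toℕ j)
    where
    go : ∀ k → ∣ (- 1ℚ) ^ k ∣ ≡ 1ℚ
    go zero = refl
    go (suc k) = trans (∣p*q∣≡∣p∣*∣q∣ (- 1ℚ) ((- 1ℚ) ^ k)) (cong (1ℚ *_) (go k))

  -- A crude Hadamard inequality with ℓ¹ norms of the rows; deleting a column does not increase such
  -- a norm, so it passes through the expansion.
  ∣det∣≤ : ∀ {n} (A : Mat n) → ∣ detℚ A ∣ ≤ product (λ i → sum (λ j → ∣ A i j ∣))
  ∣det∣≤ {zero} A = ≤-refl
  ∣det∣≤ {suc n} A = begin
    ∣ detℚ A ∣  ≤⟨ ∣∑∣≤ (λ j → sgn j * A zero j * detℚ (minor A j)) ⟩
    sum (λ j → ∣ sgn j * A zero j * detℚ (minor A j) ∣)  ≤⟨ ∑-mono term ⟩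
    sum (λ j → ∣ A zero j ∣ * P)  ≡⟨ sym (*-distribʳ-sum P (λ j → ∣ A zero j ∣)) ⟩
    sum (λ j → ∣ A zero j ∣) * P  ∎
    where
    open ≤-Reasoning
    P = product (λ i → sum (λ j → ∣ A (suc i) j ∣))
    product-mono : ∀ {n} {f g : Fin n → ℚ} → (∀ i → 0ℚ ≤ f i) → (∀ i → f i ≤ g i) → 0ℚ ≤ product f × product f ≤ product g
    product-mono {zero} h h′ = 0≤1 , ≤-refl
    product-mono {suc n} h h′ = 0≤* (h zero) (proj₁ r) , *-mono (h zero) (h′ zero) (proj₁ r) (proj₂ r)
      where r = product-mono (λ i → h (suc i)) (λ i → h′ (suc i))
    punchIn-sum : ∀ {n} (f : Fin (suc n) → ℚ) → (∀ i → 0ℚ ≤ f i) → ∀ j → sum (λ k → f (punchIn j k)) ≤ sum f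
    punchIn-sum f h zero = ≤-by (f zero) (h zero) (+-comm (f zero) _)
    punchIn-sum {suc n} f h (suc j) = +-monoʳ-≤ (f zero) (punchIn-sum (f ∘ suc) (λ i → h (suc i)) j)
    term : ∀ j → ∣ sgn j * A zero j * detℚ (minor A j) ∣ ≤ ∣ A zero j ∣ * P
    term j = begin
      ∣ sgn j * A zero j * detℚ (minor A j) ∣        ≡⟨ ∣p*q∣≡∣p∣*∣q∣ (sgn j * A zero j) (detℚ (minor A j)) ⟩
      ∣ sgn j * A zero j ∣ * ∣ detℚ (minor A j) ∣    ≡⟨ cong (_* ∣ detℚ (minor A j) ∣) (trans (∣p*q∣≡∣p∣*∣q∣ (sgn j) (A zero j)) (trans (cong (_* ∣ A zero j ∣) (∣sgn∣ j)) (*-identityˡ ∣ A zero j ∣))) ⟩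
      ∣ A zero j ∣ * ∣ detℚ (minor A j) ∣  ≤⟨ *-monoˡ ∣ A zero j ∣ (0≤∣p∣ (A zero j)) (≤-trans (∣det∣≤ (minor A j))
                                (proj₂ (product-mono (λ i → 0≤∑ (λ k → 0≤∣p∣ (minor A j i k))) (λ i → punchIn-sum (λ k → ∣ A (suc i) k ∣) (λ k → 0≤∣p∣ (A (suc i) k)) j)))) ⟩
      ∣ A zero j ∣ * P  ∎

-- Quadratic forms, Cauchy-Schwarz, and Cramer's rule for differences of coordinates.

module QuadraticForms where

  open Rationals
  open Determinants

  Vect : ℕ → Set
  Vect n = Fin n → ℚ

  2ℚ : ℚ
  2ℚ = ℤ.+ 2 / 1

  dot : ∀ {n} → Vect n → Vect n → ℚ
  dot x y = sum λ i → x i * y i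

  normSq : ∀ {n} → Vect n → ℚ
  normSq x = dot x x

  infixr 7 _⊛_

  _⊛_ : ∀ {n} → Mat n → Vect n → Vect n
  (A ⊛ x) i = sum λ j → A i j * x j

  quad : ∀ {n} → Mat n → Vect n → ℚ
  quad A x = dot x (A ⊛ x)

  Sym : ∀ {n} → Mat n → Set
  Sym A = ∀ i j → A i j ≡ A j i

  dot-cong : ∀ {n} {x x′ y y′ : Vect n} → (∀ i → x i ≡ x′ i) → (∀ i → y i ≡ y′ i) → dot x y ≡ dot x′ y′
  dot-cong h k = sum-cong-≗ λ i → cong₂ _*_ (h i) (k i)

  dot-comm : ∀ {n} (x y : Vect n) → dot x y ≡ dot y x
  dot-comm x y = sum-cong-≗ λ i → *-comm (x i) (y i)

  dot-linearʳ : ∀ {n} (x : Vect n) a b y z → dot x (λ i → a * y i + b * z i) ≡ a * dot x y + b * dot x z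
  dot-linearʳ x a b y z = trans
    (sum-cong-≗ λ i → solve 5 (λ x a y b z → x :* (a :* y :+ b :* z) := a :* (x :* y) :+ b :* (x :* z)) refl (x i) a (y i) b (z i))
    (∑-linear a b (λ i → x i * y i) (λ i → x i * z i))

  dot-linearˡ : ∀ {n} a b (x y z : Vect n) → dot (λ i → a * x i + b * y i) z ≡ a * dot x z + b * dot y z
  dot-linearˡ a b x y z = trans (dot-comm _ z) (trans (dot-linearʳ z a b x y) (cong₂ (λ p q → a * p + b * q) (dot-comm z x) (dot-comm z y)))

  ⊛-linear : ∀ {n} (A : Mat n) a b x y i → (A ⊛ λ j → a * x j + b * y j) i ≡ a * (A ⊛ x) i + b * (A ⊛ y) i
  ⊛-linear A a b x y i = dot-linearʳ (A i) a b x y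

  dot-⊛ : ∀ {n} (A : Mat n) → Sym A → ∀ x y → dot x (A ⊛ y) ≡ dot (A ⊛ x) y
  dot-⊛ {n} A A-sym x y = begin
    sum (λ i → x i * sum (λ j → A i j * y j))    ≡⟨ sum-cong-≗ (λ i → *-distribˡ-sum (x i) (λ j → A i j * y j)) ⟩
    sum (λ i → sum (λ j → x i * (A i j * y j)))  ≡⟨ ∑-comm (λ i j → x i * (A i j * y j)) ⟩
    sum (λ j → sum (λ i → x i * (A i j * y j)))  ≡⟨ sum-cong-≗ (λ j → trans (sum-cong-≗ (λ i → trans
                                (solve 3 (λ x a y → x :* (a :* y) := a :* x :* y) refl (x i) (A i j) (y j))
                                (cong (λ a → a * x i * y j) (A-sym i j))))
                                (sym (*-distribʳ-sum (y j) (λ i → A j i * x i)))) ⟩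
    sum (λ j → (A ⊛ x) j * y j)  ∎
    where open ≡-Reasoning

  0≤normSq : ∀ {n} (x : Vect n) → 0ℚ ≤ normSq x
  0≤normSq x = 0≤∑ λ i → 0≤-square (x i)

  -- Lagrange's identity for `f` and the constant vector. It yields Cauchy-Schwarz in `sum²≤`, and
  -- for vectors of sum zero it recovers the norm from the pairwise differences, which are what
  -- Cramer's rule bounds.
  ∑-differences : ∀ {n} (f : Vect n) →
    sum (λ i → sum (λ j → (f j - f i) * (f j - f i))) ≡ 2ℚ * (ι n * normSq f - sum f * sum f)
  ∑-differences {n} f = begin
    sum (λ i → sum (λ j → (f j - f i) * (f j - f i)))
      ≡⟨ sum-cong-≗ inner ⟩
    sum (λ i → 1ℚ * (S₂ + ι n * (f i * f i)) + (- 2ℚ * S₁) * f i)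
      ≡⟨ ∑-linear 1ℚ (- 2ℚ * S₁) (λ i → S₂ + ι n * (f i * f i)) f ⟩
    1ℚ * sum (λ i → S₂ + ι n * (f i * f i)) + (- 2ℚ * S₁) * S₁
      ≡⟨ cong (λ z → 1ℚ * z + (- 2ℚ * S₁) * S₁) (trans (∑-distrib-+ (λ _ → S₂) (λ i → ι n * (f i * f i)))
           (cong₂ _+_ (∑-const n S₂) (sym (*-distribˡ-sum (ι n) (λ i → f i * f i))))) ⟩
    1ℚ * (ι n * S₂ + ι n * S₂) + (- 2ℚ * S₁) * S₁
      ≡⟨ solve 3 (λ n s t → con 1ℚ :* (n :* s :+ n :* s) :+ (con (- 2ℚ) :* t) :* t := con 2ℚ :* (n :* s :- t :* t)) refl (ι n) S₂ S₁ ⟩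
    2ℚ * (ι n * S₂ - S₁ * S₁) ∎
    where
    open ≡-Reasoning
    S₁ = sum f
    S₂ = normSq f
    inner : ∀ i → sum (λ j → (f j - f i) * (f j - f i)) ≡ 1ℚ * (S₂ + ι n * (f i * f i)) + (- 2ℚ * S₁) * f i
    inner i = begin
      sum (λ j → (f j - f i) * (f j - f i))
        ≡⟨ sum-cong-≗ (λ j → solve 2 (λ x y → (x :- y) :* (x :- y) := con 1ℚ :* (x :* x :+ y :* y) :+ (con (- 2ℚ) :* y) :* x) refl (f j) (f i)) ⟩
      sum (λ j → 1ℚ * (f j * f j + f i * f i) + (- 2ℚ * f i) * f j)
        ≡⟨ ∑-linear 1ℚ (- 2ℚ * f i) (λ j → f j * f j + f i * f i) f ⟩
      1ℚ * sum (λ j → f j * f j + f i * f i) + (- 2ℚ * f i) * S₁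
        ≡⟨ cong₂ _+_ (cong (1ℚ *_) (trans (∑-distrib-+ (λ j → f j * f j) (λ _ → f i * f i)) (cong (S₂ +_) (∑-const n (f i * f i)))))
             (solve 2 (λ x y → con (- 2ℚ) :* x :* y := con (- 2ℚ) :* y :* x) refl (f i) S₁) ⟩
      1ℚ * (S₂ + ι n * (f i * f i)) + (- 2ℚ * S₁) * f i ∎

  0<2 : 0ℚ < 2ℚ
  0<2 = *<* (ℤ.+<+ (s≤s z≤n))

  sum²≤ : ∀ {n} (f : Vect n) → sum f * sum f ≤ ι n * normSq f
  sum²≤ {n} f = ≤-by _ (*-cancelˡ-≤ 2ℚ 0<2 (subst₂ _≤_ (sym (*-zeroʳ 2ℚ)) (∑-differences f)
      (0≤∑ λ i → 0≤∑ λ j → 0≤-square (f j - f i))))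
    (solve 2 (λ x y → x := y :+ (x :- y)) refl (ι n * normSq f) (sum f * sum f))

  -- Schur's test: each product of two coordinates is split by the arithmetic-geometric mean.
  -- Weighting (x i - x j)² by |a| + a and (x i + x j)² by |a| - a avoids a case distinction on the
  -- sign of the entry a.
  quad≤ : ∀ {n} (A : Mat n) → Sym A → ∀ R → (∀ i → sum (λ j → ∣ A i j ∣) ≤ R) → ∀ x → quad A x ≤ R * normSq x
  quad≤ {n} A A-sym R h x = *-cancelˡ-≤ 2ℚ 0<2 (begin
    2ℚ * quad A x
      ≡⟨ trans (*-distribˡ-sum 2ℚ (λ i → x i * (A ⊛ x) i)) (sum-cong-≗ λ i → trans (cong (2ℚ *_) (*-distribˡ-sum (x i) (λ j → A i j * x j)))
           (*-distribˡ-sum 2ℚ (λ j → x i * (A i j * x j)))) ⟩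
    sum (λ i → sum (λ j → 2ℚ * (x i * (A i j * x j))))
      ≤⟨ ∑-mono (λ i → ∑-mono (λ j → term i j)) ⟩
    sum (λ i → sum (λ j → ∣ A i j ∣ * (x i * x i) + ∣ A j i ∣ * (x j * x j)))
      ≡⟨ trans (sum-cong-≗ (λ i → ∑-distrib-+ (λ j → ∣ A i j ∣ * (x i * x i)) (λ j → ∣ A j i ∣ * (x j * x j))))
           (∑-distrib-+ (λ i → sum (λ j → ∣ A i j ∣ * (x i * x i))) (λ i → sum (λ j → ∣ A j i ∣ * (x j * x j)))) ⟩
    T + sum (λ i → sum (λ j → ∣ A j i ∣ * (x j * x j)))
      ≡⟨ cong (T +_) (∑-comm (λ i j → ∣ A j i ∣ * (x j * x j))) ⟩
    T + T
      ≤⟨ +-mono-≤ T≤ T≤ ⟩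
    R * normSq x + R * normSq x
      ≡⟨ solve 1 (λ x → x :+ x := con 2ℚ :* x) refl (R * normSq x) ⟩
    2ℚ * (R * normSq x) ∎)
    where
    open ≤-Reasoning
    T = sum (λ i → sum (λ j → ∣ A i j ∣ * (x i * x i)))
    T≤ : T ≤ R * normSq x
    T≤ = ≤-trans (∑-mono (λ i → ≤-trans (≤-reflexive (sym (*-distribʳ-sum (x i * x i) (λ j → ∣ A i j ∣)))) (*-monoʳ (x i * x i) (0≤-square (x i)) (h i))))
           (≤-reflexive (sym (*-distribˡ-sum R (λ i → x i * x i))))
    term : ∀ i j → 2ℚ * (x i * (A i j * x j)) ≤ ∣ A i j ∣ * (x i * x i) + ∣ A j i ∣ * (x j * x j)
    term i j = ≤-by (½ * ((∣ A i j ∣ + A i j) * ((x i - x j) * (x i - x j)) + (∣ A i j ∣ - A i j) * ((x i + x j) * (x i + x j))))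
      (0≤* 0≤½ (0≤+ (0≤* (subst (λ z → 0ℚ ≤ ∣ A i j ∣ + z) (solve 1 (λ a → :- (:- a) := a) refl (A i j)) (0≤Δ (-p≤∣p∣ (A i j)))) (0≤-square (x i - x j)))
            (0≤* (0≤Δ (p≤∣p∣ (A i j))) (0≤-square (x i + x j)))))
      (trans (cong (λ a → ∣ A i j ∣ * (x i * x i) + ∣ a ∣ * (x j * x j)) (A-sym j i))
        (solve 4 (λ m a x y → m :* (x :* x) :+ m :* (y :* y) := con 2ℚ :* (x :* (a :* y)) :+
          con ½ :* ((m :+ a) :* ((x :- y) :* (x :- y)) :+ (m :- a) :* ((x :+ y) :* (x :+ y)))) refl ∣ A i j ∣ (A i j) (x i) (x j)))

  ones : ∀ {n} → Vect n
  ones _ = 1ℚ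

  -- Adding all rows to row `i` turns it into `τ` times `ones`. Then row `j` is replaced by the
  -- combination of the rows with coefficients `x k - x i`, which multiplies the determinant by
  -- `x j - x i`. Row `i` enters with coefficient zero, so the combination is `A ⊛ x` up to a
  -- multiple of `ones`, and that multiple is killed by row `i`. The factor `τ` on the right cancels
  -- the eigenvalue of the constant vector in `detℚ A`, so that only the behaviour on 1^⊥ is
  -- measured.
  det-differences : ∀ {n} (A : Mat n) → Sym A → ∀ τ → (∀ i → sum (A i) ≡ τ) → ∀ x i j → i ≢ j →
    (x j - x i) * detℚ A ≡ τ * detℚ (A [ i ≔ ones ] [ j ≔ A ⊛ x ])
  det-differences {n} A A-sym τ A-row x i j i≢j = begin
    (x j - x i) * detℚ A  ≡⟨ cong ((x j - x i) *_) first ⟩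
    (x j - x i) * (τ * detℚ N)   ≡⟨ solve 3 (λ z t d → z :* (t :* d) := t :* (z :* d)) refl (x j - x i) τ (detℚ N) ⟩
    τ * ((x j - x i) * detℚ N)   ≡⟨ cong (τ *_) second ⟩
    τ * detℚ (N [ j ≔ A ⊛ x ])   ∎
    where
    open ≡-Reasoning
    N = A [ i ≔ ones ]
    z : Vect n
    z k = x k - x i
    column : ∀ l → sum (λ k → A k l) ≡ τ
    column l = trans (sum-cong-≗ (λ k → A-sym k l)) (A-row l)
    first : detℚ A ≡ τ * detℚ N
    first = begin
      detℚ A  ≡⟨ sym (*-identityˡ (detℚ A)) ⟩
      1ℚ * detℚ A  ≡⟨ sym (det-combination A i ones) ⟩
      detℚ (A [ i ≔ (λ l → sum λ k → 1ℚ * A k l) ])       ≡⟨ det-cong (≔-cong {A = A} i (λ _ _ _ → refl) (λ l → trans (sum-cong-≗ (λ k → *-identityˡ (A k l)))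
                                (trans (column l) (solve 1 (λ t → t := t :* con 1ℚ :+ con 0ℚ :* con 1ℚ) refl τ)))) ⟩
      detℚ (A [ i ≔ (λ l → τ * 1ℚ + 0ℚ * 1ℚ) ])  ≡⟨ det-≔-linear {A = A} i τ 0ℚ ones ones ⟩
      τ * detℚ N + 0ℚ * detℚ N  ≡⟨ solve 2 (λ t d → t :* d :+ con 0ℚ :* d := t :* d) refl τ (detℚ N) ⟩
      τ * detℚ N  ∎
    row : ∀ l → sum (λ k → z k * N k l) ≡ 1ℚ * (A ⊛ x) l + (- (x i * τ)) * 1ℚ
    row l = begin
      sum (λ k → z k * N k l)  ≡⟨ sum-cong-≗ entry ⟩
      sum (λ k → 1ℚ * (A l k * x k) + (- x i) * A k l)    ≡⟨ ∑-linear 1ℚ (- x i) (λ k → A l k * x k) (λ k → A k l) ⟩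
      1ℚ * (A ⊛ x) l + (- x i) * sum (λ k → A k l)        ≡⟨ cong (1ℚ * (A ⊛ x) l +_) (trans (cong ((- x i) *_) (column l))
                                (solve 2 (λ x t → (:- x) :* t := (:- (x :* t)) :* con 1ℚ) refl (x i) τ)) ⟩
      1ℚ * (A ⊛ x) l + (- (x i * τ)) * 1ℚ  ∎
      where
      entry : ∀ k → z k * N k l ≡ 1ℚ * (A l k * x k) + (- x i) * A k l
      entry k with k Fin.≟ i
      ... | yes refl = trans (solve 2 (λ x n → (x :- x) :* n := con 0ℚ) refl (x i) (N i l))
        (sym (trans (cong (λ a → 1ℚ * (a * x i) + (- x i) * A i l) (A-sym l i)) (solve 2 (λ a x → con 1ℚ :* (a :* x) :+ (:- x) :* a := con 0ℚ) refl (A i l) (x i))))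
      ... | no k≢i = trans (cong (z k *_) (≔-other {A = A} i k k≢i l)) (trans
        (solve 3 (λ x y a → (x :- y) :* a := con 1ℚ :* (a :* x) :+ (:- y) :* a) refl (x k) (x i) (A k l))
        (cong (λ a → 1ℚ * (a * x k) + (- x i) * A k l) (A-sym k l)))
    second : (x j - x i) * detℚ N ≡ detℚ (N [ j ≔ A ⊛ x ])
    second = begin
      z j * detℚ N  ≡⟨ sym (det-combination N j z) ⟩
      detℚ (N [ j ≔ (λ l → sum λ k → z k * N k l) ])      ≡⟨ det-cong (≔-cong {A = N} j (λ _ _ _ → refl) row) ⟩
      detℚ (N [ j ≔ (λ l → 1ℚ * (A ⊛ x) l + (- (x i * τ)) * 1ℚ) ])
                                ≡⟨ det-≔-linear {A = N} j 1ℚ (- (x i * τ)) (A ⊛ x) ones ⟩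
      1ℚ * detℚ (N [ j ≔ A ⊛ x ]) + (- (x i * τ)) * detℚ (N [ j ≔ ones ])
                                ≡⟨ cong (λ d → 1ℚ * detℚ (N [ j ≔ A ⊛ x ]) + (- (x i * τ)) * d) repeated ⟩
      1ℚ * detℚ (N [ j ≔ A ⊛ x ]) + (- (x i * τ)) * 0ℚ    ≡⟨ solve 2 (λ d c → con 1ℚ :* d :+ c :* con 0ℚ := d) refl (detℚ (N [ j ≔ A ⊛ x ])) (- (x i * τ)) ⟩
      detℚ (N [ j ≔ A ⊛ x ])  ∎
      where
      repeated : detℚ (N [ j ≔ ones ]) ≡ 0ℚ
      repeated = det-alternating n _ i j i≢j (λ k → trans (≔-other {A = N} j i i≢j k) (trans (≔-same {A = A} i ones k) (sym (≔-same {A = N} j ones k))))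

  product≤ : ∀ {n} (f : Vect (suc n)) Q e j → 0ℚ ≤ Q → (∀ i → 0ℚ ≤ f i) → f j ≤ e → (∀ i → i ≢ j → f i ≤ Q) → product f ≤ e * Q ^ n
  product≤ {n} f Q e zero 0≤Q 0≤f h k = *-mono (0≤f zero) h (proj₁ tail) (proj₂ tail)
    where
    bound : ∀ {n} {f : Vect n} → (∀ i → 0ℚ ≤ f i) → (∀ i → f i ≤ Q) → 0ℚ ≤ product f × product f ≤ Q ^ n
    bound {zero} h k = 0≤1 , ≤-refl
    bound {suc n} h k = 0≤* (h zero) (proj₁ r) , *-mono (h zero) (k zero) (proj₁ r) (proj₂ r)
      where r = bound (λ i → h (suc i)) (λ i → k (suc i))
    tail = bound (λ i → 0≤f (suc i)) (λ i → k (suc i) (λ ()))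
  product≤ {suc n} f Q e (suc j) 0≤Q 0≤f h k = ≤-trans
    (*-mono (0≤f zero) (k zero (λ ())) (0≤product (λ i → 0≤f (suc i))) (product≤ (f ∘ suc) Q e j 0≤Q (λ i → 0≤f (suc i)) h (λ i i≢j → k (suc i) (i≢j ∘ Fin.suc-injective))))
    (≤-reflexive (solve 3 (λ q e p → q :* (e :* p) := e :* (q :* p)) refl Q e (Q ^ n)))
    where
    0≤product : ∀ {n} {f : Vect n} → (∀ i → 0ℚ ≤ f i) → 0ℚ ≤ product f
    0≤product {zero} h = 0≤1
    0≤product {suc n} h = 0≤* (h zero) (0≤product (λ i → h (suc i)))

-- Propagation of positive semidefiniteness on 1^⊥ along a fine mesh of shifts.

module Descent where

  open Rationals
  open Determinants
  open QuadraticForms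

  PSD⊥ : ∀ {n} → Mat n → Set
  PSD⊥ M = ∀ x → sum x ≡ 0ℚ → 0ℚ ≤ quad M x

  ∑-⊛ : ∀ {n} (M : Mat n) → Sym M → ∀ ρ → (∀ i → sum (M i) ≡ ρ) → ∀ x → sum (M ⊛ x) ≡ ρ * sum x
  ∑-⊛ M M-sym ρ M-row x = trans (∑-comm (λ i j → M i j * x j)) (trans
    (sum-cong-≗ (λ j → trans (sym (*-distribʳ-sum (x j) (λ i → M i j))) (cong (_* x j) (trans (sum-cong-≗ (λ i → M-sym i j)) (M-row j)))))
    (sym (*-distribˡ-sum ρ x)))

  -- For positive semidefinite M, small x·Mx forces small Mx: evaluate M at R x - M x.
  normSq-⊛≤ : ∀ {n} (M : Mat n) → Sym M → ∀ ρ → (∀ i → sum (M i) ≡ ρ) → ∀ R → 0ℚ < R → (∀ i → sum (λ j → ∣ M i j ∣) ≤ R) →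
    PSD⊥ M → ∀ x → sum x ≡ 0ℚ → normSq (M ⊛ x) ≤ R * quad M x
  normSq-⊛≤ {n} M M-sym ρ M-row R 0<R M≤R psd x x⊥1 = *-cancelˡ-≤ R 0<R (≤-by
    (quad M z + (R * Y - quad M y)) (0≤+ (psd z z⊥1) (0≤Δ (quad≤ M M-sym R M≤R y)))
    (trans (solve 4 (λ r q s y → r :* (r :* q) := r :* y :+ ((r :* (r :* q :+ (:- con 1ℚ) :* y) :+ (:- con 1ℚ) :* (r :* y :+ (:- con 1ℚ) :* s)) :+ (r :* y :- s)))
             refl R (quad M x) (quad M y) Y)
           (cong (λ t → R * Y + (t + (R * Y - quad M y))) (sym quad-z))))
    where
    y = M ⊛ x
    Y = normSq y
    z : Vect n
    z i = R * x i + - 1ℚ * y i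
    z⊥1 : sum z ≡ 0ℚ
    z⊥1 = trans (∑-linear R (- 1ℚ) x y) (trans (cong₂ (λ a b → R * a + - 1ℚ * b) x⊥1 (trans (∑-⊛ M M-sym ρ M-row x) (trans (cong (ρ *_) x⊥1) (*-zeroʳ ρ))))
      (solve 1 (λ r → r :* con 0ℚ :+ con (- 1ℚ) :* con 0ℚ := con 0ℚ) refl R))
    quad-z : quad M z ≡ R * (R * quad M x + - 1ℚ * Y) + - 1ℚ * (R * Y + - 1ℚ * quad M y)
    quad-z = trans (dot-cong {x = z} (λ _ → refl) (⊛-linear M R (- 1ℚ) x y)) (trans (dot-linearˡ R (- 1ℚ) x y _)
      (cong₂ (λ a b → R * a + - 1ℚ * b)
        (trans (dot-linearʳ x R (- 1ℚ) (M ⊛ x) (M ⊛ y)) (cong (λ a → R * quad M x + - 1ℚ * a) (dot-⊛ M M-sym x y)))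
        (dot-linearʳ y R (- 1ℚ) (M ⊛ x) (M ⊛ y))))

  -- If x·Mx were below ε|x|², then `M ⊛ x` would be small by `normSq-⊛≤`, and with it `A ⊛ x`. By
  -- `det-differences` all differences of the coordinates of `x` would then be small against |det A|
  -- / τ, and as `x` has sum zero, |x| would be smaller than itself. The sign `s` admits both
  -- `M - ε` and its negative, whichever has positive row sums `τ`.
  shift-PSD⊥ : ∀ {m} (M A : Mat (suc m)) s τ ρ R Q c ε →
    Sym M → (∀ i → sum (M i) ≡ ρ) → s * s ≡ 1ℚ → (∀ i j → A i j ≡ s * (M i j - ε * δ i j)) →
    Sym A → (∀ i → sum (A i) ≡ τ) → 0ℚ < τ →
    0ℚ < R → (∀ i → sum (λ j → ∣ M i j ∣) ≤ R) → (∀ i → sum (λ j → ∣ A i j ∣) ≤ Q) → ι (suc m) ≤ Q →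
    0ℚ ≤ c → τ * c ≤ ∣ detℚ A ∣ → 0ℚ < ε →
    ι (suc m) * ι (suc m) * (R * ε + ε * ε) * (Q ^ m * Q ^ m) < c * c →
    PSD⊥ M → ∀ x → sum x ≡ 0ℚ → ε * normSq x ≤ quad M x
  shift-PSD⊥ {m} M A s τ ρ R Q c ε M-sym M-row s² A≡ A-sym A-row 0<τ 0<R M≤R A≤Q n≤Q 0≤c det≥ 0<ε small psd x x⊥1
    with ε * normSq x ≤? quad M x
  ... | yes h = h
  ... | no h = contradiction (≤-<-trans total strict) (<-irrefl refl)
    where
    n = ι (suc m)
    P = Q ^ m
    X = normSq x
    q = quad M x
    y = M ⊛ x
    Y = normSq y
    v = A ⊛ x
    V = normSq v
    e = sum (λ k → ∣ v k ∣)
    q<εX = ≰⇒> h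
    0≤q = psd x x⊥1
    0<X : 0ℚ < X
    0<X = *-cancelʳ-< {0ℚ} {X} ε (<⇒≤ 0<ε) (subst₂ _<_ (sym (*-zeroˡ ε)) (*-comm ε X) (≤-<-trans 0≤q q<εX))
    0<n : 0ℚ < n
    0<n = 0<ι-suc m
    0≤Q : 0ℚ ≤ Q
    0≤Q = ≤-trans (<⇒≤ 0<n) n≤Q
    0≤P : 0ℚ ≤ P
    0≤P = 0≤^ m 0≤Q
    v≡ : ∀ i → v i ≡ s * y i + (- (s * ε)) * x i
    v≡ i = begin
      sum (λ j → A i j * x j)  ≡⟨ sum-cong-≗ (λ j → trans (cong (_* x j) (A≡ i j))
                                (solve 5 (λ s a e d x → s :* (a :- e :* d) :* x := s :* (a :* x) :+ (:- (s :* e)) :* (d :* x)) refl s (M i j) ε (δ i j) (x j))) ⟩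
      sum (λ j → s * (M i j * x j) + (- (s * ε)) * (δ i j * x j))        ≡⟨ ∑-linear s (- (s * ε)) (λ j → M i j * x j) (λ j → δ i j * x j) ⟩
      s * y i + (- (s * ε)) * sum (λ j → δ i j * x j)  ≡⟨ cong (λ z → s * y i + (- (s * ε)) * z) (∑-δ x i) ⟩
      s * y i + (- (s * ε)) * x i  ∎
      where open ≡-Reasoning
    V≡ : V ≡ Y - (ε * q + ε * q) + ε * ε * X
    V≡ = begin
      V
        ≡⟨ dot-cong v≡ v≡ ⟩
      dot w w
        ≡⟨ dot-linearˡ s (- (s * ε)) y x w ⟩
      s * dot y w + (- (s * ε)) * dot x w
        ≡⟨ cong₂ (λ a b → s * a + (- (s * ε)) * b) (dot-linearʳ y s (- (s * ε)) y x) (dot-linearʳ x s (- (s * ε)) y x) ⟩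
      s * (s * Y + (- (s * ε)) * dot y x) + (- (s * ε)) * (s * q + (- (s * ε)) * X)
        ≡⟨ cong (λ z → s * (s * Y + (- (s * ε)) * z) + (- (s * ε)) * (s * q + (- (s * ε)) * X)) (dot-comm y x) ⟩
      s * (s * Y + (- (s * ε)) * q) + (- (s * ε)) * (s * q + (- (s * ε)) * X)
        ≡⟨ solve 5 (λ s y e q x → s :* (s :* y :+ (:- (s :* e)) :* q) :+ (:- (s :* e)) :* (s :* q :+ (:- (s :* e)) :* x) := s :* s :* (y :- (e :* q :+ e :* q) :+ e :* e :* x)) refl s Y ε q X ⟩
      s * s * (Y - (ε * q + ε * q) + ε * ε * X)
        ≡⟨ trans (cong (_* (Y - (ε * q + ε * q) + ε * ε * X)) s²) (*-identityˡ _) ⟩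
      Y - (ε * q + ε * q) + ε * ε * X ∎
      where
      open ≡-Reasoning
      w : Vect (suc m)
      w i = s * y i + (- (s * ε)) * x i
    V≤ : V ≤ (R * ε + ε * ε) * X
    V≤ = ≤-by ((R * q - Y) + R * (ε * X - q) + (ε * q + ε * q))
      (0≤+ (0≤+ (0≤Δ (normSq-⊛≤ M M-sym ρ M-row R 0<R M≤R psd x x⊥1)) (0≤* (<⇒≤ 0<R) (0≤Δ (<⇒≤ q<εX))))
            (0≤+ (0≤* (<⇒≤ 0<ε) 0≤q) (0≤* (<⇒≤ 0<ε) 0≤q)))
      (trans (solve 5 (λ r e x q y → (r :* e :+ e :* e) :* x := (y :- (e :* q :+ e :* q) :+ e :* e :* x) :+ ((r :* q :- y) :+ r :* (e :* x :- q) :+ (e :* q :+ e :* q))) refl R ε X q Y)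
        (cong (_+ ((R * q - Y) + R * (ε * X - q) + (ε * q + ε * q))) (sym V≡)))
    e² : e * e ≤ n * V
    e² = ≤-trans (sum²≤ (λ k → ∣ v k ∣)) (≤-reflexive (cong (n *_) (sum-cong-≗ (λ k → ∣∣*∣∣ (v k)))))
    0≤e : 0ℚ ≤ e
    0≤e = 0≤∑ (λ k → 0≤∣p∣ (v k))
    pair : ∀ i j → (x j - x i) * (x j - x i) * (c * c) ≤ e * e * (P * P)
    pair i j with i Fin.≟ j
    ... | yes refl = ≤-trans (≤-reflexive (solve 2 (λ x c → (x :- x) :* (x :- x) :* c := con 0ℚ) refl (x i) (c * c))) (0≤* (0≤* 0≤e 0≤e) (0≤* 0≤P 0≤P))
    ... | no i≢j = subst₂ _≤_
      (trans (solve 2 (λ d c → d :* c :* (d :* c) := d :* d :* (c :* c)) refl ∣ x j - x i ∣ c) (cong (_* (c * c)) (∣∣*∣∣ (x j - x i))))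
      (solve 2 (λ e p → e :* p :* (e :* p) := e :* e :* (p :* p)) refl e P)
      (*-mono (0≤* (0≤∣p∣ (x j - x i)) 0≤c) bound (0≤* (0≤∣p∣ (x j - x i)) 0≤c) bound)
      where
      open ≤-Reasoning
      B = A [ i ≔ ones ] [ j ≔ v ]
      row-norm : Fin (suc m) → ℚ
      row-norm k = sum (λ l → ∣ B k l ∣)
      row-i : row-norm i ≤ Q
      row-i = ≤-trans (≤-reflexive (trans (sum-cong-≗ (λ l → cong ∣_∣ (trans (≔-other {A = A [ i ≔ ones ]} {r = v} j i i≢j l) (≔-same {A = A} i ones l))))
        (trans (∑-const (suc m) 1ℚ) (*-identityʳ n)))) n≤Q
      rows : ∀ k → k ≢ j → row-norm k ≤ Q
      rows k k≢j with k Fin.≟ i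
      ... | yes refl = row-i
      ... | no k≢i = ≤-trans (≤-reflexive (sum-cong-≗ (λ l → cong ∣_∣ (trans (≔-other {A = A [ i ≔ ones ]} {r = v} j k k≢j l) (≔-other {A = A} {r = ones} i k k≢i l))))) (A≤Q k)
      bound : ∣ x j - x i ∣ * c ≤ e * P
      bound = *-cancelˡ-≤ τ 0<τ (begin
        τ * (∣ x j - x i ∣ * c)      ≡⟨ solve 3 (λ t d c → t :* (d :* c) := d :* (t :* c)) refl τ ∣ x j - x i ∣ c ⟩
        ∣ x j - x i ∣ * (τ * c)      ≤⟨ *-monoˡ ∣ x j - x i ∣ (0≤∣p∣ (x j - x i)) det≥ ⟩
        ∣ x j - x i ∣ * ∣ detℚ A ∣   ≡⟨ sym (∣p*q∣≡∣p∣*∣q∣ (x j - x i) (detℚ A)) ⟩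
        ∣ (x j - x i) * detℚ A ∣     ≡⟨ cong ∣_∣ (det-differences A A-sym τ A-row x i j i≢j) ⟩
        ∣ τ * detℚ B ∣  ≡⟨ trans (∣p*q∣≡∣p∣*∣q∣ τ (detℚ B)) (cong (_* ∣ detℚ B ∣) (0≤p⇒∣p∣≡p (<⇒≤ 0<τ))) ⟩
        τ * ∣ detℚ B ∣  ≤⟨ *-monoˡ τ (<⇒≤ 0<τ) (≤-trans (∣det∣≤ B) (product≤ row-norm Q e j 0≤Q (λ k → 0≤∑ (λ l → 0≤∣p∣ (B k l)))
                                (≤-reflexive (sum-cong-≗ (λ l → cong ∣_∣ (≔-same {A = A [ i ≔ ones ]} j v l)))) rows)) ⟩
        τ * (e * P)  ∎)
    total : 2ℚ * (c * c * X) ≤ n * n * (R * ε + ε * ε) * (P * P) * X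
    total = *-cancelˡ-≤ n 0<n (begin
      n * (2ℚ * (c * c * X))
        ≡⟨ solve 3 (λ n c x → n :* (con 2ℚ :* (c :* x)) := con 2ℚ :* (n :* x :- con 0ℚ :* con 0ℚ) :* c) refl n (c * c) X ⟩
      2ℚ * (n * X - 0ℚ * 0ℚ) * (c * c)
        ≡⟨ cong (λ z → 2ℚ * (n * X - z * z) * (c * c)) (sym x⊥1) ⟩
      2ℚ * (n * X - sum x * sum x) * (c * c)
        ≡⟨ cong (_* (c * c)) (sym (∑-differences x)) ⟩
      sum (λ i → sum (λ j → (x j - x i) * (x j - x i))) * (c * c)
        ≡⟨ trans (*-distribʳ-sum (c * c) (λ i → sum (λ j → (x j - x i) * (x j - x i)))) (sum-cong-≗ (λ i → *-distribʳ-sum (c * c) (λ j → (x j - x i) * (x j - x i)))) ⟩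
      sum (λ i → sum (λ j → (x j - x i) * (x j - x i) * (c * c)))
        ≤⟨ ∑-mono (λ i → ∑-mono (λ j → pair i j)) ⟩
      sum {suc m} (λ i → sum {suc m} (λ j → e * e * (P * P)))
        ≡⟨ trans (sum-cong-≗ {suc m} (λ i → ∑-const (suc m) (e * e * (P * P)))) (∑-const (suc m) (n * (e * e * (P * P)))) ⟩
      n * (n * (e * e * (P * P)))
        ≤⟨ *-monoˡ n (<⇒≤ 0<n) (*-monoˡ n (<⇒≤ 0<n) (*-monoʳ (P * P) (0≤* 0≤P 0≤P) (≤-trans e² (*-monoˡ n (<⇒≤ 0<n) V≤)))) ⟩
      n * (n * (n * ((R * ε + ε * ε) * X) * (P * P)))
        ≡⟨ solve 4 (λ n r x p → n :* (n :* (n :* (r :* x) :* p)) := n :* (n :* n :* r :* p :* x)) refl n (R * ε + ε * ε) X (P * P) ⟩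
      n * (n * n * (R * ε + ε * ε) * (P * P) * X) ∎)
      where open ≤-Reasoning
    strict : n * n * (R * ε + ε * ε) * (P * P) * X < 2ℚ * (c * c * X)
    strict = <-≤-trans (*-monoˡ-<-pos X {{positive 0<X}} small)
      (≤-by (c * c * X) (0≤* (0≤* 0≤c 0≤c) (<⇒≤ 0<X)) (solve 1 (λ z → con 2ℚ :* z := z :+ z) refl (c * c * X)))

  shift : ∀ {n} → Mat n → ℚ → Mat n
  shift M t i j = M i j - t * δ i j

  ∑-δ-row : ∀ {n} (i : Fin n) → sum (δ i) ≡ 1ℚ
  ∑-δ-row i = trans (∑-single i (λ j j≢i → δ-≢ (j≢i ∘ sym))) (δ-refl i)

  shift-sym : ∀ {n} (M : Mat n) t → Sym M → Sym (shift M t)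
  shift-sym M t M-sym i j = cong₂ (λ a b → a - t * b) (M-sym i j) (δ-sym i j)

  shift-row : ∀ {n} (M : Mat n) t ρ → (∀ i → sum (M i) ≡ ρ) → ∀ i → sum (shift M t i) ≡ ρ - t
  shift-row M t ρ M-row i = trans (∑-distrib-- (M i) (λ j → t * δ i j))
    (cong₂ _-_ (M-row i) (trans (sym (*-distribˡ-sum t (δ i))) (trans (cong (t *_) (∑-δ-row i)) (*-identityʳ t))))

  0≤δ : ∀ {n} (i j : Fin n) → 0ℚ ≤ δ i j
  0≤δ i j with i Fin.≟ j
  ... | yes _ = 0≤1
  ... | no _ = ≤-refl

  shift-norm : ∀ {n} (M : Mat n) t R → 0ℚ ≤ t → (∀ i → sum (λ j → ∣ M i j ∣) ≤ R) → ∀ i → sum (λ j → ∣ shift M t i j ∣) ≤ R + t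
  shift-norm M t R 0≤t h i = begin
    sum (λ j → ∣ M i j - t * δ i j ∣)       ≤⟨ ∑-mono (λ j → ≤-trans (∣p+q∣≤∣p∣+∣q∣ (M i j) (- (t * δ i j)))
                                (≤-reflexive (cong (∣ M i j ∣ +_) (trans (∣-p∣≡∣p∣ (t * δ i j)) (0≤p⇒∣p∣≡p (0≤* 0≤t (0≤δ i j))))))) ⟩
    sum (λ j → ∣ M i j ∣ + t * δ i j)       ≡⟨ ∑-distrib-+ (λ j → ∣ M i j ∣) (λ j → t * δ i j) ⟩
    sum (λ j → ∣ M i j ∣) + sum (λ j → t * δ i j)
                                ≡⟨ cong (sum (λ j → ∣ M i j ∣) +_) (trans (sym (*-distribˡ-sum t (δ i))) (trans (cong (t *_) (∑-δ-row i)) (*-identityʳ t))) ⟩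
    sum (λ j → ∣ M i j ∣) + t  ≤⟨ +-monoˡ-≤ t (h i) ⟩
    _  ∎
    where open ≤-Reasoning

  quad-shift : ∀ {n} (M : Mat n) t x → quad (shift M t) x ≡ quad M x - t * normSq x
  quad-shift M t x = trans (sum-cong-≗ (λ i → cong (x i *_) (row i)))
    (trans (dot-linearʳ x 1ℚ (- t) (M ⊛ x) x) (solve 3 (λ q t n → con 1ℚ :* q :+ (:- t) :* n := q :- t :* n) refl (quad M x) t (normSq x)))
    where
    row : ∀ i → (shift M t ⊛ x) i ≡ 1ℚ * (M ⊛ x) i + (- t) * x i
    row i = trans (sum-cong-≗ (λ j → solve 4 (λ m t d x → (m :- t :* d) :* x := con 1ℚ :* (m :* x) :+ (:- t) :* (d :* x)) refl (M i j) t (δ i j) (x j)))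
      (trans (∑-linear 1ℚ (- t) (λ j → M i j * x j) (λ j → δ i j * x j)) (cong (λ z → 1ℚ * (M ⊛ x) i + (- t) * z) (∑-δ x i)))

  -- PSD⊥ propagates from M to M - Jε in steps of ε, because M - kε never gets close to being singular on 1^⊥.
  descend : ∀ {m} (M : Mat (suc m)) s ρ R c ε J →
    Sym M → (∀ i → sum (M i) ≡ ρ) → s * s ≡ 1ℚ → (∀ i → sum (λ j → ∣ M i j ∣) ≤ R) → 0ℚ < ε → 0ℚ ≤ c →
    let Q = R + ι J * ε + ι (suc m) in
    ι (suc m) * ι (suc m) * (Q * ε + ε * ε) * (Q ^ m * Q ^ m) < c * c →
    (∀ k → k ℕ.< J → let τ = s * (ρ - ι (suc k) * ε) in
      0ℚ < τ × τ * c ≤ ∣ detℚ (λ i j → s * shift M (ι (suc k) * ε) i j) ∣) →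
    PSD⊥ M → ∀ x → sum x ≡ 0ℚ → ι J * ε * normSq x ≤ quad M x
  descend {m} M s ρ R c ε J M-sym M-row s² M≤R 0<ε 0≤c small dets psd x x⊥1 =
    ≤-by (quad (shift M (ι J * ε)) x) (go J ℕ.≤-refl x x⊥1)
      (trans (solve 2 (λ q t → q := t :+ (q :- t)) refl (quad M x) (ι J * ε * normSq x)) (cong (ι J * ε * normSq x +_) (sym (quad-shift M (ι J * ε) x))))
    where
    Q = R + ι J * ε + ι (suc m)
    0≤R : 0ℚ ≤ R
    0≤R = ≤-trans (0≤∑ (λ j → 0≤∣p∣ (M zero j))) (M≤R zero)
    0≤Jε : 0ℚ ≤ ι J * ε
    0≤Jε = 0≤* (0≤ι J) (<⇒≤ 0<ε)
    n≤Q : ι (suc m) ≤ Q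
    n≤Q = ≤-by (R + ι J * ε) (0≤+ 0≤R 0≤Jε) (+-comm (R + ι J * ε) (ι (suc m)))
    norm≤Q : ∀ k → k ℕ.≤ J → ∀ i → sum (λ j → ∣ shift M (ι k * ε) i j ∣) ≤ Q
    norm≤Q k k≤J i = ≤-trans (shift-norm M (ι k * ε) R (0≤* (0≤ι k) (<⇒≤ 0<ε)) M≤R i)
      (≤-trans (+-monoʳ-≤ R (*-monoʳ ε (<⇒≤ 0<ε) (ι-mono k≤J))) (≤-by (ι (suc m)) (0≤ι (suc m)) refl))
    ∣s∣ : ∣ s ∣ ≡ 1ℚ
    ∣s∣ = ≤-antisym (square-≤⁻¹ 0≤1 (≤-reflexive (trans (∣∣*∣∣ s) s²))) (square-≤⁻¹ (0≤∣p∣ s) (≤-reflexive (sym (trans (∣∣*∣∣ s) s²))))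
    go : ∀ k → k ℕ.≤ J → PSD⊥ (shift M (ι k * ε))
    go zero _ y y⊥1 = subst (0ℚ ≤_) (sym (trans (quad-shift M (ι 0 * ε) y) (trans (cong (λ z → quad M y - z * ε * normSq y) (ι-def 0))
      (solve 3 (λ q e n → q :- con 0ℚ :* e :* n := q) refl (quad M y) ε (normSq y))))) (psd y y⊥1)
    go (suc k) k<J y y⊥1 = subst (0ℚ ≤_) (trans (cong (_- ε * normSq y) (quad-shift M (ι k * ε) y)) (trans
        (trans (solve 4 (λ q k e n → (q :- k :* e :* n) :- e :* n := q :- (con 1ℚ :+ k) :* e :* n) refl (quad M y) (ι k) ε (normSq y))
          (cong (λ z → quad M y - z * ε * normSq y) (sym (ι-suc k)))) (sym (quad-shift M (ι (suc k) * ε) y))))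
      (0≤Δ (shift-PSD⊥ (shift M (ι k * ε)) A s (s * (ρ - ι (suc k) * ε)) (ρ - ι k * ε) Q Q c ε
        (shift-sym M (ι k * ε) M-sym) (shift-row M (ι k * ε) ρ M-row) s² A≡ (λ i j → cong (s *_) (shift-sym M (ι (suc k) * ε) M-sym i j)) A-row
        (proj₁ (dets k k<J)) (<-≤-trans (0<ι-suc m) n≤Q) (norm≤Q k (ℕ.<⇒≤ k<J)) A≤Q n≤Q 0≤c (proj₂ (dets k k<J)) 0<ε small (go k (ℕ.<⇒≤ k<J)) y y⊥1))
      where
      A : Mat (suc m)
      A i j = s * shift M (ι (suc k) * ε) i j
      A≡ : ∀ i j → A i j ≡ s * (shift M (ι k * ε) i j - ε * δ i j)
      A≡ i j = cong (s *_) (trans (cong (λ z → M i j - z * ε * δ i j) (ι-suc k))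
        (solve 4 (λ a k e d → a :- (con 1ℚ :+ k) :* e :* d := (a :- k :* e :* d) :- e :* d) refl (M i j) (ι k) ε (δ i j)))
      A-row : ∀ i → sum (A i) ≡ s * (ρ - ι (suc k) * ε)
      A-row i = trans (sym (*-distribˡ-sum s (shift M (ι (suc k) * ε) i))) (cong (s *_) (shift-row M (ι (suc k) * ε) ρ M-row i))
      A≤Q : ∀ i → sum (λ j → ∣ A i j ∣) ≤ Q
      A≤Q i = ≤-trans (≤-reflexive (sum-cong-≗ (λ j → trans (∣p*q∣≡∣p∣*∣q∣ s (shift M (ι (suc k) * ε) i j))
        (trans (cong (_* ∣ shift M (ι (suc k) * ε) i j ∣) ∣s∣) (*-identityˡ ∣ shift M (ι (suc k) * ε) i j ∣))))) (norm≤Q (suc k) k<J i)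

  -- The number of steps is one more than a natural number bounding W T / d; the extra step makes
  -- the last inequality strict.
  mesh : ∀ T W d → 0ℚ < T → 0ℚ ≤ W → 0ℚ < d → ∃[ J ] ∃[ ε ] ι J * ε ≡ T × 0ℚ < ε × ε ≤ T × W * ε < d
  mesh T W d 0<T 0≤W 0<d with inverse d 0<d
  ... | d⁻¹ , 0<d⁻¹ , dd⁻¹≡1 with archimedean (W * T * d⁻¹)
  ... | J , bound with inverse (ι (suc J)) (0<ι-suc J)
  ... | j⁻¹ , 0<j⁻¹ , jj⁻¹≡1 = suc J , T * j⁻¹
    , trans (solve 3 (λ j t i → j :* (t :* i) := j :* i :* t) refl (ι (suc J)) T j⁻¹) (trans (cong (_* T) jj⁻¹≡1) (*-identityˡ T))
    , 0<* 0<T 0<j⁻¹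
    , *-cancelʳ-≤ (ι (suc J)) (0<ι-suc J) (≤-by (T * ι J) (0≤* (<⇒≤ 0<T) (0≤ι J)) (begin
        T * ι (suc J)  ≡⟨ cong (T *_) (ι-suc J) ⟩
        T * (1ℚ + ι J)  ≡⟨ solve 2 (λ t j → t :* (con 1ℚ :+ j) := t :* con 1ℚ :+ t :* j) refl T (ι J) ⟩
        T * 1ℚ + T * ι J  ≡⟨ cong (λ z → T * z + T * ι J) (sym jj⁻¹≡1) ⟩
        T * (ι (suc J) * j⁻¹) + T * ι J  ≡⟨ cong (_+ T * ι J) (solve 3 (λ j t i → t :* (j :* i) := t :* i :* j) refl (ι (suc J)) T j⁻¹) ⟩
        T * j⁻¹ * ι (suc J) + T * ι J  ∎))
    , *-cancelʳ-< (ι (suc J)) (0≤ι (suc J)) (<-by (d * (1ℚ + (ι J - W * T * d⁻¹)))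
        (0<* 0<d (+-mono-<-≤ {0ℚ} {1ℚ} {0ℚ} {ι J - W * T * d⁻¹} 0<1 (0≤Δ bound))) (begin
        d * ι (suc J)  ≡⟨ cong (d *_) (ι-suc J) ⟩
        d * (1ℚ + ι J)  ≡⟨ solve 5 (λ d j w t i → d :* (con 1ℚ :+ j) := d :* i :* (w :* t) :+ d :* (con 1ℚ :+ (j :- w :* t :* i))) refl d (ι J) W T d⁻¹ ⟩
        d * d⁻¹ * (W * T) + r  ≡⟨ cong (λ z → z * (W * T) + r) (trans dd⁻¹≡1 (sym jj⁻¹≡1)) ⟩
        ι (suc J) * j⁻¹ * (W * T) + r  ≡⟨ cong (_+ r) (solve 4 (λ j i w t → j :* i :* (w :* t) := w :* (t :* i) :* j) refl (ι (suc J)) j⁻¹ W T) ⟩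
        W * (T * j⁻¹) * ι (suc J) + r  ∎))
    where
    open ≡-Reasoning
    r = d * (1ℚ + (ι J - W * T * d⁻¹))

-- Statements about reals as statements about all late terms of their Cauchy sequences.

module RealSequences where

  open Rationals
  open R using (ℝ; module ℝ; mk≈; mk<; shrink; telescope; +-differences; *-differences; sum-<; half-pos; *-<-bound; eventually-bounded)
  open ℝ using (seq; cauchy)
  open Determinants

  Eventually : (ℕ → Set) → Set
  Eventually P = ∃[ N ] ∀ j → N ℕ.≤ j → P j

  ev-map : ∀ {P Q : ℕ → Set} → (∀ j → P j → Q j) → Eventually P → Eventually Q
  ev-map f (N , h) = N , λ j N≤j → f j (h j N≤j)

  infixr 2 _⊓ᵉ_

  _⊓ᵉ_ : ∀ {P Q : ℕ → Set} → Eventually P → Eventually Q → Eventually (λ j → P j × Q j)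
  (M , h) ⊓ᵉ (N , k) = M ℕ.⊔ N , λ j le → h j (ℕ.m⊔n≤o⇒m≤o M N le) , k j (ℕ.m⊔n≤o⇒n≤o M N le)

  ev-Fin : ∀ {n} {P : Fin n → ℕ → Set} → (∀ i → Eventually (P i)) → Eventually (λ j → ∀ i → P i j)
  ev-Fin {zero} h = 0 , λ _ _ ()
  ev-Fin {suc n} h = ev-map (λ { j (p , q) zero → p ; j (p , q) (suc i) → q i }) (h zero ⊓ᵉ ev-Fin (h ∘ suc))

  ev-< : ∀ n {P : ℕ → ℕ → Set} → (∀ k → Eventually (P k)) → Eventually (λ j → ∀ k → k ℕ.< n → P k j)
  ev-< zero h = 0 , λ _ _ _ ()
  ev-< (suc n) {P} h = ev-map (λ { j (p , q) zero _ → p ; j (p , q) (suc k) (s≤s lt) → q k lt }) (h zero ⊓ᵉ ev-< n {λ k → P (suc k)} (h ∘ suc))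

  seq-sum : ∀ {n} (f : Fin n → ℝ) j → seq (R.sum f) j ≡ sum (λ i → seq (f i) j)
  seq-sum {zero} f j = refl
  seq-sum {suc n} f j = cong (seq (f zero) j +_) (seq-sum (f ∘ suc) j)

  seq-product : ∀ {n} (f : Fin n → ℝ) j → seq (R.product f) j ≡ product (λ i → seq (f i) j)
  seq-product {zero} f j = refl
  seq-product {suc n} f j = cong (seq (f zero) j *_) (seq-product (f ∘ suc) j)

  seq-^ : ∀ x k j → seq (x R.^ k) j ≡ seq x j ^ k
  seq-^ x zero j = refl
  seq-^ x (suc k) j = cong (seq x j *_) (seq-^ x k j)

  seq-det : ∀ {n} (A : R.Matrix n) j → seq (R.det A) j ≡ detℚ (λ i k → seq (A i k) j)
  seq-det {zero} A j = refl
  seq-det {suc n} A j = trans (seq-sum (λ i → (R.- R.1ℝ) R.^ toℕ i R.* A zero i R.* R.det (λ k l → A (suc k) (punchIn i l))) j) (sum-cong-≗ (λ i → cong₂ _*_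
    (cong (_* seq (A zero i) j) (seq-^ (R.- R.1ℝ) (toℕ i) j)) (seq-det (λ k l → A (suc k) (punchIn i l)) j)))

  ∣-∣-comm : ∀ p q → ∣ p - q ∣ ≡ ∣ q - p ∣
  ∣-∣-comm p q = trans (cong ∣_∣ (solve 2 (λ p q → p :- q := :- (q :- p)) refl p q)) (∣-p∣≡∣p∣ (q - p))

  ≈-refl : ∀ {x} → x R.≈ x
  ≈-refl {x} = mk≈ λ ε ε>0 → 0 , λ j _ → subst (_< ε) (cong ∣_∣ (sym (+-inverseʳ (seq x j)))) ε>0

  ≈-trans : ∀ {x y z} → x R.≈ y → y R.≈ z → x R.≈ z
  ≈-trans {x} {y} {z} (mk≈ h) (mk≈ k) = mk≈ λ ε ε>0 → ev-map
    (λ j (p , q) → sum-< (seq x j - seq y j) (seq y j - seq z j) (telescope (seq x j) (seq y j) (seq z j)) p q)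
    (h (½ * ε) (half-pos ε>0) ⊓ᵉ k (½ * ε) (half-pos ε>0))

  ≈-sym : ∀ {x y} → x R.≈ y → y R.≈ x
  ≈-sym {x} {y} (mk≈ h) = mk≈ λ ε ε>0 → ev-map (λ j → subst (_< ε) (∣-∣-comm (seq x j) (seq y j))) (h ε ε>0)

  +-cong : ∀ {x x′ y y′} → x R.≈ x′ → y R.≈ y′ → x R.+ y R.≈ x′ R.+ y′
  +-cong {x} {x′} {y} {y′} (mk≈ h) (mk≈ k) = mk≈ λ ε ε>0 → ev-map
    (λ j (p , q) → sum-< (seq x j - seq x′ j) (seq y j - seq y′ j) (+-differences (seq x j) (seq y j) (seq x′ j) (seq y′ j)) p q)
    (h (½ * ε) (half-pos ε>0) ⊓ᵉ k (½ * ε) (half-pos ε>0))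

  neg-cong : ∀ {x x′} → x R.≈ x′ → R.- x R.≈ R.- x′
  neg-cong {x} {x′} (mk≈ h) = mk≈ λ ε ε>0 → ev-map
    (λ j → subst (_< ε) (trans (∣-∣-comm (seq x j) (seq x′ j)) (cong ∣_∣ (solve 2 (λ p q → q :- p := :- p :- :- q) refl (seq x j) (seq x′ j))))) (h ε ε>0)

  *-cong : ∀ {x x′ y y′} → x R.≈ x′ → y R.≈ y′ → x R.* y R.≈ x′ R.* y′
  *-cong {x} {x′} {y} {y′} (mk≈ h) (mk≈ k) = mk≈ close
    where
    close : ∀ ε → 0ℚ < ε → Eventually (λ j → ∣ seq x j * seq y j - seq x′ j * seq y′ j ∣ < ε)
    close ε ε>0 with eventually-bounded x | eventually-bounded y′
    ... | A , A>0 , evA | B , B>0 , evB with shrink A>0 (half-pos ε>0) | shrink B>0 (half-pos ε>0)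
    ... | α , α>0 , hα | β , β>0 , hβ = ev-map
      (λ j (∣x∣≤A , ∣y′∣≤B , x-x′ , y-y′) → sum-< (seq x j * (seq y j - seq y′ j)) (seq y′ j * (seq x j - seq x′ j))
        (*-differences (seq x j) (seq y j) (seq x′ j) (seq y′ j))
        (*-<-bound {seq x j} A>0 ∣x∣≤A (hα _ y-y′)) (*-<-bound {seq y′ j} B>0 ∣y′∣≤B (hβ _ x-x′)))
      (evA ⊓ᵉ evB ⊓ᵉ h β β>0 ⊓ᵉ k α α>0)

  sum-cong : ∀ {n} {f g : Fin n → ℝ} → (∀ i → f i R.≈ g i) → R.sum f R.≈ R.sum g
  sum-cong {zero} h = ≈-refl
  sum-cong {suc n} h = +-cong (h zero) (sum-cong (h ∘ suc))

  det-cong-≈ : ∀ {n} {A B : R.Matrix n} → (∀ i j → A i j R.≈ B i j) → R.det A R.≈ R.det B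
  det-cong-≈ {zero} h = ≈-refl
  det-cong-≈ {suc n} h = sum-cong λ j → *-cong (*-cong (≈-refl {(R.- R.1ℝ) R.^ toℕ j}) (h zero j)) (det-cong-≈ λ i k → h (suc i) (punchIn j k))

  eventually-close : ∀ {x y} → x R.≈ y → ∀ ε → 0ℚ < ε → Eventually (λ j → ∣ seq x j - seq y j ∣ < ε)
  eventually-close (mk≈ h) = h

  ∣-∣<⇒ : ∀ p q {ε} → ∣ p - q ∣ < ε → p ≤ q + ε × q ≤ p + ε
  ∣-∣<⇒ p q {ε} h =
    ≤-by (ε - (p - q)) (0≤Δ (≤-trans (p≤∣p∣ (p - q)) (<⇒≤ h))) (solve 3 (λ p q e → q :+ e := p :+ (e :- (p :- q))) refl p q ε) ,
    ≤-by (ε - - (p - q)) (0≤Δ (≤-trans (-p≤∣p∣ (p - q)) (<⇒≤ h))) (solve 3 (λ p q e → p :+ e := q :+ (e :- (:- (p :- q)))) refl p q ε)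

  -- As `x ≤ y` is merely the negation of `y < x`, positive information is obtained by deciding a
  -- rational inequality at one index past both moduli. If it fails there, `x` exceeds `y` by at
  -- least `h` at all later indices, which contradicts the hypothesis.
  eventually-≤ : ∀ {x y} → x R.≤ y → ∀ ε → 0ℚ < ε → Eventually (λ j → seq x j ≤ seq y j + ε)
  eventually-≤ {x} {y} x≤y ε ε>0 = from-cauchy (cauchy x h h>0) (cauchy y h h>0)
    where
    -- An eighth of `ε`: the comparison at the chosen index takes three parts and the two Cauchy
    -- estimates one each, which leaves three parts to spare.
    h = ½ * (½ * (½ * ε))
    h>0 : 0ℚ < h
    h>0 = half-pos (half-pos (half-pos ε>0))
    from-cauchy : (∃[ M ] ∀ i j → M ℕ.≤ i → M ℕ.≤ j → ∣ seq x i - seq x j ∣ < h) →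
                  (∃[ N ] ∀ i j → N ℕ.≤ i → N ℕ.≤ j → ∣ seq y i - seq y j ∣ < h) → Eventually (λ j → seq x j ≤ seq y j + ε)
    from-cauchy (M , hx) (N , hy) with seq x K ≤? seq y K + (h + h + h)
      where K = M ℕ.⊔ N
    ... | yes le = K , λ j K≤j → ≤-by
        (((seq x K + h) - seq x j) + ((seq y K + (h + h + h)) - seq x K) + ((seq y j + h) - seq y K) + (h + h + h))
        (0≤+ (0≤+ (0≤+ (0≤Δ (proj₁ (∣-∣<⇒ (seq x j) (seq x K) (hx j K (M≤ K≤j) (M≤ ℕ.≤-refl))))) (0≤Δ le)) (0≤Δ (proj₁ (∣-∣<⇒ (seq y K) (seq y j) (hy K j (N≤ ℕ.≤-refl) (N≤ K≤j))))))
              (0≤+ (0≤+ (<⇒≤ h>0) (<⇒≤ h>0)) (<⇒≤ h>0)))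
        (solve 5 (λ e xj yj xK yK → let h = con ½ :* (con ½ :* (con ½ :* e)) in
          yj :+ e := xj :+ (((xK :+ h) :- xj) :+ ((yK :+ (h :+ h :+ h)) :- xK) :+ ((yj :+ h) :- yK) :+ (h :+ h :+ h))) refl ε (seq x j) (seq y j) (seq x K) (seq y K))
      where
      K = M ℕ.⊔ N
      M≤ : ∀ {j} → K ℕ.≤ j → M ℕ.≤ j
      M≤ = ℕ.m⊔n≤o⇒m≤o M N
      N≤ : ∀ {j} → K ℕ.≤ j → N ℕ.≤ j
      N≤ = ℕ.m⊔n≤o⇒n≤o M N
    ... | no ≰ = contradiction (mk< h h>0 K λ j K≤j → ≤-by
        (((seq x j + h) - seq x K) + (seq x K - (seq y K + (h + h + h))) + ((seq y K + h) - seq y j))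
        (0≤+ (0≤+ (0≤Δ (proj₁ (∣-∣<⇒ (seq x K) (seq x j) (hx K j (M≤ ℕ.≤-refl) (M≤ K≤j))))) (0≤Δ (<⇒≤ (≰⇒> ≰)))) (0≤Δ (proj₁ (∣-∣<⇒ (seq y j) (seq y K) (hy j K (N≤ K≤j) (N≤ ℕ.≤-refl))))))
        (solve 5 (λ h xj yj xK yK → xj := (yj :+ h) :+ (((xj :+ h) :- xK) :+ (xK :- (yK :+ (h :+ h :+ h))) :+ ((yK :+ h) :- yj))) refl h (seq x j) (seq y j) (seq x K) (seq y K))) x≤y
      where
      K = M ℕ.⊔ N
      M≤ : ∀ {j} → K ℕ.≤ j → M ℕ.≤ j
      M≤ = ℕ.m⊔n≤o⇒m≤o M N
      N≤ : ∀ {j} → K ℕ.≤ j → N ℕ.≤ j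
      N≤ = ℕ.m⊔n≤o⇒n≤o M N

  product≥ : ∀ {n} (f : Fin n → ℚ) q → 0ℚ ≤ q → (∀ i → q ≤ ∣ f i ∣) → q ^ n ≤ ∣ product f ∣
  product≥ {zero} f q 0≤q h = ≤-refl
  product≥ {suc n} f q 0≤q h = subst (q ^ suc n ≤_) (sym (∣p*q∣≡∣p∣*∣q∣ (f zero) (product (f ∘ suc))))
    (*-mono 0≤q (h zero) (0≤^ n 0≤q) (product≥ (f ∘ suc) q 0≤q (h ∘ suc)))

-- From the characteristic polynomial of the Laplacian to bounds on Rayleigh quotients.

module RayleighBounds where

  open Rationals
  open R using (ℝ; module ℝ; mk<; half-pos; eventually-bounded; IsSpectrum)
  open ℝ using (seq)
  open Determinants
  open QuadraticForms
  open Descent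
  open RealSequences

  lap : ∀ {n} → Mat n → Mat n
  lap W i k = δ i k * sum (W i) - W i k

  lap-sym : ∀ {n} (W : Mat n) → Sym W → Sym (lap W)
  lap-sym W W-sym i k with i Fin.≟ k
  ... | yes refl = cong (λ d → d * sum (W i) - W i i) (sym (δ-refl i))
  ... | no i≢k = cong₂ (λ a b → a - b) (trans (*-zeroˡ (sum (W i))) (sym (trans (cong (_* sum (W k)) (δ-≢ (i≢k ∘ sym))) (*-zeroˡ (sum (W k)))))) (W-sym i k)

  lap-row : ∀ {n} (W : Mat n) i → sum (lap W i) ≡ 0ℚ
  lap-row W i = trans (∑-distrib-- (λ k → δ i k * sum (W i)) (W i)) (trans
    (cong (_- sum (W i)) (trans (sym (*-distribʳ-sum (sum (W i)) (δ i))) (trans (cong (_* sum (W i)) (∑-δ-row i)) (*-identityˡ (sum (W i))))))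
    (+-inverseʳ (sum (W i))))

  lap-⊛ : ∀ {n} (W : Mat n) x i → (lap W ⊛ x) i ≡ sum (W i) * x i + - 1ℚ * (W ⊛ x) i
  lap-⊛ W x i = trans (sum-cong-≗ (λ k → solve 4 (λ d s w x → (d :* s :- w) :* x := s :* (d :* x) :+ con (- 1ℚ) :* (w :* x)) refl (δ i k) (sum (W i)) (W i k) (x k)))
    (trans (∑-linear (sum (W i)) (- 1ℚ) (λ k → δ i k * x k) (λ k → W i k * x k)) (cong (λ z → sum (W i) * z + - 1ℚ * (W ⊛ x) i) (∑-δ x i)))

  2*quad-lap : ∀ {n} (W : Mat n) → Sym W → ∀ x → 2ℚ * quad (lap W) x ≡ sum (λ i → sum (λ k → W i k * ((x i - x k) * (x i - x k))))
  2*quad-lap {n} W W-sym x = sym (begin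
    sum (λ i → sum (λ k → W i k * ((x i - x k) * (x i - x k))))
      ≡⟨ trans (sum-cong-≗ (λ i → trans (sum-cong-≗ (λ k → expand i k)) (∑-distrib-+ (half i) (λ k → half k i))))
           (∑-distrib-+ (λ i → sum (half i)) (λ i → sum (λ k → half k i))) ⟩
    H + sum (λ i → sum (λ k → half k i))
      ≡⟨ cong (H +_) (∑-comm (λ i k → half k i)) ⟩
    H + H
      ≡⟨ solve 1 (λ h → h :+ h := con 2ℚ :* h) refl H ⟩
    2ℚ * H
      ≡⟨ cong (2ℚ *_) (sum-cong-≗ row) ⟩
    2ℚ * quad (lap W) x ∎)
    where
    open ≡-Reasoning
    half : Fin n → Fin n → ℚ
    half i k = x i * (W i k * x i - W i k * x k)
    H = sum (λ i → sum (half i))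
    expand : ∀ i k → W i k * ((x i - x k) * (x i - x k)) ≡ half i k + half k i
    expand i k = trans (solve 3 (λ w x y → w :* ((x :- y) :* (x :- y)) := x :* (w :* x :- w :* y) :+ y :* (w :* y :- w :* x)) refl (W i k) (x i) (x k))
      (cong (λ w → half i k + x k * (w * x k - w * x i)) (W-sym i k))
    row : ∀ i → sum (half i) ≡ x i * (lap W ⊛ x) i
    row i = begin
      sum (λ k → x i * (W i k * x i - W i k * x k))  ≡⟨ sym (*-distribˡ-sum (x i) (λ k → W i k * x i - W i k * x k)) ⟩
      x i * sum (λ k → W i k * x i - W i k * x k)  ≡⟨ cong (x i *_) (∑-distrib-- (λ k → W i k * x i) (λ k → W i k * x k)) ⟩
      x i * (sum (λ k → W i k * x i) - (W ⊛ x) i)  ≡⟨ cong (λ z → x i * (z - (W ⊛ x) i)) (sym (*-distribʳ-sum (x i) (W i))) ⟩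
      x i * (sum (W i) * x i - (W ⊛ x) i)  ≡⟨ cong (x i *_) (solve 2 (λ a b → a :- b := a :+ con (- 1ℚ) :* b) refl (sum (W i) * x i) ((W ⊛ x) i)) ⟩
      x i * (sum (W i) * x i + - 1ℚ * (W ⊛ x) i)  ≡⟨ cong (x i *_) (sym (lap-⊛ W x i)) ⟩
      x i * (lap W ⊛ x) i  ∎

  lap-psd : ∀ {n} (W : Mat n) → Sym W → (∀ i k → 0ℚ ≤ W i k) → ∀ x → 0ℚ ≤ quad (lap W) x
  lap-psd W W-sym 0≤W x = *-cancelˡ-≤ 2ℚ 0<2 (subst₂ _≤_ (sym (*-zeroʳ 2ℚ)) (sym (2*quad-lap W W-sym x))
    (0≤∑ λ i → 0≤∑ λ k → 0≤* (0≤W i k) (0≤-square (x i - x k))))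

  lap-norm : ∀ {n} (W : Mat n) r → (∀ i k → ∣ W i k ∣ ≤ r) → ∀ i → sum (λ k → ∣ lap W i k ∣) ≤ ι n * r + ι n * r
  lap-norm {n} W r h i = begin
    sum (λ k → ∣ δ i k * S - W i k ∣)  ≤⟨ ∑-mono (λ k → ≤-trans (∣p-q∣≤∣p∣+∣q∣ (δ i k * S) (W i k))
                                (≤-reflexive (cong (_+ ∣ W i k ∣) (trans (∣p*q∣≡∣p∣*∣q∣ (δ i k) S) (cong (_* ∣ S ∣) (0≤p⇒∣p∣≡p (0≤δ i k))))))) ⟩
    sum (λ k → δ i k * ∣ S ∣ + ∣ W i k ∣)  ≡⟨ ∑-distrib-+ (λ k → δ i k * ∣ S ∣) (λ k → ∣ W i k ∣) ⟩
    sum (λ k → δ i k * ∣ S ∣) + T  ≡⟨ cong (_+ T) (trans (sym (*-distribʳ-sum ∣ S ∣ (δ i))) (trans (cong (_* ∣ S ∣) (∑-δ-row i)) (*-identityˡ ∣ S ∣))) ⟩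
    ∣ S ∣ + T  ≤⟨ +-mono-≤ (≤-trans (∣∑∣≤ (W i)) T≤) T≤ ⟩
    ι n * r + ι n * r  ∎
    where
    open ≤-Reasoning
    S = sum (W i)
    T = sum (λ k → ∣ W i k ∣)
    T≤ : T ≤ ι n * r
    T≤ = ≤-trans (∑-mono (h i)) (≤-reflexive (∑-const n r))

  -- `det-differences` with `τ = 0`, for a vector whose first two entries differ.
  det-singular : ∀ {m} (A : Mat (suc (suc m))) → Sym A → (∀ i → sum (A i) ≡ 0ℚ) → detℚ A ≡ 0ℚ
  det-singular A A-sym A-row = trans (solve 1 (λ d → d := :- ((con 0ℚ :- con 1ℚ) :* d)) refl (detℚ A))
    (cong -_ (trans (det-differences A A-sym 0ℚ A-row (δ zero) zero (suc zero) (λ ())) (*-zeroˡ (detℚ (A [ zero ≔ ones ] [ suc zero ≔ A ⊛ δ zero ])))))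

  -- The factor of the smallest eigenvalue is at least t - t₀/2, hence at least t/2, and each other
  -- factor is at least `g`. Subtracting the error `ε` leaves a quarter of `t * g ^ k`. The factor
  -- `t` is kept because it is the row sum `τ` in `descend`.
  det≥ : ∀ {k} t t₀ g ε (μ : Fin (suc k) → ℚ) D → 0ℚ < t₀ → t₀ ≤ t → 0ℚ ≤ g → μ zero ≤ ½ * t₀ → (∀ i → g ≤ ∣ t - μ (suc i) ∣) →
    ∣ D - product (λ i → t - μ i) ∣ < ε → ε ≤ ½ * ½ * (t₀ * g ^ k) → t * (½ * ½ * g ^ k) ≤ ∣ D ∣
  det≥ {k} t t₀ g ε μ D 0<t₀ t₀≤t 0≤g μ₀≤ gap close ε≤ = ≤-by
    ((∣ D ∣ - (∣ Π ∣ - ε)) + (∣ Π ∣ - (t - ½ * t₀) * P) + (½ * ½ * (t₀ * P) - ε) + (½ + ½ * ½) * ((t - t₀) * P))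
    (0≤+ (0≤+ (0≤+ (0≤Δ D≥) (0≤Δ Π≥)) (0≤Δ ε≤)) (0≤* {½ + ½ * ½} (*≤* (ℤ.+≤+ z≤n)) (0≤* (0≤Δ t₀≤t) 0≤P)))
    (solve 6 (λ d e p t t₀ g → d := t :* (con ½ :* con ½ :* g) :+ ((d :- (p :- e)) :+ (p :- (t :- con ½ :* t₀) :* g) :+
       (con ½ :* con ½ :* (t₀ :* g) :- e) :+ (con ½ :+ con ½ :* con ½) :* ((t :- t₀) :* g))) refl (∣ D ∣) ε (∣ Π ∣) t t₀ P)
    where
    P = g ^ k
    0≤P = 0≤^ k 0≤g
    Π = product (λ i → t - μ i)
    D≥ : ∣ Π ∣ - ε ≤ ∣ D ∣
    D≥ = ≤-by (ε - ∣ D - Π ∣ + (∣ D ∣ + ∣ D - Π ∣ - ∣ Π ∣))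
      (0≤+ (0≤Δ (<⇒≤ close)) (0≤Δ (≤-trans (≤-reflexive (cong ∣_∣ (solve 2 (λ p d → p := d :- (d :- p)) refl Π D))) (∣p-q∣≤∣p∣+∣q∣ D (D - Π)))))
      (solve 4 (λ d p e c → d := (p :- e) :+ (e :- c :+ (d :+ c :- p))) refl (∣ D ∣) (∣ Π ∣) ε (∣ D - Π ∣))
    0≤t-½t₀ : 0ℚ ≤ t - ½ * t₀
    0≤t-½t₀ = subst (0ℚ ≤_) (solve 2 (λ t t₀ → (t :- t₀) :+ con ½ :* t₀ := t :- con ½ :* t₀) refl t t₀) (0≤+ (0≤Δ t₀≤t) (<⇒≤ (half-pos 0<t₀)))
    Π≥ : (t - ½ * t₀) * P ≤ ∣ Π ∣
    Π≥ = subst ((t - ½ * t₀) * P ≤_) (sym (∣p*q∣≡∣p∣*∣q∣ (t - μ zero) (product (λ i → t - μ (suc i)))))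
      (*-mono 0≤t-½t₀ (≤-trans (+-monoʳ-≤ t (neg-antimono-≤ μ₀≤)) (p≤∣p∣ (t - μ zero))) 0≤P (product≥ (λ i → t - μ (suc i)) g 0≤g gap))

  seq-diagonal : ∀ {n} (a : Fin n → ℝ) i k j → seq (R.diagonal a i k) j ≡ δ i k * seq (a i) j
  seq-diagonal a i k j with i Fin.≟ k
  ... | yes _ = sym (*-identityˡ (seq (a i) j))
  ... | no _ = sym (*-zeroˡ (seq (a i) j))

  at : ∀ {n} → R.Matrix n → ℕ → Mat n
  at w j u v = seq (w u v) j

  weightLaplacian : ∀ {n} → R.Matrix n → R.Matrix n
  weightLaplacian w = R.diagonal (λ u → R.sum (w u)) R.⊖ w

  at-laplacian : ∀ {n} (w : R.Matrix n) i k j → at (weightLaplacian w) j i k ≡ lap (at w j) i k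
  at-laplacian w i k j = cong (_- seq (w i k) j) (trans (seq-diagonal (λ u → R.sum (w u)) i k j) (cong (δ i k *_) (seq-sum (w i) j)))

  at-charpoly : ∀ {n} (w : R.Matrix n) t j →
    seq (R.det (R.diagonal (λ _ → R.fromℚ t) R.⊖ weightLaplacian w)) j ≡ detℚ (λ i k → δ i k * t - lap (at w j) i k)
  at-charpoly w t j = trans (seq-det (R.diagonal (λ _ → R.fromℚ t) R.⊖ weightLaplacian w) j) (det-cong (λ i k → cong₂ _-_ (seq-diagonal (λ _ → R.fromℚ t) i k j) (at-laplacian w i k j)))

  module _ {m} (w : R.Matrix (suc (suc m))) (w-sym : ∀ u v → w u v ≡ w v u)
    (w-nonNeg : Eventually (λ j → ∀ u v → 0ℚ ≤ seq (w u v) j))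
    (μ : Fin (suc (suc m)) → ℝ) (spectrum : IsSpectrum (weightLaplacian w) μ) where

    open IsSpectrum spectrum

    at-sym : ∀ j → Sym (at w j)
    at-sym j u v = cong (λ x → seq x j) (w-sym u v)

    charpoly-close : ∀ t ε → 0ℚ < ε → Eventually (λ j →
      ∣ detℚ (λ i k → δ i k * t - lap (at w j) i k) - product (λ i → t - seq (μ i) j) ∣ < ε)
    charpoly-close t ε ε>0 = ev-map (λ j → subst₂ (λ p q → ∣ p - q ∣ < ε) (at-charpoly w t j) (seq-product (λ i → R.fromℚ t R.- μ i) j))
      (eventually-close (charpoly (R.fromℚ t)) ε ε>0)

    -- The determinant vanishes at `t = 0` because the Laplacian kills constants, whereas a positive
    -- smallest eigenvalue would keep the product of all eigenvalues away from zero.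
    eventually-μ₁≤ : ∀ η → 0ℚ < η → Eventually (λ j → seq (μ zero) j ≤ η)
    eventually-μ₁≤ η η>0 = ev-map (λ j → subst (seq (μ zero) j ≤_) (+-identityˡ η)) (eventually-≤ {μ zero} {R.0ℝ} μ₁≤0 η η>0)
      where
      μ₁≤0 : μ zero R.≤ R.0ℝ
      μ₁≤0 (mk< g g>0 N h) = absurd (proj₂ both (proj₁ both) ℕ.≤-refl)
        where
        q = ½ * g
        q>0 = half-pos g>0
        both = (N , h) ⊓ᵉ ev-Fin (λ i → eventually-≤ (nondecreasing {zero} {i} z≤n) q q>0) ⊓ᵉ charpoly-close 0ℚ (q ^ suc (suc m)) (0<^ (suc (suc m)) q>0)
        absurd : ∀ {j} → ¬ ((0ℚ + g ≤ seq (μ zero) j) × (∀ i → seq (μ zero) j ≤ seq (μ i) j + q) × ∣ detℚ (λ i k → δ i k * 0ℚ - lap (at w j) i k) - product (λ i → 0ℚ - seq (μ i) j) ∣ < q ^ suc (suc m))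
        absurd {j} (g≤ , mono , close) = <-irrefl refl (<-≤-trans close (subst (q ^ suc (suc m) ≤_)
          (trans (sym (∣-p∣≡∣p∣ Π)) (cong ∣_∣ (trans (sym (+-identityˡ (- Π))) (cong (_- Π) (sym singular)))))
          (product≥ (λ i → 0ℚ - seq (μ i) j) q (<⇒≤ q>0) (λ i → ≤-trans (≤-by
            ((seq (μ i) j + q - seq (μ zero) j) + (seq (μ zero) j - (0ℚ + g)))
            (0≤+ (0≤Δ (mono i)) (0≤Δ g≤))
            (solve 3 (λ g i z → :- (con 0ℚ :- i) := con ½ :* g :+ ((i :+ con ½ :* g :- z) :+ (z :- (con 0ℚ :+ g)))) refl g (seq (μ i) j) (seq (μ zero) j)))
            (-p≤∣p∣ (0ℚ - seq (μ i) j))))))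
          where
          Π = product (λ i → 0ℚ - seq (μ i) j)
          singular : detℚ (λ i k → δ i k * 0ℚ - lap (at w j) i k) ≡ 0ℚ
          singular = det-singular _ (λ i k → cong₂ (λ d l → d * 0ℚ - l) (δ-sym i k) (lap-sym (at w j) (at-sym j) i k))
            (λ i → trans (∑-distrib-- (λ k → δ i k * 0ℚ) (lap (at w j) i)) (cong₂ _-_ (∑-zero (λ k → *-zeroʳ (δ i k))) (lap-row (at w j) i)))

    -- The lower bound descends from `L` to `L - a`, the upper one from `b + r - L` to `b - L`. The
    -- mesh points lie in (0, a] and in [b, b + r), so they stay at distance γ/2 from all
    -- eigenvalues but the first, and the determinants there are bounded below by `det≥`.
    rayleigh : ∀ a b γ → 0ℚ < a → 0ℚ < b → 0ℚ < γ →
      Eventually (λ j → a + γ ≤ seq (μ (suc zero)) j) → Eventually (λ j → seq (μ (fromℕ (suc m))) j + γ ≤ b) →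
      Eventually (λ j → ∀ x → sum x ≡ 0ℚ → a * normSq x ≤ quad (lap (at w j)) x × quad (lap (at w j)) x ≤ b * normSq x)
    rayleigh a b γ a>0 b>0 γ>0 μ₂≥ μₙ≤ = ev-map conclude
      (ev-Fin (λ u → ev-Fin (λ v → proj₂ (proj₂ (eventually-bounded (w u v)))))
        ⊓ᵉ w-nonNeg ⊓ᵉ ev-Fin (λ i → eventually-≤ (nondecreasing {suc zero} {suc i} (s≤s z≤n)) g g>0)
        ⊓ᵉ ev-Fin (λ i → eventually-≤ (nondecreasing {i} {fromℕ (suc m)} (Fin.≤fromℕ i)) g g>0)
        ⊓ᵉ μ₂≥ ⊓ᵉ μₙ≤ ⊓ᵉ eventually-μ₁≤ (½ * t₁) (half-pos t₁>0) ⊓ᵉ eventually-μ₁≤ (½ * b) (half-pos b>0)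
        ⊓ᵉ ev-< J₁ (λ k → charpoly-close (ι (suc k) * t₁) (½ * ½ * (t₁ * G)) (half-half-pos t₁>0))
        ⊓ᵉ ev-< J₂ (λ k → charpoly-close (b + r - ι (suc k) * t₂) (½ * ½ * (b * G)) (half-half-pos b>0)))
      where
      n = ι (suc (suc m))
      g = ½ * γ
      g>0 = half-pos γ>0
      G = g ^ suc m
      G>0 = 0<^ (suc m) g>0
      c = ½ * ½ * G
      c>0 : 0ℚ < c
      c>0 = subst (0ℚ <_) (sym (*-assoc ½ ½ G)) (half-pos (half-pos G>0))
      half-half-pos : ∀ {t} → 0ℚ < t → 0ℚ < ½ * ½ * (t * G)
      half-half-pos {t} t>0 = subst (0ℚ <_) (sym (*-assoc ½ ½ (t * G))) (half-pos (half-pos (0<* t>0 G>0)))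
      bound : Fin (suc (suc m)) → Fin (suc (suc m)) → ℚ
      bound u v = proj₁ (eventually-bounded (w u v))
      0≤bound : ∀ u v → 0ℚ ≤ bound u v
      0≤bound u v = <⇒≤ (proj₁ (proj₂ (eventually-bounded (w u v))))
      -- A bound valid at all late indices. With it `r` and both meshes are fixed before an index is
      -- chosen, so only finitely many determinants have to be near their limits at that index.
      r₀ = 1ℚ + sum (λ u → sum (bound u))
      r₀>0 : 0ℚ < r₀
      r₀>0 = +-mono-<-≤ {0ℚ} {1ℚ} {0ℚ} 0<1 (0≤∑ (λ u → 0≤∑ (0≤bound u)))
      r = n * r₀ + n * r₀
      r>0 : 0ℚ < r
      r>0 = +-mono-< (0<* (0<ι-suc (suc m)) r₀>0) (0<* (0<ι-suc (suc m)) r₀>0)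
      -- An upper bound for the smallness condition of `descend`, after division by the mesh width
      -- t; the last summand `T` comes from t² ≤ T t. Being linear in t, it can be handed to `mesh`.
      cost : ℚ → ℚ → ℚ
      cost R T = n * n * (R + T + n + T) * ((R + T + n) ^ suc m * (R + T + n) ^ suc m)
      0≤cost : ∀ {R T} → 0ℚ ≤ R → 0ℚ ≤ T → 0ℚ ≤ cost R T
      0≤cost 0≤R 0≤T = 0≤* (0≤* (0≤* 0≤n 0≤n) (0≤+ (0≤+ (0≤+ 0≤R 0≤T) 0≤n) 0≤T)) (0≤* 0≤P 0≤P)
        where
        0≤n = 0≤ι (suc (suc m))
        0≤P = 0≤^ (suc m) (0≤+ (0≤+ 0≤R 0≤T) 0≤n)
      mesh₁ = mesh a (cost r a) (c * c) a>0 (0≤cost (<⇒≤ r>0) (<⇒≤ a>0)) (0<-square c>0)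
      J₁ = proj₁ mesh₁
      t₁ = proj₁ (proj₂ mesh₁)
      t₁>0 = proj₁ (proj₂ (proj₂ (proj₂ mesh₁)))
      R₂ = r + (b + r)
      0≤R₂ : 0ℚ ≤ R₂
      0≤R₂ = 0≤+ (<⇒≤ r>0) (0≤+ (<⇒≤ b>0) (<⇒≤ r>0))
      mesh₂ = mesh r (cost R₂ r) (c * c) r>0 (0≤cost 0≤R₂ (<⇒≤ r>0)) (0<-square c>0)
      J₂ = proj₁ mesh₂
      t₂ = proj₁ (proj₂ mesh₂)
      t₂>0 = proj₁ (proj₂ (proj₂ (proj₂ mesh₂)))
      small : ∀ R T → 0ℚ ≤ R → 0ℚ ≤ T → ∀ J t → ι J * t ≡ T → 0ℚ < t → t ≤ T → cost R T * t < c * c →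
        n * n * ((R + ι J * t + n) * t + t * t) * ((R + ι J * t + n) ^ suc m * (R + ι J * t + n) ^ suc m) < c * c
      small R T 0≤R 0≤T J t Jt≡T 0<t t≤T h rewrite Jt≡T = ≤-<-trans (≤-by
        (n * n * (t * (T - t)) * (P * P))
        (0≤* (0≤* (0≤* (0≤ι (suc (suc m))) (0≤ι (suc (suc m)))) (0≤* (<⇒≤ 0<t) (0≤Δ t≤T))) (0≤-square P))
        (solve 5 (λ n q T t p → n :* n :* (q :+ T) :* p :* t := n :* n :* (q :* t :+ t :* t) :* p :+ n :* n :* (t :* (T :- t)) :* p) refl n (R + T + n) T t (P * P))) h
        where P = (R + T + n) ^ suc m
      conclude : ∀ j → _ → ∀ x → sum x ≡ 0ℚ → a * normSq x ≤ quad (lap (at w j)) x × quad (lap (at w j)) x ≤ b * normSq x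
      conclude j (bounded , 0≤w , μ₂≤ , ≤μₙ , a≤ , ≤b , μ₁≤₁ , μ₁≤₂ , close₁ , close₂) x x⊥1 = lower , upper
        where
        L = lap (at w j)
        L-sym = lap-sym (at w j) (at-sym j)
        L-row = lap-row (at w j)
        L-norm : ∀ i → sum (λ k → ∣ L i k ∣) ≤ r
        L-norm = lap-norm (at w j) r₀ (λ u v → ≤-trans (bounded u v) (≤-trans (term≤∑ (0≤bound u) v)
          (≤-trans (term≤∑ {f = λ u → sum (bound u)} (λ u → 0≤∑ (0≤bound u)) u) (≤-by 1ℚ 0≤1 (+-comm 1ℚ (sum (λ u → sum (bound u))))))))
        ν : Fin (suc (suc m)) → ℚ
        ν i = seq (μ i) j
        gap₁ : ∀ t → t ≤ a → ∀ i → g ≤ ∣ t - ν (suc i) ∣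
        gap₁ t t≤a i = ≤-trans (≤-by ((ν (suc i) + g - ν (suc zero)) + (ν (suc zero) - (a + γ)) + (a - t))
          (0≤+ (0≤+ (0≤Δ (μ₂≤ i)) (0≤Δ a≤)) (0≤Δ t≤a))
          (solve 5 (λ t i z a γ → :- (t :- i) := con ½ :* γ :+ ((i :+ con ½ :* γ :- z) :+ (z :- (a :+ γ)) :+ (a :- t))) refl t (ν (suc i)) (ν (suc zero)) a γ))
          (-p≤∣p∣ (t - ν (suc i)))
        gap₂ : ∀ t → b ≤ t → ∀ i → g ≤ ∣ t - ν (suc i) ∣
        gap₂ t b≤t i = ≤-trans (≤-by ((ν (fromℕ (suc m)) + g - ν (suc i)) + (b - (ν (fromℕ (suc m)) + γ)) + (t - b))
          (0≤+ (0≤+ (0≤Δ (≤μₙ (suc i))) (0≤Δ ≤b)) (0≤Δ b≤t))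
          (solve 5 (λ t i z b γ → t :- i := con ½ :* γ :+ ((z :+ con ½ :* γ :- i) :+ (b :- (z :+ γ)) :+ (t :- b))) refl t (ν (suc i)) (ν (fromℕ (suc m))) b γ))
          (p≤∣p∣ (t - ν (suc i)))
        lower : a * normSq x ≤ quad L x
        lower = subst (λ z → z * normSq x ≤ quad L x) Jt≡a (descend L (- 1ℚ) 0ℚ r c t₁ J₁ L-sym L-row refl L-norm t₁>0 (<⇒≤ c>0)
          (small r a (<⇒≤ r>0) (<⇒≤ a>0) J₁ t₁ Jt≡a t₁>0 (proj₁ (proj₂ (proj₂ (proj₂ (proj₂ mesh₁))))) (proj₂ (proj₂ (proj₂ (proj₂ (proj₂ mesh₁))))))
          dets (λ y _ → lap-psd (at w j) (at-sym j) 0≤w y) x x⊥1)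
          where
          Jt≡a = proj₁ (proj₂ (proj₂ mesh₁))
          dets : ∀ k → k ℕ.< J₁ → 0ℚ < - 1ℚ * (0ℚ - ι (suc k) * t₁) ×
            - 1ℚ * (0ℚ - ι (suc k) * t₁) * c ≤ ∣ detℚ (λ i l → - 1ℚ * shift L (ι (suc k) * t₁) i l) ∣
          dets k k<J = subst₂ (λ τ D → 0ℚ < τ × τ * c ≤ ∣ D ∣)
            (solve 1 (λ t → t := con (- 1ℚ) :* (con 0ℚ :- t)) refl t)
            (det-cong (λ i l → solve 3 (λ d t l → d :* t :- l := con (- 1ℚ) :* (l :- t :* d)) refl (δ i l) t (L i l)))
            (0<* (0<ι-suc k) t₁>0 , det≥ t t₁ g _ ν (detℚ (λ i l → δ i l * t - L i l)) t₁>0 t₁≤t (<⇒≤ g>0) μ₁≤₁ (gap₁ t t≤a) (close₁ k k<J) ≤-refl)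
            where
            t = ι (suc k) * t₁
            t₁≤t : t₁ ≤ t
            t₁≤t = ≤-by (ι k * t₁) (0≤* (0≤ι k) (<⇒≤ t₁>0)) (trans (cong (_* t₁) (ι-suc k)) (solve 2 (λ k t → (con 1ℚ :+ k) :* t := t :+ k :* t) refl (ι k) t₁))
            t≤a : t ≤ a
            t≤a = subst (t ≤_) Jt≡a (*-monoʳ t₁ (<⇒≤ t₁>0) (ι-mono k<J))
        upper : quad L x ≤ b * normSq x
        upper = ≤-by (quad M x - r * normSq x) (0≤Δ (subst (λ z → z * normSq x ≤ quad M x) Jt≡r
            (descend M 1ℚ (b + r) R₂ c t₂ J₂ M-sym M-row refl M-norm t₂>0 (<⇒≤ c>0)
              (small R₂ r 0≤R₂ (<⇒≤ r>0) J₂ t₂ Jt≡r t₂>0 (proj₁ (proj₂ (proj₂ (proj₂ (proj₂ mesh₂))))) (proj₂ (proj₂ (proj₂ (proj₂ (proj₂ mesh₂))))))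
              dets M-psd x x⊥1)))
          (trans (solve 4 (λ b r n q → b :* n := q :+ (((b :+ r) :* n :- q) :- r :* n)) refl b r (normSq x) (quad L x))
            (cong (λ z → quad L x + (z - r * normSq x)) (sym (quad-M x))))
          where
          Jt≡r = proj₁ (proj₂ (proj₂ mesh₂))
          -- `M` below is `b + r - L`, semidefinite at the start of the descent because `r` bounds
          -- the absolute row sums of `L`.
          N : Mat (suc (suc m))
          N i k = - 1ℚ * L i k
          M : Mat (suc (suc m))
          M = shift N (- (b + r))
          N-sym : Sym N
          N-sym i k = cong (- 1ℚ *_) (L-sym i k)
          M-sym : Sym M
          M-sym = shift-sym N (- (b + r)) N-sym
          N-row : ∀ i → sum (N i) ≡ 0ℚ
          N-row i = trans (sym (*-distribˡ-sum (- 1ℚ) (L i))) (cong (- 1ℚ *_) (L-row i))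
          M-row : ∀ i → sum (M i) ≡ b + r
          M-row i = trans (shift-row N (- (b + r)) 0ℚ N-row i) (solve 1 (λ t → con 0ℚ :- (:- t) := t) refl (b + r))
          M-norm : ∀ i → sum (λ k → ∣ M i k ∣) ≤ R₂
          M-norm i = ≤-trans (≤-reflexive (sum-cong-≗ (λ k → trans (sym (∣-p∣≡∣p∣ (M i k))) (cong ∣_∣ (solve 3 (λ l t d → :- (con (- 1ℚ) :* l :- (:- t) :* d) := l :- t :* d) refl (L i k) (b + r) (δ i k))))))
            (shift-norm L (b + r) r (0≤+ (<⇒≤ b>0) (<⇒≤ r>0)) L-norm i)
          quad-M : ∀ y → quad M y ≡ (b + r) * normSq y - quad L y
          quad-M y = trans (quad-shift N (- (b + r)) y) (trans (cong (_- - (b + r) * normSq y) (trans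
            (sum-cong-≗ (λ i → trans (cong (y i *_) (trans (sum-cong-≗ (λ k → *-assoc (- 1ℚ) (L i k) (y k))) (sym (*-distribˡ-sum (- 1ℚ) (λ k → L i k * y k)))))
              (solve 2 (λ y l → y :* (con (- 1ℚ) :* l) := con (- 1ℚ) :* (y :* l)) refl (y i) ((L ⊛ y) i))))
            (sym (*-distribˡ-sum (- 1ℚ) (λ i → y i * (L ⊛ y) i)))))
            (solve 3 (λ q t n → con (- 1ℚ) :* q :- (:- t) :* n := t :* n :- q) refl (quad L y) (b + r) (normSq y)))
          M-psd : PSD⊥ M
          M-psd y _ = subst (0ℚ ≤_) (trans (solve 4 (λ b r n q → b :* n :+ (r :* n :- q) := (b :+ r) :* n :- q) refl b r (normSq y) (quad L y)) (sym (quad-M y)))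
            (0≤+ (0≤* (<⇒≤ b>0) (0≤normSq y)) (0≤Δ (quad≤ L L-sym r L-norm y)))
          dets : ∀ k → k ℕ.< J₂ → 0ℚ < 1ℚ * (b + r - ι (suc k) * t₂) ×
            1ℚ * (b + r - ι (suc k) * t₂) * c ≤ ∣ detℚ (λ i l → 1ℚ * shift M (ι (suc k) * t₂) i l) ∣
          dets k k<J = subst₂ (λ τ D → 0ℚ < τ × τ * c ≤ ∣ D ∣) (sym (*-identityˡ t))
            (det-cong (λ i l → solve 4 (λ d t k l → d :* (t :- k) :- l := con 1ℚ :* (con (- 1ℚ) :* l :- (:- t) :* d :- k :* d)) refl (δ i l) (b + r) (ι (suc k) * t₂) (L i l)))
            (<-≤-trans b>0 b≤t , det≥ t b g _ ν (detℚ (λ i l → δ i l * t - L i l)) b>0 b≤t (<⇒≤ g>0) μ₁≤₂ (gap₂ t b≤t) (close₂ k k<J) ≤-refl)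
            where
            t = b + r - ι (suc k) * t₂
            b≤t : b ≤ t
            b≤t = ≤-by (r - ι (suc k) * t₂) (0≤Δ (subst (ι (suc k) * t₂ ≤_) Jt≡r (*-monoʳ t₂ (<⇒≤ t₂>0) (ι-mono k<J))))
              (solve 3 (λ b r k → b :+ r :- k := b :+ (r :- k)) refl b r (ι (suc k) * t₂))

-- Two distinct paths with common ends yield a short cycle.

module SimplePaths where

  open R using (WeightedGraph; HasCycle)

  end : ∀ {A : Set} → A → List A → A
  end v [] = v
  end v (u ∷ us) = end u us

  end∈ : ∀ {A : Set} (v : A) us → end v us ∈ v ∷ us
  end∈ v [] = here refl
  end∈ v (u ∷ us) = there (end∈ u us)

  module _ {n} (G : WeightedGraph n) where
    open WeightedGraph G

    -- The list holds the vertices after the first, so a path is lengthened at its start, and its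
    -- last vertex is given by `end`.
    data Path : Fin n → List (Fin n) → Set where
      stop : ∀ {v} → Path v []
      step : ∀ {u v vs} → u ∼ v → u ∉ v ∷ vs → Path v vs → Path u (v ∷ vs)

    -- An injective walk in the indexed form that `IsCycle` asks for. The field `inside` confines it
    -- to `vs`, so that a vertex outside `vs` can be put in front.
    record Segment (a b : Fin n) (vs : List (Fin n)) (k : ℕ) : Set where
      field
        vertex    : Fin (suc k) → Fin n
        start     : vertex zero ≡ a
        finish    : vertex (fromℕ k) ≡ b
        adjacent  : ∀ i → vertex (inject₁ i) ∼ vertex (suc i)
        injective : Injective _≡_ _≡_ vertex
        inside    : ∀ i → vertex i ∈ vs

    open Segment

    singleton : ∀ {a vs} → Segment a a (a ∷ vs) 0
    singleton {a} = record { vertex = λ _ → a ; start = refl ; finish = refl ; adjacent = λ ()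
                           ; injective = λ { {zero} {zero} _ → refl } ; inside = λ _ → here refl }

    extend : ∀ {a a′ b vs k} → a ∼ a′ → a ∉ vs → Segment a′ b vs k → Segment a b (a ∷ vs) (suc k)
    extend {a} {a′} {b} {vs} {k} a∼a′ a∉vs s = record
      { vertex = c ; start = refl ; finish = finish s ; adjacent = adj ; injective = inj
      ; inside = λ { zero → here refl ; (suc i) → there (inside s i) } }
      where
      c : Fin (suc (suc k)) → Fin n
      c zero = a
      c (suc i) = vertex s i
      adj : ∀ i → c (inject₁ i) ∼ c (suc i)
      adj zero = subst (a ∼_) (sym (start s)) a∼a′
      adj (suc i) = adjacent s i
      inj : Injective _≡_ _≡_ c
      inj {zero} {zero} _ = refl
      inj {zero} {suc j} eq = contradiction (subst (_∈ vs) (sym eq) (inside s j)) a∉vs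
      inj {suc i} {zero} eq = contradiction (subst (_∈ vs) eq (inside s i)) a∉vs
      inj {suc i} {suc j} eq = cong suc (injective s eq)

    segment : ∀ {a vs b} → Path a vs → b ∈ a ∷ vs → ∃[ k ] k ℕ.≤ length vs × Segment a b (a ∷ vs) k
    segment p (here refl) = 0 , z≤n , singleton
    segment (step e fresh p) (there b∈) with segment p b∈
    ... | k , k≤ , s = suc k , s≤s k≤ , extend e fresh s

    CycleWithin : ℕ → Set
    CycleWithin l = ∃[ k ] k ℕ.≤ l × HasCycle G k

    -- `b` comes after the second vertex, so the part of the path from `a` to `b` has at least three
    -- vertices and the edge back to `a` closes it to a cycle.
    chord : ∀ {a a′ vs b} → Path a (a′ ∷ vs) → b ∈ vs → b ∼ a → CycleWithin (2 ℕ.+ length vs)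
    chord {b = b} (step e fresh (step e′ fresh′ p)) b∈ b∼a with segment p b∈
    ... | k , k≤ , s = 3 ℕ.+ k , s≤s (s≤s (s≤s k≤)) , vertex t , record
      { length≥3 = s≤s (s≤s (s≤s z≤n)) ; distinct = injective t ; step = adjacent t
      ; closing = subst (_∼ _) (sym (finish t)) b∼a }
      where t = extend e fresh (extend e′ fresh′ s)

    -- The path a ∷ a′ ∷ vs is prolonged along the second path until the latter runs into it.
    meet : ∀ {a a′ vs q qs} → Path a (a′ ∷ vs) → Path q qs → q ∼ a → q ≢ a′ → a ∉ q ∷ qs → end q qs ∈ a ∷ a′ ∷ vs →
      CycleWithin (2 ℕ.+ length vs ℕ.+ length qs)
    meet {a} {a′} {vs} {q} {qs} p p′ q∼a q≢a′ a∉ r∈ with any? (q Fin.≟_) vs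
    ... | yes q∈vs with chord p q∈vs q∼a
    ...   | k , k≤ , c = k , ℕ.≤-trans k≤ (ℕ.m≤m+n _ (length qs)) , c
    meet {a} {a′} {vs} {q} {[]} p stop q∼a q≢a′ a∉ r∈ | no q∉vs = ⊥-elim (outside r∈)
      where
      outside : q ∉ a ∷ a′ ∷ vs
      outside (here q≡a) = ∼-irrefl q≡a q∼a
      outside (there (here q≡a′)) = q≢a′ q≡a′
      outside (there (there q∈vs)) = q∉vs q∈vs
    meet {a} {a′} {vs} {q} {q′ ∷ qs} p (step e fresh p′) q∼a q≢a′ a∉ r∈ | no q∉vs
      with meet (step q∼a outside p) p′ (∼-sym e) (λ eq → a∉ (there (here (sym eq)))) fresh (there r∈)
      where
      outside : q ∉ a ∷ a′ ∷ vs
      outside (here q≡a) = ∼-irrefl q≡a q∼a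
      outside (there (here q≡a′)) = q≢a′ q≡a′
      outside (there (there q∈vs)) = q∉vs q∈vs
    ... | k , k≤ , c = k , subst (k ℕ.≤_) (cong (2 ℕ.+_) (sym (ℕ.+-suc (length vs) (length qs)))) k≤ , c

    -- Once the common beginning is stripped, the paths leave `v` towards different neighbours. The
    -- second one must run into the first, at the latest at their common end, and `meet` finds the
    -- cycle.
    two-paths : ∀ {v ps qs} → Path v ps → Path v qs → end v ps ≡ end v qs → ps ≡ qs ⊎ CycleWithin (length ps ℕ.+ length qs)
    two-paths stop stop _ = inj₁ refl
    two-paths stop (step {vs = vs} _ fresh _) eq = contradiction (subst (_∈ _) (sym eq) (end∈ _ vs)) fresh
    two-paths (step {vs = vs} _ fresh _) stop eq = contradiction (subst (_∈ _) eq (end∈ _ vs)) fresh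
    two-paths (step {v = x} {ps} e fresh p) (step {v = y} {qs} e′ fresh′ q) eq with x Fin.≟ y
    ... | yes refl with two-paths p q eq
    ...   | inj₁ refl = inj₁ refl
    ...   | inj₂ (k , k≤ , c) = inj₂ (k , ℕ.≤-trans k≤ (ℕ.+-mono-≤ (ℕ.n≤1+n _) (ℕ.n≤1+n _)) , c)
    two-paths (step {v = x} {ps} e fresh p) (step {v = y} {qs} e′ fresh′ q) eq | no x≢y
      with meet (step e fresh p) q (∼-sym e′) (x≢y ∘ sym) fresh′ (there (subst (_∈ x ∷ ps) eq (end∈ x ps)))
    ... | k , k≤ , c = inj₂ (k , subst (k ℕ.≤_) (cong suc (sym (ℕ.+-suc (length ps) (length qs)))) k≤ , c)

-- Sums over vertex lists of fixed length, and indicators of simplicity.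

module ListSums where

  open Rationals
  open Descent using (0≤δ)

  -- The range is all lists of length `ℓ`, and lists that are not simple paths will have weight
  -- zero. This spares an enumeration of the paths and makes exchanging sums easy.
  sumW : ∀ {n} → ℕ → (List (Fin n) → ℚ) → ℚ
  sumW zero F = F []
  sumW (suc ℓ) F = sum λ v → sumW ℓ (F ∘ (v ∷_))

  sumW-cong : ∀ {n} ℓ {F H : List (Fin n) → ℚ} → (∀ vs → length vs ≡ ℓ → F vs ≡ H vs) → sumW ℓ F ≡ sumW ℓ H
  sumW-cong zero h = h [] refl
  sumW-cong (suc ℓ) h = sum-cong-≗ λ v → sumW-cong ℓ λ vs eq → h (v ∷ vs) (cong suc eq)

  sumW-mono : ∀ {n} ℓ {F H : List (Fin n) → ℚ} → (∀ vs → length vs ≡ ℓ → F vs ≤ H vs) → sumW ℓ F ≤ sumW ℓ H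
  sumW-mono zero h = h [] refl
  sumW-mono (suc ℓ) h = ∑-mono λ v → sumW-mono ℓ λ vs eq → h (v ∷ vs) (cong suc eq)

  0≤sumW : ∀ {n} ℓ {F : List (Fin n) → ℚ} → (∀ vs → 0ℚ ≤ F vs) → 0ℚ ≤ sumW ℓ F
  0≤sumW zero h = h []
  0≤sumW (suc ℓ) h = 0≤∑ λ v → 0≤sumW ℓ λ vs → h (v ∷ vs)

  *-distribˡ-sumW : ∀ {n} ℓ c (F : List (Fin n) → ℚ) → c * sumW ℓ F ≡ sumW ℓ (λ vs → c * F vs)
  *-distribˡ-sumW zero c F = refl
  *-distribˡ-sumW (suc ℓ) c F = trans (*-distribˡ-sum c (λ v → sumW ℓ (F ∘ (v ∷_)))) (sum-cong-≗ λ v → *-distribˡ-sumW ℓ c (F ∘ (v ∷_)))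

  ∑-sumW-comm : ∀ {m n} ℓ (F : Fin m → List (Fin n) → ℚ) → sum (λ i → sumW ℓ (F i)) ≡ sumW ℓ (λ vs → sum λ i → F i vs)
  ∑-sumW-comm zero F = refl
  ∑-sumW-comm (suc ℓ) F = trans (∑-comm (λ i v → sumW ℓ (F i ∘ (v ∷_)))) (sum-cong-≗ λ v → ∑-sumW-comm ℓ (λ i → F i ∘ (v ∷_)))

  term≤sumW : ∀ {n} {F : List (Fin n) → ℚ} → (∀ vs → 0ℚ ≤ F vs) → ∀ vs → F vs ≤ sumW (length vs) F
  term≤sumW h [] = ≤-refl
  term≤sumW {F = F} h (v ∷ vs) = ≤-trans (term≤sumW (λ us → h (v ∷ us)) vs)
    (term≤∑ {f = λ u → sumW (length vs) (F ∘ (u ∷_))} (λ u → 0≤sumW (length vs) λ us → h (u ∷ us)) v)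

  sumW-zero : ∀ {n} ℓ {F : List (Fin n) → ℚ} → (∀ vs → length vs ≡ ℓ → F vs ≡ 0ℚ) → sumW ℓ F ≡ 0ℚ
  sumW-zero zero h = h [] refl
  sumW-zero (suc ℓ) h = ∑-zero λ v → sumW-zero ℓ λ vs eq → h (v ∷ vs) (cong suc eq)

  sumW-orthogonal : ∀ {n} k ℓ {F H : List (Fin n) → ℚ} →
    (∀ us vs → length us ≡ k → length vs ≡ ℓ → F us * H vs ≡ 0ℚ) → sumW k F * sumW ℓ H ≡ 0ℚ
  sumW-orthogonal k ℓ {F} {H} h = begin
    sumW k F * sumW ℓ H  ≡⟨ trans (*-comm (sumW k F) (sumW ℓ H)) (*-distribˡ-sumW k (sumW ℓ H) F) ⟩
    sumW k (λ us → sumW ℓ H * F us)  ≡⟨ sumW-zero k (λ us eq → trans (*-comm (sumW ℓ H) (F us)) (trans (*-distribˡ-sumW ℓ (F us) H)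
                                (sumW-zero ℓ λ vs eq′ → h us vs eq eq′))) ⟩
    0ℚ  ∎
    where open ≡-Reasoning

  -- The vanishing of all mixed products says that at most one term is nonzero; this is the form in
  -- which uniqueness of paths enters the norms.
  ∑-square : ∀ {n} (f : Fin n → ℚ) → (∀ i j → i ≢ j → f i * f j ≡ 0ℚ) → sum f * sum f ≡ sum (λ i → f i * f i)
  ∑-square f h = trans (*-distribʳ-sum (sum f) f) (sum-cong-≗ λ i →
    trans (*-distribˡ-sum (f i) f) (∑-single i λ j j≢i → h i j (j≢i ∘ sym)))

  sumW-square : ∀ {n} ℓ (F : List (Fin n) → ℚ) →
    (∀ us vs → length us ≡ ℓ → length vs ≡ ℓ → us ≢ vs → F us * F vs ≡ 0ℚ) → sumW ℓ F * sumW ℓ F ≡ sumW ℓ (λ vs → F vs * F vs)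
  sumW-square zero F h = refl
  sumW-square (suc ℓ) F h = trans
    (∑-square (λ v → sumW ℓ (F ∘ (v ∷_))) λ u v u≢v → sumW-orthogonal ℓ ℓ λ us vs eq eq′ →
      h (u ∷ us) (v ∷ vs) (cong suc eq) (cong suc eq′) (u≢v ∘ ∷-injectiveˡ))
    (sum-cong-≗ λ v → sumW-square ℓ (F ∘ (v ∷_)) λ us vs eq eq′ us≢vs →
      h (v ∷ us) (v ∷ vs) (cong suc eq) (cong suc eq′) (us≢vs ∘ ∷-injectiveʳ))

  sumW-snoc : ∀ {n} ℓ (F : List (Fin n) → ℚ) → sumW (suc ℓ) F ≡ sumW ℓ (λ vs → sum λ z → F (vs ∷ʳ z))
  sumW-snoc zero F = refl
  sumW-snoc (suc ℓ) F = sum-cong-≗ λ v → sumW-snoc ℓ (F ∘ (v ∷_))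

  ne : ∀ {n} → Fin n → Fin n → ℚ
  ne u v = 1ℚ - δ u v

  0≤ne : ∀ {n} (u v : Fin n) → 0ℚ ≤ ne u v
  0≤ne u v with u Fin.≟ v
  ... | yes _ = ≤-refl
  ... | no _ = 0≤1

  ne-cases : ∀ {n} (u v : Fin n) → ne u v * ne u v ≡ ne u v
  ne-cases u v with u Fin.≟ v
  ... | yes _ = refl
  ... | no _ = refl

  -- The indicator of `u ∉ vs`, as a rational number so that it can take part in ring identities.
  out : ∀ {n} → Fin n → List (Fin n) → ℚ
  out u [] = 1ℚ
  out u (v ∷ vs) = ne u v * out u vs

  0≤out : ∀ {n} (u : Fin n) vs → 0ℚ ≤ out u vs
  0≤out u [] = 0≤1
  0≤out u (v ∷ vs) = 0≤* (0≤ne u v) (0≤out u vs)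

  out² : ∀ {n} (u : Fin n) vs → out u vs * out u vs ≡ out u vs
  out² u [] = refl
  out² u (v ∷ vs) = trans (solve 2 (λ a b → a :* b :* (a :* b) := a :* a :* (b :* b)) refl (ne u v) (out u vs)) (cong₂ _*_ (ne-cases u v) (out² u vs))

  out≤1 : ∀ {n} (u : Fin n) vs → out u vs ≤ 1ℚ
  out≤1 u vs = square-≤⁻¹ 0≤1 (≤-by (1ℚ - out u vs) (helper vs) (trans (solve 1 (λ o → con 1ℚ :* con 1ℚ := o :+ (con 1ℚ :- o)) refl (out u vs)) (cong (_+ (1ℚ - out u vs)) (sym (out² u vs)))))
    where
    helper : ∀ vs → 0ℚ ≤ 1ℚ - out u vs
    helper [] = ≤-refl
    helper (v ∷ vs) with u Fin.≟ v
    ... | yes _ = subst (0ℚ ≤_) (solve 1 (λ o → con 1ℚ := con 1ℚ :- (con 1ℚ :- con 1ℚ) :* o) refl (out u vs)) 0≤1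
    ... | no _ = subst (0ℚ ≤_) (solve 1 (λ o → con 1ℚ :- o := con 1ℚ :- (con 1ℚ :- con 0ℚ) :* o) refl (out u vs)) (helper vs)

  out≢0⇒∉ : ∀ {n} (u : Fin n) vs → out u vs ≢ 0ℚ → u ∉ vs
  out≢0⇒∉ u (v ∷ vs) h (here refl) = h (trans (cong (λ d → (1ℚ - d) * out u vs) (δ-refl u)) (*-zeroˡ (out u vs)))
  out≢0⇒∉ u (v ∷ vs) h (there u∈) = out≢0⇒∉ u vs (λ eq → h (trans (cong (ne u v *_) eq) (*-zeroʳ (ne u v)))) u∈

  out-∷ʳ : ∀ {n} (u : Fin n) vs z → out u (vs ∷ʳ z) ≡ out u vs * ne z u
  out-∷ʳ u [] z = trans (*-identityʳ (ne u z)) (trans (cong (λ d → 1ℚ - d) (δ-sym u z)) (sym (*-identityˡ (ne z u))))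
  out-∷ʳ u (v ∷ vs) z = trans (cong (ne u v *_) (out-∷ʳ u vs z)) (sym (*-assoc (ne u v) (out u vs) (ne z u)))

  -- Each entry of `vs` removes at most one term of the sum, of size at most `q`; repeated entries
  -- remove nothing new.
  ∑-out≥ : ∀ {n} (f : Fin n → ℚ) q → (∀ z → 0ℚ ≤ f z) → (∀ z → f z ≤ q) → ∀ vs → sum f - ι (length vs) * q ≤ sum (λ z → f z * out z vs)
  ∑-out≥ f q 0≤f f≤q [] = ≤-reflexive (trans (trans (cong (λ z → sum f - z * q) (ι-def 0)) (solve 2 (λ s q → s :- con 0ℚ :* q := s) refl (sum f) q))
    (sum-cong-≗ λ z → sym (*-identityʳ (f z))))
  ∑-out≥ f q 0≤f f≤q (v ∷ vs) = begin
    sum f - ι (suc (length vs)) * q  ≡⟨ cong (λ z → sum f - z * q) (ι-suc (length vs)) ⟩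
    sum f - (1ℚ + ι (length vs)) * q  ≡⟨ solve 3 (λ s l q → s :- (con 1ℚ :+ l) :* q := (s :- l :* q) :- q) refl (sum f) (ι (length vs)) q ⟩
    sum f - ι (length vs) * q - q  ≤⟨ +-mono-≤ (∑-out≥ f q 0≤f f≤q vs) (neg-antimono-≤ (f≤q v)) ⟩
    sum (λ z → f z * out z vs) - f v  ≡⟨ cong (λ t → sum (λ z → f z * out z vs) - t) (sym (∑-δ f v)) ⟩
    sum (λ z → f z * out z vs) - sum (λ z → δ v z * f z)        ≡⟨ sym (∑-distrib-- (λ z → f z * out z vs) (λ z → δ v z * f z)) ⟩
    sum (λ z → f z * out z vs - δ v z * f z)  ≤⟨ ∑-mono (λ z → ≤-by (δ v z * f z * (1ℚ - out z vs))
                                (0≤* (0≤* (0≤δ v z) (0≤f z)) (0≤Δ (out≤1 z vs)))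
                                (trans (cong (λ d → f z * ((1ℚ - d) * out z vs)) (δ-sym z v))
                                (solve 3 (λ f o d → f :* ((con 1ℚ :- d) :* o) := (f :* o :- d :* f) :+ d :* f :* (con 1ℚ :- o)) refl (f z) (out z vs) (δ v z)))) ⟩
    sum (λ z → f z * (ne z v * out z vs))  ∎
    where
    open ≤-Reasoning

-- The Rayleigh quotient test for vectors built from disjoint levels.

module LevelTest where

  open Rationals
  open Determinants using (Mat)
  open QuadraticForms
  open RayleighBounds using (lap; lap-sym; lap-row; lap-⊛)

  range : ℕ → (ℕ → ℚ) → ℚ
  range zero f = 0ℚ
  range (suc k) f = range k f + f k

  range-mono : ∀ k {f h : ℕ → ℚ} → (∀ ℓ → ℓ ℕ.< k → f ℓ ≤ h ℓ) → range k f ≤ range k h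
  range-mono zero h = ≤-refl
  range-mono (suc k) h = +-mono-≤ (range-mono k (λ ℓ ℓ<k → h ℓ (ℕ.m<n⇒m<1+n ℓ<k))) (h k ℕ.≤-refl)

  range-const : ∀ k c → range k (λ _ → c) ≡ ι k * c
  range-const zero c = sym (trans (cong (_* c) (ι-def 0)) (*-zeroˡ c))
  range-const (suc k) c = trans (cong (_+ c) (range-const k c))
    (trans (solve 2 (λ k c → k :* c :+ c := (con 1ℚ :+ k) :* c) refl (ι k) c) (cong (_* c) (sym (ι-suc k))))

  ∑-range : ∀ {n} k (f : Fin n → ℕ → ℚ) → sum (λ i → range k (f i)) ≡ range k (λ ℓ → sum λ i → f i ℓ)
  ∑-range {n} zero f = ∑-zero {n} (λ _ → refl)
  ∑-range (suc k) f = trans (∑-distrib-+ (λ i → range k (f i)) (λ i → f i k)) (cong (_+ sum (λ i → f i k)) (∑-range k f))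

  4ℚ : ℚ
  4ℚ = ℤ.+ 4 / 1

  module _ {m} (W : Mat (suc m)) (W-sym : Sym W) (0≤W : ∀ u v → 0ℚ ≤ W u v) (b : ℚ) (0≤b : 0ℚ ≤ b)
    (rayleigh : ∀ x → sum x ≡ 0ℚ → normSq x ≤ quad (lap W) x × quad (lap W) x ≤ b * normSq x) where

    private
      n = ι (suc m)
      0<n = 0<ι-suc m
      L = lap W

    -- The Rayleigh bounds at n x - (sum x) 1, the projection to 1^⊥ scaled by `n` to avoid a
    -- division; the Laplacian does not see the constant part.
    centred : ∀ (x : Vect (suc m)) → n * normSq x - sum x * sum x ≤ n * quad L x × n * quad L x ≤ b * (n * normSq x - sum x * sum x)
    centred x = *-cancelˡ-≤ n 0<n (subst₂ _≤_ norm-y quad-y (proj₁ r)) ,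
                *-cancelˡ-≤ n 0<n (subst₂ _≤_ quad-y (trans (cong (b *_) norm-y)
                  (solve 3 (λ b n z → b :* (n :* z) := n :* (b :* z)) refl b n (n * normSq x - s * s))) (proj₂ r))
      where
      s = sum x
      y : Vect (suc m)
      y i = n * x i + (- s) * 1ℚ
      y⊥1 : sum y ≡ 0ℚ
      y⊥1 = trans (∑-linear n (- s) x ones) (trans (cong (λ z → n * s + (- s) * z) (trans (∑-const (suc m) 1ℚ) (*-identityʳ n)))
        (solve 2 (λ n s → n :* s :+ (:- s) :* n := con 0ℚ) refl n s))
      r = rayleigh y y⊥1
      x·1 : dot x ones ≡ s
      x·1 = sum-cong-≗ (λ i → *-identityʳ (x i))
      1·1 : dot {suc m} ones ones ≡ n
      1·1 = trans (∑-const (suc m) (1ℚ * 1ℚ)) (*-identityʳ n)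
      norm-y : normSq y ≡ n * (n * normSq x - s * s)
      norm-y = begin
        normSq y
          ≡⟨ dot-linearˡ n (- s) x ones y ⟩
        n * dot x y + (- s) * dot ones y
          ≡⟨ cong₂ (λ p q → n * p + (- s) * q) (trans (dot-linearʳ x n (- s) x ones) (cong (λ z → n * normSq x + (- s) * z) x·1))
               (trans (dot-linearʳ ones n (- s) x ones) (cong₂ (λ p q → n * p + (- s) * q) (trans (dot-comm ones x) x·1) 1·1)) ⟩
        n * (n * normSq x + (- s) * s) + (- s) * (n * s + (- s) * n)
          ≡⟨ solve 3 (λ n z s → n :* (n :* z :+ (:- s) :* s) :+ (:- s) :* (n :* s :+ (:- s) :* n) := n :* (n :* z :- s :* s)) refl n (normSq x) s ⟩
        n * (n * normSq x - s * s) ∎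
        where open ≡-Reasoning
      L-ones : ∀ i → (L ⊛ ones) i ≡ 0ℚ
      L-ones i = trans (sum-cong-≗ (λ k → *-identityʳ (L i k))) (lap-row W i)
      quad-y : quad L y ≡ n * (n * quad L x)
      quad-y = begin
        quad L y
          ≡⟨ dot-cong {x = y} (λ _ → refl) (λ i → trans (⊛-linear L n (- s) x ones i)
               (cong (λ z → n * (L ⊛ x) i + (- s) * z) (L-ones i))) ⟩
        dot y (λ i → n * (L ⊛ x) i + (- s) * 0ℚ)
          ≡⟨ trans (dot-linearʳ y n (- s) (L ⊛ x) (λ _ → 0ℚ)) (cong₂ (λ p q → n * p + (- s) * q) (dot-linearˡ n (- s) x ones (L ⊛ x))
               (∑-zero (λ i → *-zeroʳ (y i)))) ⟩
        n * (n * quad L x + (- s) * dot ones (L ⊛ x)) + (- s) * 0ℚ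
          ≡⟨ cong (λ z → n * (n * quad L x + (- s) * z) + (- s) * 0ℚ) (trans (dot-⊛ L (lap-sym W W-sym) ones x) (∑-zero (λ i → trans (cong (_* x i) (L-ones i)) (*-zeroˡ (x i))))) ⟩
        n * (n * quad L x + (- s) * 0ℚ) + (- s) * 0ℚ
          ≡⟨ solve 3 (λ n q s → n :* (n :* q :+ (:- s) :* con 0ℚ) :+ (:- s) :* con 0ℚ := n :* (n :* q)) refl n (quad L x) s ⟩
        n * (n * quad L x) ∎
        where open ≡-Reasoning

    -- Obtained by comparing the quadratic forms at p + q and p - q: as the supports are disjoint, the degrees cancel.
    disjoint-test : ∀ (p q : Vect (suc m)) → (∀ v → p v * q v ≡ 0ℚ) →
      4ℚ * n * dot p (W ⊛ q) ≤ n * (b - 1ℚ) * (normSq p + normSq q) + (sum p + sum q) * (sum p + sum q)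
    -- The square of `sum d` enters the upper bound with a favourable sign and is given away; only
    -- the square of `sum f` remains in the statement.
    disjoint-test p q p·q≡0 = ≤-by (lowerSlack + upperSlack + b * (sum d * sum d))
      (0≤+ (0≤+ (0≤Δ (proj₁ (centred f))) (0≤Δ (proj₂ (centred d)))) (0≤* 0≤b (0≤-square (sum d))))
      (begin
        n * (b - 1ℚ) * Z + (sum p + sum q) * (sum p + sum q)
          ≡⟨ solve 8 (λ n b z s t x y w → n :* (b :- con 1ℚ) :* z :+ s :* s
               := con 4ℚ :* n :* w :+ ((n :* (x :+ (:- con 2ℚ) :* w :+ y) :- (n :* z :- s :* s)) :+ (b :* (n :* z :- t :* t) :- n :* (x :+ con 2ℚ :* w :+ y)) :+ b :* (t :* t)))
               refl n b Z (sum p + sum q) (sum d) (quad L p) (quad L q) C ⟩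
        4ℚ * n * C + ((n * (quad L p + (- 2ℚ) * C + quad L q) - (n * Z - (sum p + sum q) * (sum p + sum q)))
          + (b * (n * Z - sum d * sum d) - n * (quad L p + 2ℚ * C + quad L q)) + b * (sum d * sum d))
          ≡⟨ cong (λ z → 4ℚ * n * C + (z + b * (sum d * sum d))) (cong₂ _+_
               (cong₂ (λ x y → n * x - y) (sym quad-f) (cong₂ (λ x y → n * x - y * y) (sym norm-f) (sym sum-f)))
               (cong₂ (λ x y → b * (n * x - sum d * sum d) - n * y) (sym norm-d) (sym quad-d))) ⟩
        4ℚ * n * C + (lowerSlack + upperSlack + b * (sum d * sum d)) ∎)
      where
      open ≡-Reasoning
      C = dot p (W ⊛ q)
      Z = normSq p + normSq q
      f d : Vect (suc m)
      f v = 1ℚ * p v + 1ℚ * q v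
      d v = 1ℚ * p v + (- 1ℚ) * q v
      lowerSlack = n * quad L f - (n * normSq f - sum f * sum f)
      upperSlack = b * (n * normSq d - sum d * sum d) - n * quad L d
      sum-f : sum f ≡ sum p + sum q
      sum-f = trans (∑-linear 1ℚ 1ℚ p q) (cong₂ _+_ (*-identityˡ (sum p)) (*-identityˡ (sum q)))
      p·q : dot p q ≡ 0ℚ
      p·q = ∑-zero p·q≡0
      norm : ∀ c → c * c ≡ 1ℚ → normSq (λ v → 1ℚ * p v + c * q v) ≡ Z
      norm c c² = trans (trans (dot-linearˡ 1ℚ c p q (λ v → 1ℚ * p v + c * q v)) (cong₂ (λ x y → 1ℚ * x + c * y) (dot-linearʳ p 1ℚ c p q) (dot-linearʳ q 1ℚ c p q)))
        (trans (cong₂ (λ x y → 1ℚ * (1ℚ * normSq p + c * x) + c * (1ℚ * y + c * normSq q)) p·q (trans (dot-comm q p) p·q))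
          (trans (solve 3 (λ x y c → con 1ℚ :* (con 1ℚ :* x :+ c :* con 0ℚ) :+ c :* (con 1ℚ :* con 0ℚ :+ c :* y) := x :+ c :* c :* y) refl (normSq p) (normSq q) c)
            (trans (cong (λ z → normSq p + z * normSq q) c²) (cong (normSq p +_) (*-identityˡ (normSq q))))))
      norm-f = norm 1ℚ refl
      norm-d = norm (- 1ℚ) refl
      cross : dot p (L ⊛ q) ≡ - C
      cross = trans (dot-cong {x = p} (λ _ → refl) (lap-⊛ W q)) (trans (sum-cong-≗ (λ v → trans
        (solve 4 (λ p s q w → p :* (s :* q :+ con (- 1ℚ) :* w) := s :* (p :* q) :+ con (- 1ℚ) :* (p :* w)) refl (p v) (sum (W v)) (q v) ((W ⊛ q) v))
        (trans (cong (λ z → sum (W v) * z + - 1ℚ * (p v * (W ⊛ q) v)) (p·q≡0 v)) (solve 2 (λ s w → s :* con 0ℚ :+ w := w) refl (sum (W v)) (- 1ℚ * (p v * (W ⊛ q) v))))))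
        (trans (sym (*-distribˡ-sum (- 1ℚ) (λ v → p v * (W ⊛ q) v))) (solve 1 (λ c → con (- 1ℚ) :* c := :- c) refl C)))
      quad-c : ∀ c → quad L (λ v → 1ℚ * p v + c * q v) ≡ quad L p + (- (2ℚ * c)) * C + c * c * quad L q
      quad-c c = begin
        dot x (L ⊛ x)
          ≡⟨ dot-cong {x = x} (λ _ → refl) (⊛-linear L 1ℚ c p q) ⟩
        dot x (λ v → 1ℚ * (L ⊛ p) v + c * (L ⊛ q) v)
          ≡⟨ trans (dot-linearˡ 1ℚ c p q (λ v → 1ℚ * (L ⊛ p) v + c * (L ⊛ q) v)) (cong₂ (λ y z → 1ℚ * y + c * z) (dot-linearʳ p 1ℚ c (L ⊛ p) (L ⊛ q)) (dot-linearʳ q 1ℚ c (L ⊛ p) (L ⊛ q))) ⟩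
        1ℚ * (1ℚ * quad L p + c * dot p (L ⊛ q)) + c * (1ℚ * dot q (L ⊛ p) + c * quad L q)
          ≡⟨ cong₂ (λ y z → 1ℚ * (1ℚ * quad L p + c * y) + c * (1ℚ * z + c * quad L q)) cross
               (trans (dot-⊛ L (lap-sym W W-sym) q p) (trans (dot-comm (L ⊛ q) p) cross)) ⟩
        1ℚ * (1ℚ * quad L p + c * - C) + c * (1ℚ * - C + c * quad L q)
          ≡⟨ solve 4 (λ x y c w → con 1ℚ :* (con 1ℚ :* x :+ c :* :- w) :+ c :* (con 1ℚ :* :- w :+ c :* y) := x :+ (:- (con 2ℚ :* c)) :* w :+ c :* c :* y) refl (quad L p) (quad L q) c C ⟩
        quad L p + (- (2ℚ * c)) * C + c * c * quad L q ∎
        where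
        x : Vect (suc m)
        x v = 1ℚ * p v + c * q v
      quad-f : quad L f ≡ quad L p + (- 2ℚ) * C + quad L q
      quad-f = trans (quad-c 1ℚ) (cong (quad L p + (- 2ℚ) * C +_) (*-identityˡ (quad L q)))
      quad-d : quad L d ≡ quad L p + 2ℚ * C + quad L q
      quad-d = trans (quad-c (- 1ℚ)) (cong (quad L p + 2ℚ * C +_) (*-identityˡ (quad L q)))

    module _ (φ : ℕ → Vect (suc m)) (K : ℕ) (0≤φ : ∀ ℓ v → 0ℚ ≤ φ ℓ v)
      (φ-disjoint : ∀ k ℓ → k ℕ.< ℓ → ℓ ℕ.≤ K → ∀ v → φ k v * φ ℓ v ≡ 0ℚ) where

      -- The levels up to k, separated by whether their parity is that of k.
      same other : ℕ → Vect (suc m)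
      same zero = φ zero
      same (suc k) v = other k v + φ (suc k) v
      other zero _ = 0ℚ
      other (suc k) = same k

      0≤same : ∀ k v → 0ℚ ≤ same k v
      0≤other : ∀ k v → 0ℚ ≤ other k v
      0≤same zero v = 0≤φ zero v
      0≤same (suc k) v = 0≤+ (0≤other k v) (0≤φ (suc k) v)
      0≤other zero v = ≤-refl
      0≤other (suc k) v = 0≤same k v

      later-disjoint : ∀ k ℓ → k ℕ.< ℓ → ℓ ℕ.≤ K → ∀ v → same k v * φ ℓ v ≡ 0ℚ × other k v * φ ℓ v ≡ 0ℚ
      later-disjoint zero ℓ k<ℓ ℓ≤K v = φ-disjoint zero ℓ k<ℓ ℓ≤K v , *-zeroˡ (φ ℓ v)
      later-disjoint (suc k) ℓ k<ℓ ℓ≤K v with later-disjoint k ℓ (ℕ.<-trans (ℕ.n<1+n k) k<ℓ) ℓ≤K v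
      ... | s , o = trans (*-distribʳ-+ (φ ℓ v) (other k v) (φ (suc k) v)) (cong₂ _+_ o (φ-disjoint (suc k) ℓ k<ℓ ℓ≤K v)) , s

      same-other : ∀ k → k ℕ.≤ K → ∀ v → same k v * other k v ≡ 0ℚ
      same-other zero _ v = *-zeroʳ (φ zero v)
      same-other (suc k) k<K v = trans (*-distribʳ-+ (same k v) (other k v) (φ (suc k) v)) (cong₂ _+_
        (trans (*-comm (other k v) (same k v)) (same-other k (ℕ.<⇒≤ k<K) v))
        (trans (*-comm (φ (suc k) v) (same k v)) (proj₁ (later-disjoint k (suc k) ℕ.≤-refl k<K v))))

      levels-norm : ∀ k → k ℕ.≤ K → normSq (same k) + normSq (other k) ≡ range (suc k) (normSq ∘ φ)
      levels-norm zero _ = trans (cong (normSq (φ zero) +_) (∑-zero {suc m} (λ _ → refl))) (+-comm (normSq (φ zero)) 0ℚ)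
      levels-norm (suc k) k<K = begin
        normSq (same (suc k)) + normSq (same k)
          ≡⟨ cong (_+ normSq (same k)) (trans (sum-cong-≗ (λ v → trans
               (solve 2 (λ o f → (o :+ f) :* (o :+ f) := o :* o :+ f :* f :+ con 2ℚ :* (o :* f)) refl (other k v) (φ (suc k) v))
               (trans (cong (λ z → other k v * other k v + φ (suc k) v * φ (suc k) v + 2ℚ * z) (proj₂ (later-disjoint k (suc k) ℕ.≤-refl k<K v)))
                 (+-identityʳ (other k v * other k v + φ (suc k) v * φ (suc k) v)))))
               (∑-distrib-+ (λ v → other k v * other k v) (λ v → φ (suc k) v * φ (suc k) v))) ⟩
        normSq (other k) + normSq (φ (suc k)) + normSq (same k)
          ≡⟨ solve 3 (λ a b c → a :+ b :+ c := c :+ a :+ b) refl (normSq (other k)) (normSq (φ (suc k))) (normSq (same k)) ⟩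
        normSq (same k) + normSq (other k) + normSq (φ (suc k))
          ≡⟨ cong (_+ normSq (φ (suc k))) (levels-norm k (ℕ.<⇒≤ k<K)) ⟩
        range (suc k) (normSq ∘ φ) + normSq (φ (suc k)) ∎
        where open ≡-Reasoning

      levels-sum : ∀ k → sum (same k) + sum (other k) ≡ range (suc k) (sum ∘ φ)
      levels-sum zero = trans (cong (sum (φ zero) +_) (∑-zero {suc m} (λ _ → refl))) (+-comm (sum (φ zero)) 0ℚ)
      levels-sum (suc k) = trans (cong (_+ sum (same k)) (∑-distrib-+ (other k) (φ (suc k))))
        (trans (solve 3 (λ a b c → a :+ b :+ c := c :+ a :+ b) refl (sum (other k)) (sum (φ (suc k))) (sum (same k)))
          (cong (_+ sum (φ (suc k))) (levels-sum k)))

      φ≤same : ∀ k v → φ k v ≤ same k v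
      φ≤same zero v = ≤-refl
      φ≤same (suc k) v = ≤-by (other k v) (0≤other k v) (+-comm (other k v) (φ (suc k) v))

      -- Raising `k` exchanges the two parity classes and adds the new level to one of them. By
      -- symmetry of `W` the form grows exactly by the edges at the new level; of these only the
      -- ones to the preceding level are retained, the others being nonnegative.
      levels-edges : ∀ k → range k (λ ℓ → dot (φ (suc ℓ)) (W ⊛ φ ℓ)) ≤ dot (same k) (W ⊛ other k)
      levels-edges zero = ≤-reflexive (sym (∑-zero (λ v → trans (cong (φ zero v *_) (∑-zero (λ u → *-zeroʳ (W v u)))) (*-zeroʳ (φ zero v)))))
      levels-edges (suc k) = begin
        range k (λ ℓ → dot (φ (suc ℓ)) (W ⊛ φ ℓ)) + dot (φ (suc k)) (W ⊛ φ k)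
          ≤⟨ +-mono-≤ (levels-edges k) (∑-mono (λ v → *-monoˡ (φ (suc k) v) (0≤φ (suc k) v) (∑-mono (λ u → *-monoˡ (W v u) (0≤W v u) (φ≤same k u))))) ⟩
        dot (same k) (W ⊛ other k) + dot (φ (suc k)) (W ⊛ same k)
          ≡⟨ cong (_+ dot (φ (suc k)) (W ⊛ same k)) (trans (dot-⊛ W W-sym (same k) (other k)) (dot-comm (W ⊛ same k) (other k))) ⟩
        dot (other k) (W ⊛ same k) + dot (φ (suc k)) (W ⊛ same k)
          ≡⟨ sym (trans (sum-cong-≗ (λ v → *-distribʳ-+ ((W ⊛ same k) v) (other k v) (φ (suc k) v)))
               (∑-distrib-+ (λ v → other k v * (W ⊛ same k) v) (λ v → φ (suc k) v * (W ⊛ same k) v))) ⟩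
        dot (same (suc k)) (W ⊛ same k) ∎
        where open ≤-Reasoning

      levels-test : 4ℚ * n * range K (λ ℓ → dot (φ (suc ℓ)) (W ⊛ φ ℓ)) ≤
        n * (b - 1ℚ) * range (suc K) (normSq ∘ φ) + range (suc K) (sum ∘ φ) * range (suc K) (sum ∘ φ)
      levels-test = begin
        4ℚ * n * range K (λ ℓ → dot (φ (suc ℓ)) (W ⊛ φ ℓ))  ≤⟨ *-monoˡ (4ℚ * n) (0≤* {4ℚ} (*≤* (ℤ.+≤+ z≤n)) (<⇒≤ 0<n)) (levels-edges K) ⟩
        4ℚ * n * dot (same K) (W ⊛ other K)  ≤⟨ disjoint-test (same K) (other K) (same-other K ℕ.≤-refl) ⟩
        n * (b - 1ℚ) * (normSq (same K) + normSq (other K)) + (sum (same K) + sum (other K)) * (sum (same K) + sum (other K))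
          ≡⟨ cong₂ (λ x y → n * (b - 1ℚ) * x + y * y) (levels-norm K ℕ.≤-refl) (levels-sum K) ⟩
        n * (b - 1ℚ) * range (suc K) (normSq ∘ φ) + range (suc K) (sum ∘ φ) * range (suc K) (sum ∘ φ) ∎
        where open ≤-Reasoning

-- Weighted path functions: their norms, sums and edge contributions.

module WeightedPaths where

  open Rationals
  open R using (WeightedGraph; HasCycle)
  open Determinants using (Mat)
  open QuadraticForms
  open Descent using (0≤δ; ∑-δ-row)
  open RayleighBounds using (lap)
  open SimplePaths
  open ListSums
  open LevelTest

  δ² : ∀ {n} (u v : Fin n) → δ u v * δ u v ≡ δ u v
  δ² u v with u Fin.≟ v
  ... | yes _ = refl
  ... | no _ = refl

  δ≢0 : ∀ {n} (u v : Fin n) → δ u v ≢ 0ℚ → u ≡ v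
  δ≢0 u v h with u Fin.≟ v
  ... | yes u≡v = u≡v
  ... | no _ = contradiction refl h

  ≢0ˡ : ∀ {p q} → p * q ≢ 0ℚ → p ≢ 0ℚ
  ≢0ˡ {q = q} h refl = h (*-zeroˡ q)

  ≢0ʳ : ∀ {p q} → p * q ≢ 0ℚ → q ≢ 0ℚ
  ≢0ʳ {p} h refl = h (*-zeroʳ p)

  -- `g` plays the square root of `W`, known only approximately. `D` bounds the sum of g² at a
  -- vertex from above, `θ` bounds it from below after the vertices of a short list have been
  -- excluded, and `γ` is a lower bound for the growth of the sums of consecutive levels.
  module PathSums {m} (G : WeightedGraph (suc m)) (W g : Mat (suc m))
    (W-sym : Sym W) (0≤W : ∀ u v → 0ℚ ≤ W u v) (g-sym : Sym g) (0≤g : ∀ u v → 0ℚ ≤ g u v)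
    (g-edge : ∀ u v → ¬ WeightedGraph._∼_ G u v → g u v ≡ 0ℚ)
    (K : ℕ) (acyclic : ∀ k → k ℕ.≤ suc K ℕ.+ suc K → ¬ HasCycle G k)
    (D : ℚ) (1≤D : 1ℚ ≤ D) (g²≤D : ∀ v → sum (λ x → g v x * g v x) ≤ D)
    (θ : ℚ) (0≤θ : 0ℚ ≤ θ) (θ≤1 : θ ≤ 1ℚ)
    (θ≤ : ∀ v us → length us ℕ.≤ suc K → θ ≤ sum (λ z → g v z * g v z * out z us))
    (ḡ : ℚ) (0<ḡ : 0ℚ < ḡ) (g≤ḡ : ∀ u v → g u v ≤ ḡ)
    (γ : ℚ) (2≤γ : 2ℚ ≤ γ) (γḡ≤θ : γ * ḡ ≤ θ) where

    open WeightedGraph G using (_∼_; _∼?_; ∼-irrefl)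

    private
      n = ι (suc m)
      V = Fin (suc m)
      0≤n = 0≤ι (suc m)
      0≤D : 0ℚ ≤ D
      0≤D = ≤-trans 0≤1 1≤D
      0≤γ : 0ℚ ≤ γ
      0≤γ = ≤-trans (<⇒≤ 0<2) 2≤γ

    pathWeight : V → List V → ℚ
    pathWeight u [] = 1ℚ
    pathWeight u (v ∷ vs) = out u (v ∷ vs) * (g u v * pathWeight v vs)

    0≤pathWeight : ∀ u vs → 0ℚ ≤ pathWeight u vs
    0≤pathWeight u [] = 0≤1
    0≤pathWeight u (v ∷ vs) = 0≤* (0≤out u (v ∷ vs)) (0≤* (0≤g u v) (0≤pathWeight v vs))

    pathWeight≢0⇒Path : ∀ u vs → pathWeight u vs ≢ 0ℚ → Path G u vs
    pathWeight≢0⇒Path u [] _ = stop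
    pathWeight≢0⇒Path u (v ∷ vs) h = step u∼v (out≢0⇒∉ u (v ∷ vs) (≢0ˡ {out u (v ∷ vs)} h))
      (pathWeight≢0⇒Path v vs (≢0ʳ {g u v} (≢0ʳ {out u (v ∷ vs)} h)))
      where
      u∼v : u ∼ v
      u∼v with u ∼? v
      ... | yes p = p
      ... | no ¬p = contradiction (g-edge u v ¬p) (≢0ˡ {g u v} (≢0ʳ {out u (v ∷ vs)} h))

    pathWeight-∷ʳ : ∀ v vs z → pathWeight v (vs ∷ʳ z) ≡ pathWeight v vs * (out z (v ∷ vs) * g (end v vs) z)
    pathWeight-∷ʳ v [] z = trans (cong (λ d → (1ℚ - d) * 1ℚ * (g v z * 1ℚ)) (δ-sym v z))
      (solve 2 (λ o g → o :* con 1ℚ :* (g :* con 1ℚ) := con 1ℚ :* (o :* con 1ℚ :* g)) refl (ne z v) (g v z))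
    pathWeight-∷ʳ v (u ∷ us) z = trans (cong₂ (λ a b → a * (g v u * b)) (out-∷ʳ v (u ∷ us) z) (pathWeight-∷ʳ u us z))
      (solve 6 (λ o e g p o′ g′ → o :* e :* (g :* (p :* (o′ :* g′))) := o :* (g :* p) :* (e :* o′ :* g′)) refl
        (out v (u ∷ us)) (ne z v) (g v u) (pathWeight u us) (out z (u ∷ us)) (g (end u us) z))

    rooted : V → V → List V → ℚ
    rooted r v vs = pathWeight v vs * δ (end v vs) r

    0≤rooted : ∀ r v vs → 0ℚ ≤ rooted r v vs
    0≤rooted r v vs = 0≤* (0≤pathWeight v vs) (0≤δ (end v vs) r)

    level : V → ℕ → Vect (suc m)
    level r ℓ v = sumW ℓ (rooted r v)

    0≤level : ∀ r ℓ v → 0ℚ ≤ level r ℓ v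
    0≤level r ℓ v = 0≤sumW ℓ (0≤rooted r v)

    -- By the girth hypothesis a vertex is reached from r by at most one path.
    rooted-unique : ∀ r v us vs → length us ℕ.≤ suc K → length vs ℕ.≤ suc K → us ≢ vs → rooted r v us * rooted r v vs ≡ 0ℚ
    rooted-unique r v us vs us≤ vs≤ us≢vs with rooted r v us * rooted r v vs ≟ 0ℚ
    ... | yes eq = eq
    ... | no ≢0 with two-paths G (path us (≢0ˡ ≢0)) (path vs (≢0ʳ {rooted r v us} ≢0)) (trans (root us (≢0ˡ ≢0)) (sym (root vs (≢0ʳ {rooted r v us} ≢0))))
      where
      path : ∀ ws → rooted r v ws ≢ 0ℚ → Path G v ws
      path ws h = pathWeight≢0⇒Path v ws (≢0ˡ h)
      root : ∀ ws → rooted r v ws ≢ 0ℚ → end v ws ≡ r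
      root ws h = δ≢0 (end v ws) r (≢0ʳ {pathWeight v ws} h)
    ...   | inj₁ us≡vs = contradiction us≡vs us≢vs
    ...   | inj₂ (k , k≤ , cycle) = contradiction cycle (acyclic k (ℕ.≤-trans k≤ (ℕ.+-mono-≤ us≤ vs≤)))

    level-disjoint : ∀ r k ℓ → k ℕ.< ℓ → ℓ ℕ.≤ suc K → ∀ v → level r k v * level r ℓ v ≡ 0ℚ
    level-disjoint r k ℓ k<ℓ ℓ≤ v = sumW-orthogonal k ℓ λ us vs ∣us∣ ∣vs∣ → rooted-unique r v us vs
      (ℕ.≤-trans (ℕ.≤-reflexive ∣us∣) (ℕ.≤-trans (ℕ.<⇒≤ k<ℓ) ℓ≤)) (ℕ.≤-trans (ℕ.≤-reflexive ∣vs∣) ℓ≤)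
      (λ eq → ℕ.<⇒≢ k<ℓ (trans (sym ∣us∣) (trans (cong length eq) ∣vs∣)))

    squared : V → V → List V → ℚ
    squared r v vs = pathWeight v vs * pathWeight v vs * δ (end v vs) r

    0≤squared : ∀ r v vs → 0ℚ ≤ squared r v vs
    0≤squared r v vs = 0≤* (0≤-square (pathWeight v vs)) (0≤δ (end v vs) r)

    rooted² : ∀ r v vs → rooted r v vs * rooted r v vs ≡ squared r v vs
    rooted² r v vs = trans (solve 2 (λ p d → p :* d :* (p :* d) := p :* p :* (d :* d)) refl (pathWeight v vs) (δ (end v vs) r))
      (cong (pathWeight v vs * pathWeight v vs *_) (δ² (end v vs) r))

    normSq-level : ∀ r ℓ → ℓ ℕ.≤ suc K → normSq (level r ℓ) ≡ sum (λ v → sumW ℓ (squared r v))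
    normSq-level r ℓ ℓ≤ = sum-cong-≗ λ v → trans (sumW-square ℓ (rooted r v) λ us vs ∣us∣ ∣vs∣ → rooted-unique r v us vs
      (ℕ.≤-trans (ℕ.≤-reflexive ∣us∣) ℓ≤) (ℕ.≤-trans (ℕ.≤-reflexive ∣vs∣) ℓ≤)) (sumW-cong ℓ λ vs _ → rooted² r v vs)

    -- The free end of the path is summed out first: the indicator that the new vertex is off the
    -- path is at most 1, and the g² at the old free end add up to at most `D`.
    ∑-squared≤ : ∀ r ℓ → sum (λ v → sumW ℓ (squared r v)) ≤ D ^ ℓ
    ∑-squared≤ r zero = ≤-reflexive (trans (sum-cong-≗ (λ v → trans (*-identityˡ (δ v r)) (δ-sym v r))) (∑-δ-row r))
    ∑-squared≤ r (suc ℓ) = begin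
      sum (λ x → sum (λ v → sumW ℓ (λ vs → squared r x (v ∷ vs))))
        ≡⟨ ∑-comm (λ x v → sumW ℓ (λ vs → squared r x (v ∷ vs))) ⟩
      sum (λ v → sum (λ x → sumW ℓ (λ vs → squared r x (v ∷ vs))))
        ≡⟨ sum-cong-≗ (λ v → ∑-sumW-comm ℓ (λ x vs → squared r x (v ∷ vs))) ⟩
      sum (λ v → sumW ℓ (λ vs → sum (λ x → squared r x (v ∷ vs))))
        ≤⟨ ∑-mono (λ v → sumW-mono ℓ (λ vs _ → extension v vs)) ⟩
      sum (λ v → sumW ℓ (λ vs → D * squared r v vs))
        ≡⟨ trans (sum-cong-≗ (λ v → sym (*-distribˡ-sumW ℓ D (squared r v)))) (sym (*-distribˡ-sum D (λ v → sumW ℓ (squared r v)))) ⟩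
      D * sum (λ v → sumW ℓ (squared r v))
        ≤⟨ *-monoˡ D 0≤D (∑-squared≤ r ℓ) ⟩
      D * D ^ ℓ ∎
      where
      open ≤-Reasoning
      extension : ∀ v vs → sum (λ x → squared r x (v ∷ vs)) ≤ D * squared r v vs
      extension v vs = begin
        sum (λ x → squared r x (v ∷ vs))  ≤⟨ ∑-mono term ⟩
        sum (λ x → g v x * g v x * squared r v vs)    ≡⟨ sym (*-distribʳ-sum (squared r v vs) (λ x → g v x * g v x)) ⟩
        sum (λ x → g v x * g v x) * squared r v vs    ≤⟨ *-monoʳ (squared r v vs) (0≤squared r v vs) (g²≤D v) ⟩
        D * squared r v vs  ∎
        where
        term : ∀ x → squared r x (v ∷ vs) ≤ g v x * g v x * squared r v vs
        term x = ≤-by ((1ℚ - o) * (g v x * g v x * squared r v vs))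
          (0≤* (0≤Δ (out≤1 x (v ∷ vs))) (0≤* (0≤-square (g v x)) (0≤squared r v vs)))
          (trans (solve 4 (λ o g p d → g :* g :* (p :* p :* d) := o :* (g :* g :* (p :* p :* d)) :+ (con 1ℚ :- o) :* (g :* g :* (p :* p :* d))) refl o (g v x) p d)
            (cong (_+ (1ℚ - o) * (g v x * g v x * squared r v vs)) (trans (cong (_* (g v x * g v x * (p * p * d))) (sym (out² x (v ∷ vs))))
              (trans (solve 4 (λ o g p d → o :* o :* (g :* g :* (p :* p :* d)) := o :* (g :* p) :* (o :* (g :* p)) :* d) refl o (g v x) p d)
                (cong (λ y → o * (y * p) * (o * (y * p)) * d) (g-sym v x))))))
          where
          o = out x (v ∷ vs)
          p = pathWeight v vs
          d = δ (end v vs) r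

    normSq-level≤ : ∀ r ℓ → ℓ ℕ.≤ suc K → normSq (level r ℓ) ≤ D ^ ℓ
    normSq-level≤ r ℓ ℓ≤ = ≤-trans (≤-reflexive (normSq-level r ℓ ℓ≤)) (∑-squared≤ r ℓ)

    levelSum : V → ℕ → ℚ
    levelSum r ℓ = sum (level r ℓ)

    0≤levelSum : ∀ r ℓ → 0ℚ ≤ levelSum r ℓ
    0≤levelSum r ℓ = 0≤∑ (0≤level r ℓ)

    -- As g ≤ ḡ, the sum of g is at least the sum of g² divided by ḡ: when every single weight is
    -- small, the square roots of the weights have a large sum.
    growth : ∀ v vs → length vs ℕ.≤ K → γ ≤ sum (λ x → out x (v ∷ vs) * g x v)
    growth v vs ∣vs∣ = *-cancelʳ-≤ ḡ 0<ḡ (begin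
      γ * ḡ  ≤⟨ γḡ≤θ ⟩
      θ  ≤⟨ θ≤ v (v ∷ vs) (s≤s ∣vs∣) ⟩
      sum (λ z → g v z * g v z * out z (v ∷ vs))     ≤⟨ ∑-mono (λ z → ≤-trans
                                (*-monoʳ (out z (v ∷ vs)) (0≤out z (v ∷ vs)) (*-monoˡ (g v z) (0≤g v z) (g≤ḡ v z)))
                                (≤-reflexive (trans (solve 3 (λ g h o → g :* h :* o := o :* g :* h) refl (g v z) ḡ (out z (v ∷ vs)))
                                (cong (λ y → out z (v ∷ vs) * y * ḡ) (g-sym v z))))) ⟩
      sum (λ z → out z (v ∷ vs) * g z v * ḡ)  ≡⟨ sym (*-distribʳ-sum ḡ (λ z → out z (v ∷ vs) * g z v)) ⟩
      sum (λ z → out z (v ∷ vs) * g z v) * ḡ  ∎)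
      where open ≤-Reasoning

    levelSum-growth : ∀ r ℓ → ℓ ℕ.≤ K → γ * levelSum r ℓ ≤ levelSum r (suc ℓ)
    levelSum-growth r ℓ ℓ≤K = begin
      γ * sum (λ v → sumW ℓ (rooted r v))
        ≡⟨ trans (*-distribˡ-sum γ (λ v → sumW ℓ (rooted r v))) (sum-cong-≗ (λ v → *-distribˡ-sumW ℓ γ (rooted r v))) ⟩
      sum (λ v → sumW ℓ (λ vs → γ * rooted r v vs))
        ≤⟨ ∑-mono (λ v → sumW-mono ℓ (λ vs ∣vs∣ → extension v vs (ℕ.≤-trans (ℕ.≤-reflexive ∣vs∣) ℓ≤K))) ⟩
      sum (λ v → sumW ℓ (λ vs → sum (λ x → rooted r x (v ∷ vs))))
        ≡⟨ sum-cong-≗ (λ v → sym (∑-sumW-comm ℓ (λ x vs → rooted r x (v ∷ vs)))) ⟩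
      sum (λ v → sum (λ x → sumW ℓ (λ vs → rooted r x (v ∷ vs))))
        ≡⟨ ∑-comm (λ v x → sumW ℓ (λ vs → rooted r x (v ∷ vs))) ⟩
      sum (λ x → sum (λ v → sumW ℓ (λ vs → rooted r x (v ∷ vs)))) ∎
      where
      open ≤-Reasoning
      extension : ∀ v vs → length vs ℕ.≤ K → γ * rooted r v vs ≤ sum (λ x → rooted r x (v ∷ vs))
      extension v vs ∣vs∣ = begin
        γ * rooted r v vs  ≤⟨ *-monoʳ (rooted r v vs) (0≤rooted r v vs) (growth v vs ∣vs∣) ⟩
        sum (λ x → out x (v ∷ vs) * g x v) * rooted r v vs        ≡⟨ *-distribʳ-sum (rooted r v vs) (λ x → out x (v ∷ vs) * g x v) ⟩
        sum (λ x → out x (v ∷ vs) * g x v * rooted r v vs)        ≡⟨ sum-cong-≗ (λ x → solve 4 (λ o g p d → o :* g :* (p :* d) := o :* (g :* p) :* d) refl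
                                (out x (v ∷ vs)) (g x v) (pathWeight v vs) (δ (end v vs) r)) ⟩
        sum (λ x → rooted r x (v ∷ vs))  ∎

    range-levelSum≤ : ∀ r k → k ℕ.≤ K → range (suc k) (levelSum r) ≤ 2ℚ * levelSum r k
    range-levelSum≤ r zero _ = ≤-by (levelSum r 0) (0≤levelSum r 0) (solve 1 (λ x → con 2ℚ :* x := con 0ℚ :+ x :+ x) refl (levelSum r 0))
    range-levelSum≤ r (suc k) k<K = begin
      range (suc k) (levelSum r) + levelSum r (suc k)  ≤⟨ +-monoˡ-≤ (levelSum r (suc k)) (≤-trans (range-levelSum≤ r k (ℕ.<⇒≤ k<K))
                                (≤-trans (*-monoʳ (levelSum r k) (0≤levelSum r k) 2≤γ) (levelSum-growth r k (ℕ.<⇒≤ k<K)))) ⟩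
      levelSum r (suc k) + levelSum r (suc k)  ≡⟨ solve 1 (λ x → x :+ x := con 2ℚ :* x) refl (levelSum r (suc k)) ⟩
      2ℚ * levelSum r (suc k)  ∎
      where open ≤-Reasoning

    -- The level sums at least double, so together they are at most twice the last one, which in
    -- turn is at most 1/γ times that of level `suc K`. There Cauchy-Schwarz and the norm bound
    -- apply.
    range-levelSum²≤ : ∀ r → γ * γ * (range (suc K) (levelSum r) * range (suc K) (levelSum r)) ≤ 4ℚ * (n * D ^ suc K)
    range-levelSum²≤ r = begin
      γ * γ * (s * s)  ≡⟨ solve 2 (λ c s → c :* c :* (s :* s) := c :* s :* (c :* s)) refl γ s ⟩
      γ * s * (γ * s)  ≤⟨ *-mono 0≤γs γs≤ 0≤γs γs≤ ⟩
      2ℚ * X * (2ℚ * X)  ≡⟨ solve 1 (λ x → con 2ℚ :* x :* (con 2ℚ :* x) := con 4ℚ :* (x :* x)) refl X ⟩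
      4ℚ * (X * X)  ≤⟨ *-monoˡ 4ℚ (*≤* (ℤ.+≤+ z≤n)) (≤-trans (sum²≤ (level r (suc K))) (*-monoˡ n 0≤n (normSq-level≤ r (suc K) ℕ.≤-refl))) ⟩
      4ℚ * (n * D ^ suc K)  ∎
      where
      open ≤-Reasoning
      s = range (suc K) (levelSum r)
      X = levelSum r (suc K)
      0≤s : ∀ k → 0ℚ ≤ range k (levelSum r)
      0≤s zero = ≤-refl
      0≤s (suc k) = 0≤+ (0≤s k) (0≤levelSum r k)
      0≤γs = 0≤* 0≤γ (0≤s (suc K))
      γs≤ : γ * s ≤ 2ℚ * X
      γs≤ = ≤-trans (*-monoˡ γ 0≤γ (range-levelSum≤ r K ℕ.≤-refl)) (≤-trans
        (≤-reflexive (solve 2 (λ c x → c :* (con 2ℚ :* x) := con 2ℚ :* (c :* x)) refl γ (levelSum r K)))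
        (*-monoˡ 2ℚ (<⇒≤ 0<2) (levelSum-growth r K ℕ.≤-refl)))

    -- The contribution to ⟨level (suc ℓ), W level ℓ⟩ of a path starting at `v` paired with its own
    -- prolongation to `x`. The new edge carries `W * g`, about w^(3/2), and every other edge g²,
    -- about w.
    flow : List V → ℚ
    flow (x ∷ v ∷ vs) = out x (v ∷ vs) * (W x v * g x v) * (pathWeight v vs * pathWeight v vs)
    flow _ = 0ℚ

    0≤flow : ∀ vs → 0ℚ ≤ flow vs
    0≤flow [] = ≤-refl
    0≤flow (x ∷ []) = ≤-refl
    0≤flow (x ∷ v ∷ vs) = 0≤* (0≤* (0≤out x (v ∷ vs)) (0≤* (0≤W x v) (0≤g x v))) (0≤-square (pathWeight v vs))

    -- Only the pairs formed by a path and its prolongation by one edge are kept; all other products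
    -- are nonnegative.
    level-edges : ∀ r ℓ → sum (λ x → sum (λ v → sumW ℓ (λ vs → flow (x ∷ v ∷ vs) * δ (end v vs) r))) ≤ dot (level r (suc ℓ)) (W ⊛ level r ℓ)
    level-edges r ℓ = ∑-mono λ x → ≤-trans (∑-mono (λ v → sumW-mono ℓ (λ vs ∣vs∣ → term x v vs ∣vs∣)))
      (≤-reflexive (trans (sum-cong-≗ (λ v → trans (sym (*-distribˡ-sumW ℓ ((W ⊛ level r ℓ) x) (λ vs → rooted r x (v ∷ vs))))
          (*-comm ((W ⊛ level r ℓ) x) (sumW ℓ (λ vs → rooted r x (v ∷ vs))))))
        (sym (*-distribʳ-sum ((W ⊛ level r ℓ) x) (λ v → sumW ℓ (λ vs → rooted r x (v ∷ vs)))))))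
      where
      term : ∀ x v vs → length vs ≡ ℓ → flow (x ∷ v ∷ vs) * δ (end v vs) r ≤ (W ⊛ level r ℓ) x * rooted r x (v ∷ vs)
      term x v vs refl = begin
        o * (W x v * g x v) * (p * p) * d  ≡⟨ cong (o * (W x v * g x v) * (p * p) *_) (sym (δ² (end v vs) r)) ⟩
        o * (W x v * g x v) * (p * p) * (d * d)      ≡⟨ solve 5 (λ o w g p d → o :* (w :* g) :* (p :* p) :* (d :* d) := w :* (p :* d) :* (o :* (g :* p) :* d)) refl o (W x v) (g x v) p d ⟩
        W x v * rooted r v vs * rooted r x (v ∷ vs)  ≤⟨ *-monoʳ (rooted r x (v ∷ vs)) (0≤rooted r x (v ∷ vs)) (≤-trans
                                (*-monoˡ (W x v) (0≤W x v) (term≤sumW (0≤rooted r v) vs))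
                                (term≤∑ {f = λ u → W x u * level r ℓ u} (λ u → 0≤* (0≤W x u) (0≤level r ℓ u)) v)) ⟩
        (W ⊛ level r ℓ) x * rooted r x (v ∷ vs)      ∎
        where
        open ≤-Reasoning
        o = out x (v ∷ vs)
        p = pathWeight v vs
        d = δ (end v vs) r

    ∑-flow≤ : ∀ ℓ → sumW (suc (suc ℓ)) flow ≤ sum (λ r → dot (level r (suc ℓ)) (W ⊛ level r ℓ))
    ∑-flow≤ ℓ = begin
      sum (λ x → sum (λ v → sumW ℓ (λ vs → flow (x ∷ v ∷ vs))))
        ≡⟨ sum-cong-≗ (λ x → trans (sum-cong-≗ (λ v → trans (sumW-cong ℓ (λ vs _ → unroot x v vs)) (sym (∑-sumW-comm ℓ (λ r vs → flow (x ∷ v ∷ vs) * δ (end v vs) r)))))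
             (∑-comm (λ v r → sumW ℓ (λ vs → flow (x ∷ v ∷ vs) * δ (end v vs) r)))) ⟩
      sum (λ x → sum (λ r → sum (λ v → sumW ℓ (λ vs → flow (x ∷ v ∷ vs) * δ (end v vs) r))))
        ≡⟨ ∑-comm (λ x r → sum (λ v → sumW ℓ (λ vs → flow (x ∷ v ∷ vs) * δ (end v vs) r))) ⟩
      sum (λ r → sum (λ x → sum (λ v → sumW ℓ (λ vs → flow (x ∷ v ∷ vs) * δ (end v vs) r))))
        ≤⟨ ∑-mono (λ r → level-edges r ℓ) ⟩
      sum (λ r → dot (level r (suc ℓ)) (W ⊛ level r ℓ)) ∎
      where
      open ≤-Reasoning
      unroot : ∀ x v vs → flow (x ∷ v ∷ vs) ≡ sum (λ r → flow (x ∷ v ∷ vs) * δ (end v vs) r)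
      unroot x v vs = sym (trans (sym (*-distribˡ-sum (flow (x ∷ v ∷ vs)) (δ (end v vs))))
        (trans (cong (flow (x ∷ v ∷ vs) *_) (∑-δ-row (end v vs))) (*-identityʳ (flow (x ∷ v ∷ vs)))))

    -- Summing out the root end of the path first leaves the far edge uniformly distributed.
    ∑-flow≥ : ∀ ℓ → ℓ ℕ.≤ K → θ ^ ℓ * sum (λ x → sum (λ v → W x v * g x v)) ≤ sumW (suc (suc ℓ)) flow
    ∑-flow≥ zero _ = ≤-reflexive (trans (*-identityˡ _) (sum-cong-≗ (λ x → sum-cong-≗ (λ v → sym (single x v)))))
      where
      single : ∀ x v → flow (x ∷ v ∷ []) ≡ W x v * g x v
      single x v with x Fin.≟ v
      ... | no _ = solve 1 (λ h → (con 1ℚ :- con 0ℚ) :* con 1ℚ :* h :* (con 1ℚ :* con 1ℚ) := h) refl (W x v * g x v)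
      ... | yes refl = trans (cong (λ z → (1ℚ - 1ℚ) * 1ℚ * (W x x * z) * (1ℚ * 1ℚ)) g≡0) (trans (solve 1 (λ w → (con 1ℚ :- con 1ℚ) :* con 1ℚ :* (w :* con 0ℚ) :* (con 1ℚ :* con 1ℚ) := w :* con 0ℚ) refl (W x x)) (cong (W x x *_) (sym g≡0)))
        where
        g≡0 : g x x ≡ 0ℚ
        g≡0 = g-edge x x (∼-irrefl refl)
    ∑-flow≥ (suc ℓ) ℓ<K = begin
      θ * θ ^ ℓ * H  ≡⟨ *-assoc θ (θ ^ ℓ) H ⟩
      θ * (θ ^ ℓ * H)  ≤⟨ *-monoˡ θ 0≤θ (∑-flow≥ ℓ (ℕ.<⇒≤ ℓ<K)) ⟩
      θ * sumW (suc (suc ℓ)) flow  ≡⟨ *-distribˡ-sumW (suc (suc ℓ)) θ flow ⟩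
      sumW (suc (suc ℓ)) (λ us → θ * flow us)  ≤⟨ sumW-mono (suc (suc ℓ)) (λ us ∣us∣ → prolong us (ℕ.≤-trans (ℕ.≤-reflexive ∣us∣) (s≤s ℓ<K))) ⟩
      sumW (suc (suc ℓ)) (λ us → sum (λ z → flow (us ∷ʳ z)))  ≡⟨ sym (sumW-snoc (suc (suc ℓ)) flow) ⟩
      sumW (suc (suc (suc ℓ))) flow  ∎
      where
      open ≤-Reasoning
      H = sum (λ x → sum (λ v → W x v * g x v))
      prolong : ∀ us → length us ℕ.≤ suc K → θ * flow us ≤ sum (λ z → flow (us ∷ʳ z))
      prolong [] _ = ≤-trans (≤-reflexive (*-zeroʳ θ)) (0≤∑ (λ z → 0≤flow (z ∷ [])))
      prolong (x ∷ []) _ = ≤-trans (≤-reflexive (*-zeroʳ θ)) (0≤∑ (λ z → 0≤flow (x ∷ z ∷ [])))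
      prolong (x ∷ v ∷ vs) ∣us∣ = begin
        θ * f  ≤⟨ *-monoʳ f (0≤flow (x ∷ v ∷ vs)) (θ≤ l (x ∷ v ∷ vs) ∣us∣) ⟩
        sum (λ z → g l z * g l z * out z (x ∷ v ∷ vs)) * f  ≡⟨ *-distribʳ-sum f (λ z → g l z * g l z * out z (x ∷ v ∷ vs)) ⟩
        sum (λ z → g l z * g l z * out z (x ∷ v ∷ vs) * f)  ≡⟨ sum-cong-≗ (λ z → sym (flow-∷ʳ z)) ⟩
        sum (λ z → flow (x ∷ v ∷ (vs ∷ʳ z)))  ∎
        where
        l = end v vs
        f = flow (x ∷ v ∷ vs)
        p = pathWeight v vs
        flow-∷ʳ : ∀ z → flow (x ∷ v ∷ (vs ∷ʳ z)) ≡ g l z * g l z * out z (x ∷ v ∷ vs) * f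
        flow-∷ʳ z = begin-equality
          out x ((v ∷ vs) ∷ʳ z) * (W x v * g x v) * (pathWeight v (vs ∷ʳ z) * pathWeight v (vs ∷ʳ z))
            ≡⟨ cong₂ (λ a b → a * (W x v * g x v) * (b * b)) (out-∷ʳ x (v ∷ vs) z) (pathWeight-∷ʳ v vs z) ⟩
          out x (v ∷ vs) * ne z x * (W x v * g x v) * (p * (out z (v ∷ vs) * g l z) * (p * (out z (v ∷ vs) * g l z)))
            ≡⟨ solve 6 (λ a e h p o g → a :* e :* h :* (p :* (o :* g) :* (p :* (o :* g))) := g :* g :* (e :* (o :* o)) :* (a :* h :* (p :* p))) refl
                 (out x (v ∷ vs)) (ne z x) (W x v * g x v) p (out z (v ∷ vs)) (g l z) ⟩
          g l z * g l z * (ne z x * (out z (v ∷ vs) * out z (v ∷ vs))) * f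
            ≡⟨ cong (λ o → g l z * g l z * (ne z x * o) * f) (out² z (v ∷ vs)) ⟩
          g l z * g l z * out z (x ∷ v ∷ vs) * f ∎

    module _ (b : ℚ) (1≤b : 1ℚ ≤ b)
      (rayleigh : ∀ x → sum x ≡ 0ℚ → normSq x ≤ quad (lap W) x × quad (lap W) x ≤ b * normSq x) where

      -- `levels-test` is summed over all roots and one factor `n` is cancelled. The factor `γ * γ`
      -- clears the denominator in the bound on the level sums.
      spectral-gap≥ : γ * γ * (4ℚ * (ι K * (θ ^ K * sum (λ x → sum (λ v → W x v * g x v))))) ≤
        γ * γ * ((b - 1ℚ) * (n * (ι (suc K) * D ^ K))) + 4ℚ * (n * D ^ suc K)
      spectral-gap≥ = *-cancelˡ-≤ n (0<ι-suc m) (begin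
        n * (γ * γ * (4ℚ * (ι K * (θ ^ K * H))))
          ≡⟨ solve 4 (λ n c q x → n :* (c :* (q :* x)) := c :* (q :* n :* x)) refl n (γ * γ) 4ℚ (ι K * (θ ^ K * H)) ⟩
        γ * γ * (4ℚ * n * (ι K * (θ ^ K * H)))
          ≤⟨ *-monoˡ (γ * γ) (0≤-square γ) (*-monoˡ (4ℚ * n) 0≤4n edges) ⟩
        γ * γ * (4ℚ * n * sum (λ r → E r))
          ≡⟨ cong (γ * γ *_) (*-distribˡ-sum (4ℚ * n) E) ⟩
        γ * γ * sum (λ r → 4ℚ * n * E r)
          ≡⟨ *-distribˡ-sum (γ * γ) (λ r → 4ℚ * n * E r) ⟩
        sum (λ r → γ * γ * (4ℚ * n * E r))
          ≤⟨ ∑-mono per-root ⟩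
        sum {suc m} (λ _ → γ * γ * (n * (b - 1ℚ) * (ι (suc K) * D ^ K)) + 4ℚ * (n * D ^ suc K))
          ≡⟨ ∑-const (suc m) _ ⟩
        n * (γ * γ * (n * (b - 1ℚ) * (ι (suc K) * D ^ K)) + 4ℚ * (n * D ^ suc K))
          ≡⟨ cong (λ z → n * (γ * γ * z + 4ℚ * (n * D ^ suc K))) (solve 3 (λ n b x → n :* b :* x := b :* (n :* x)) refl n (b - 1ℚ) (ι (suc K) * D ^ K)) ⟩
        n * (γ * γ * ((b - 1ℚ) * (n * (ι (suc K) * D ^ K))) + 4ℚ * (n * D ^ suc K)) ∎)
        where
        open ≤-Reasoning
        H = sum (λ x → sum (λ v → W x v * g x v))
        E : V → ℚ
        E r = range K (λ ℓ → dot (level r (suc ℓ)) (W ⊛ level r ℓ))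
        0≤H : 0ℚ ≤ H
        0≤H = 0≤∑ (λ x → 0≤∑ (λ v → 0≤* (0≤W x v) (0≤g x v)))
        0≤4n : 0ℚ ≤ 4ℚ * n
        0≤4n = 0≤* {4ℚ} (*≤* (ℤ.+≤+ z≤n)) 0≤n
        θ^-antitone : ∀ {k ℓ} → k ℕ.≤ ℓ → θ ^ ℓ ≤ θ ^ k
        θ^-antitone {zero} {zero} _ = ≤-refl
        θ^-antitone {zero} {suc ℓ} _ = ≤-trans (*-mono 0≤θ θ≤1 (0≤^ ℓ 0≤θ) (θ^-antitone {zero} {ℓ} z≤n)) (≤-reflexive (*-identityˡ 1ℚ))
        θ^-antitone {suc k} {suc ℓ} (s≤s k≤ℓ) = *-monoˡ θ 0≤θ (θ^-antitone k≤ℓ)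
        D^-monotone : ∀ {k ℓ} → k ℕ.≤ ℓ → D ^ k ≤ D ^ ℓ
        D^-monotone {zero} {zero} _ = ≤-refl
        D^-monotone {zero} {suc ℓ} _ = ≤-trans (≤-reflexive (sym (*-identityˡ 1ℚ))) (*-mono 0≤1 1≤D 0≤1 (D^-monotone {zero} {ℓ} z≤n))
        D^-monotone {suc k} {suc ℓ} (s≤s k≤ℓ) = *-monoˡ D 0≤D (D^-monotone k≤ℓ)
        edges : ι K * (θ ^ K * H) ≤ sum (λ r → E r)
        edges = begin
          ι K * (θ ^ K * H)  ≡⟨ sym (range-const K (θ ^ K * H)) ⟩
          range K (λ _ → θ ^ K * H)  ≤⟨ range-mono K (λ ℓ ℓ<K → ≤-trans (*-monoʳ H 0≤H (θ^-antitone (ℕ.<⇒≤ ℓ<K))) (≤-trans (∑-flow≥ ℓ (ℕ.<⇒≤ ℓ<K)) (∑-flow≤ ℓ))) ⟩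
          range K (λ ℓ → sum (λ r → dot (level r (suc ℓ)) (W ⊛ level r ℓ)))        ≡⟨ sym (∑-range K (λ r ℓ → dot (level r (suc ℓ)) (W ⊛ level r ℓ))) ⟩
          sum (λ r → E r)  ∎
        per-root : ∀ r → γ * γ * (4ℚ * n * E r) ≤ γ * γ * (n * (b - 1ℚ) * (ι (suc K) * D ^ K)) + 4ℚ * (n * D ^ suc K)
        per-root r = begin
          γ * γ * (4ℚ * n * E r)
            ≤⟨ *-monoˡ (γ * γ) (0≤-square γ) (levels-test W W-sym 0≤W b (≤-trans 0≤1 1≤b) rayleigh (level r) K (0≤level r)
                 (λ k ℓ k<ℓ ℓ≤K → level-disjoint r k ℓ k<ℓ (ℕ.m≤n⇒m≤1+n ℓ≤K))) ⟩
          γ * γ * (n * (b - 1ℚ) * range (suc K) (normSq ∘ level r) + s * s)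
            ≡⟨ *-distribˡ-+ (γ * γ) (n * (b - 1ℚ) * range (suc K) (normSq ∘ level r)) (s * s) ⟩
          γ * γ * (n * (b - 1ℚ) * range (suc K) (normSq ∘ level r)) + γ * γ * (s * s)
            ≤⟨ +-mono-≤ (*-monoˡ (γ * γ) (0≤-square γ) (*-monoˡ (n * (b - 1ℚ)) (0≤* 0≤n (0≤Δ 1≤b)) norms)) (range-levelSum²≤ r) ⟩
          γ * γ * (n * (b - 1ℚ) * (ι (suc K) * D ^ K)) + 4ℚ * (n * D ^ suc K) ∎
          where
          s = range (suc K) (levelSum r)
          norms : range (suc K) (normSq ∘ level r) ≤ ι (suc K) * D ^ K
          norms = ≤-trans (range-mono (suc K) (λ ℓ ℓ<1+K → ≤-trans (normSq-level≤ r ℓ (ℕ.<⇒≤ ℓ<1+K)) (D^-monotone (ℕ.≤-pred ℓ<1+K))))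
            (≤-reflexive (range-const (suc K) (D ^ K)))

-- Rational square roots, bounds for powers, and the closing numerical contradiction.

module Estimates where

  open Rationals

  -- Unlike `ι` this unfolds, so that the ring solver can compute with the constants; `κ` is its
  -- counterpart in the solver's syntax.
  lit : ℕ → ℚ
  lit n = ℤ.+ n / 1

  0≤lit : ∀ n → 0ℚ ≤ lit n
  0≤lit n = subst (0ℚ ≤_) (ι-def n) (0≤ι n)

  κ : ∀ {n} → ℕ → Polynomial n
  κ k = con (lit k)

  -- Linear search on a grid of width `h`; the last hypothesis says that the fuel suffices to pass
  -- the root.
  sqrt-search : ∀ w h fuel g → 0ℚ < h → 0ℚ ≤ g → g * g ≤ w → w < (g + ι fuel * h) * (g + ι fuel * h) →
    ∃[ r ] 0ℚ ≤ r × r * r ≤ w × w ≤ (r + h) * (r + h)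
  sqrt-search w h zero g 0<h 0≤g g²≤w w< = contradiction (<-≤-trans w< (subst (_≤ w) (sym (cong (λ z → z * z)
    (trans (cong (λ z → g + z * h) (ι-def 0)) (trans (cong (g +_) (*-zeroˡ h)) (+-identityʳ g))))) g²≤w)) (<-irrefl refl)
  sqrt-search w h (suc fuel) g 0<h 0≤g g²≤w w< with w ≤? (g + h) * (g + h)
  ... | yes w≤ = g , 0≤g , g²≤w , w≤
  ... | no w≰ = sqrt-search w h fuel (g + h) 0<h (0≤+ 0≤g (<⇒≤ 0<h)) (<⇒≤ (≰⇒> w≰))
    (subst (λ z → w < z * z) (trans (cong (λ z → g + z * h) (ι-suc fuel)) (solve 3 (λ g k h → g :+ (con 1ℚ :+ k) :* h := g :+ h :+ k :* h) refl g (ι fuel) h)) w<)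

  -- The root is produced before `0ℚ ≤ w` is supplied, so it depends on `ε` and `w` alone and a
  -- symmetric weight matrix has symmetric roots.
  sqrt-approx : ∀ ε → 0ℚ < ε → ∀ w → ∃[ r ] 0ℚ ≤ r × (0ℚ ≤ w → r * r ≤ w × w ≤ r * r + ε)
  sqrt-approx ε 0<ε w with 0ℚ ≤? w
  ... | no w≱0 = 0ℚ , ≤-refl , λ 0≤w → contradiction 0≤w w≱0
  ... | yes 0≤w = r , 0≤r , λ _ → r²≤w , w≤r²+ε
    where
    -- The step is h = ε / a. As `r ≤ 1 + w` and `h ≤ 1`, enlarging the root by `h` raises its
    -- square by at most h (3 + 2 w), which is at most `ε`.
    a = lit 3 + lit 2 * w + ε
    0<3+2w : 0ℚ < lit 3 + lit 2 * w
    0<3+2w = +-mono-<-≤ {0ℚ} {lit 3} {0ℚ} (*<* (ℤ.+<+ (s≤s z≤n))) (0≤* (0≤lit 2) 0≤w)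
    0<a : 0ℚ < a
    0<a = +-mono-< 0<3+2w 0<ε
    a⁻¹ = inverse a 0<a
    i = proj₁ a⁻¹
    0<i = proj₁ (proj₂ a⁻¹)
    ai≡1 = proj₂ (proj₂ a⁻¹)
    h = ε * i
    0<h : 0ℚ < h
    0<h = 0<* 0<ε 0<i
    h≤1 : h ≤ 1ℚ
    h≤1 = ≤-by ((lit 3 + lit 2 * w) * i) (0≤* (<⇒≤ 0<3+2w) (<⇒≤ 0<i)) (trans (sym ai≡1)
      (solve 3 (λ w e i → (κ 3 :+ κ 2 :* w :+ e) :* i := e :* i :+ (κ 3 :+ κ 2 :* w) :* i) refl w ε i))
    hb≤ε : h * (lit 3 + lit 2 * w) ≤ ε
    hb≤ε = ≤-by (ε * h) (0≤* (<⇒≤ 0<ε) (<⇒≤ 0<h)) (trans (sym (*-identityʳ ε)) (trans (cong (ε *_) (sym ai≡1))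
      (solve 3 (λ w e i → e :* ((κ 3 :+ κ 2 :* w :+ e) :* i) := e :* i :* (κ 3 :+ κ 2 :* w) :+ e :* (e :* i)) refl w ε i)))
    h⁻¹ = inverse h 0<h
    -- That many steps of width `h` reach `1 + w`, whose square exceeds `w`.
    fuel = archimedean ((1ℚ + w) * proj₁ h⁻¹)
    F = proj₁ fuel
    1+w≤Fh : 1ℚ + w ≤ ι F * h
    1+w≤Fh = ≤-trans (≤-reflexive (trans (sym (*-identityʳ (1ℚ + w))) (trans (cong ((1ℚ + w) *_) (sym (proj₂ (proj₂ h⁻¹))))
      (solve 3 (λ w h i → w :* (h :* i) := w :* i :* h) refl (1ℚ + w) h (proj₁ h⁻¹))))) (*-monoʳ h (<⇒≤ 0<h) (proj₂ fuel))
    0≤1+w : 0ℚ ≤ 1ℚ + w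
    0≤1+w = 0≤+ 0≤1 0≤w
    w<[1+w]² : w < (1ℚ + w) * (1ℚ + w)
    w<[1+w]² = <-by (1ℚ + w + w * w) (+-mono-<-≤ {0ℚ} {1ℚ + w} {0ℚ} (+-mono-<-≤ {0ℚ} {1ℚ} {0ℚ} 0<1 0≤w) (0≤-square w))
      (solve 1 (λ w → (con 1ℚ :+ w) :* (con 1ℚ :+ w) := w :+ (con 1ℚ :+ w :+ w :* w)) refl w)
    search = sqrt-search w h F 0ℚ 0<h ≤-refl 0≤w
      (subst (λ z → w < z * z) (sym (+-identityˡ (ι F * h))) (<-≤-trans w<[1+w]² (*-mono 0≤1+w 1+w≤Fh 0≤1+w 1+w≤Fh)))
    r = proj₁ search
    0≤r = proj₁ (proj₂ search)
    r²≤w = proj₁ (proj₂ (proj₂ search))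
    r≤1+w : r ≤ 1ℚ + w
    r≤1+w = square-≤⁻¹ 0≤1+w (≤-trans r²≤w (<⇒≤ w<[1+w]²))
    w≤r²+ε : w ≤ r * r + ε
    w≤r²+ε = ≤-by (((r + h) * (r + h) - w) + lit 2 * (h * (1ℚ + w - r)) + h * (1ℚ - h) + (ε - h * (lit 3 + lit 2 * w)))
      (0≤+ (0≤+ (0≤+ (0≤Δ (proj₂ (proj₂ (proj₂ search)))) (0≤* (0≤lit 2) (0≤* (<⇒≤ 0<h) (0≤Δ r≤1+w))))
                (0≤* (<⇒≤ 0<h) (0≤Δ h≤1))) (0≤Δ hb≤ε))
      (solve 4 (λ r h w e → r :* r :+ e := w :+ (((r :+ h) :* (r :+ h) :- w) :+ κ 2 :* (h :* (con 1ℚ :+ w :- r)) :+ h :* (con 1ℚ :- h)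
         :+ (e :- h :* (κ 3 :+ κ 2 :* w)))) refl r h w ε)

  bernoulli : ∀ z k → 0ℚ ≤ z → z ≤ 1ℚ → 1ℚ - ι k * z ≤ (1ℚ - z) ^ k
  bernoulli z zero 0≤z z≤1 = ≤-reflexive (trans (cong (λ t → 1ℚ - t * z) (ι-def 0)) (solve 1 (λ z → con 1ℚ :- con 0ℚ :* z := con 1ℚ) refl z))
  bernoulli z (suc k) 0≤z z≤1 = ≤-trans (≤-by (ι k * (z * z)) (0≤* (0≤ι k) (0≤-square z))
    (trans (solve 2 (λ k z → (con 1ℚ :- z) :* (con 1ℚ :- k :* z) := (con 1ℚ :- (con 1ℚ :+ k) :* z) :+ k :* (z :* z)) refl (ι k) z)
      (cong (λ t → 1ℚ - t * z + ι k * (z * z)) (sym (ι-suc k)))))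
    (*-monoˡ (1ℚ - z) (0≤Δ z≤1) (bernoulli z k 0≤z z≤1))

  ^≤1+2kz : ∀ z k → 0ℚ ≤ z → lit 2 * (ι k * z) ≤ 1ℚ → (1ℚ + z) ^ k ≤ 1ℚ + lit 2 * (ι k * z)
  ^≤1+2kz z zero 0≤z _ = ≤-reflexive (sym (trans (cong (λ t → 1ℚ + lit 2 * (t * z)) (ι-def 0)) (solve 1 (λ z → con 1ℚ :+ κ 2 :* (con 0ℚ :* z) := con 1ℚ) refl z)))
  ^≤1+2kz z (suc k) 0≤z h = ≤-trans (*-monoˡ (1ℚ + z) (0≤+ 0≤1 0≤z) (^≤1+2kz z k 0≤z h′))
    (≤-by (z * (1ℚ - lit 2 * (ι k * z))) (0≤* 0≤z (0≤Δ h′))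
      (trans (cong (λ t → 1ℚ + lit 2 * (t * z)) (ι-suc k))
        (solve 2 (λ k z → con 1ℚ :+ κ 2 :* ((con 1ℚ :+ k) :* z) := (con 1ℚ :+ z) :* (con 1ℚ :+ κ 2 :* (k :* z)) :+ z :* (con 1ℚ :- κ 2 :* (k :* z))) refl (ι k) z)))
    where
    h′ : lit 2 * (ι k * z) ≤ 1ℚ
    h′ = ≤-trans (*-monoˡ (lit 2) (*≤* (ℤ.+≤+ z≤n)) (*-monoʳ z 0≤z (ι-mono (ℕ.n≤1+n k)))) h

  -- The terms 4 ν cancel, and constants decide. Having k = ν - 3 costs 12 on the left, the level
  -- sums put 64 on the right, and `lit 100 * y * ν` takes 100 off the right. The margin of 24
  -- covers all terms that vanish with `y`.
  final-contradiction : ∀ ν y k → 0ℚ < y → lit 2 * y ≤ 1ℚ → ν * y ≡ 1ℚ → k + lit 3 ≡ ν → 0ℚ ≤ k →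
    lit 4 * (k * ((1ℚ - lit 6 * (y * y)) * (1ℚ - lit 3 * (y * y * (y * y) * y)))) ≤
      (lit 4 - lit 100 * y) * ν * (1ℚ + lit 8 * (y * y * y)) + lit 64 * (1ℚ + lit 8 * (y * y * y)) → ⊥
  final-contradiction ν y k 0<y 2y≤1 νy≡1 k+3≡ν 0≤k h = <-irrefl refl (<-≤-trans strict h)
    where
    y² = y * y
    0≤y = <⇒≤ 0<y
    0≤u : 0ℚ ≤ 1ℚ - lit 2 * y
    0≤u = 0≤Δ 2y≤1
    y³ = y * y * y
    y⁷ = y * y * y * y * (y * y * y)
    0≤y³ : 0ℚ ≤ y³
    0≤y³ = 0≤* (0≤-square y) 0≤y
    L = lit 4 * (k * ((1ℚ - lit 6 * (y * y)) * (1ℚ - lit 3 * (y * y * (y * y) * y))))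
    R = (lit 4 - lit 100 * y) * ν * (1ℚ + lit 8 * (y * y * y)) + lit 64 * (1ℚ + lit 8 * (y * y * y))
    k≡ : k ≡ ν - lit 3
    k≡ = trans (solve 1 (λ k → k := k :+ κ 3 :- κ 3) refl k) (cong (λ z → z - lit 3) k+3≡ν)
    ky≡ : k * y ≡ 1ℚ - lit 3 * y
    ky≡ = trans (cong (_* y) k≡) (trans (solve 2 (λ n y → (n :- κ 3) :* y := n :* y :- κ 3 :* y) refl ν y) (cong (λ z → z - lit 3 * y) νy≡1))
    R≡ : R ≡ lit 4 * ν + 1ℚ * (lit 32 * y² - lit 100 - lit 800 * y³) + lit 64 + lit 512 * y³
    R≡ = trans (solve 2 (λ n y → (κ 4 :- κ 100 :* y) :* n :* (con 1ℚ :+ κ 8 :* (y :* y :* y)) :+ κ 64 :* (con 1ℚ :+ κ 8 :* (y :* y :* y))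
        := κ 4 :* n :+ n :* y :* (κ 32 :* (y :* y) :- κ 100 :- κ 800 :* (y :* y :* y)) :+ κ 64 :+ κ 512 :* (y :* y :* y)) refl ν y)
      (cong (λ z → lit 4 * ν + z * (lit 32 * y² - lit 100 - lit 800 * y³) + lit 64 + lit 512 * y³) νy≡1)
    L≡ : L ≡ lit 4 * (ν - lit 3) - (1ℚ - lit 3 * y) * (lit 24 * y + lit 12 * (y² * y²)) + lit 72 * (k * y⁷)
    L≡ = trans (solve 2 (λ k y → κ 4 :* (k :* ((con 1ℚ :- κ 6 :* (y :* y)) :* (con 1ℚ :- κ 3 :* (y :* y :* (y :* y) :* y))))
        := κ 4 :* k :- k :* y :* (κ 24 :* y :+ κ 12 :* (y :* y :* (y :* y))) :+ κ 72 :* (k :* (y :* y :* y :* y :* (y :* y :* y)))) refl k y)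
      (cong₂ (λ a b → lit 4 * a - b * (lit 24 * y + lit 12 * (y² * y²)) + lit 72 * (k * y⁷)) k≡ ky≡)
    rest = lit 23 - lit 24 * y - lit 12 * (y² * y²) - lit 32 * y²
    0≤rest : 0ℚ ≤ rest
    0≤rest = subst (0ℚ ≤_) (solve 1 (λ y → κ 2 :+ κ 12 :* (con 1ℚ :- κ 2 :* y) :+ κ 8 :* ((con 1ℚ :- κ 2 :* y) :* (con 1ℚ :+ κ 2 :* y))
        :+ (con 1ℚ :- κ 2 :* y) :* (con 1ℚ :+ κ 2 :* y) :* (con 1ℚ :+ κ 4 :* (y :* y)) :+ κ 4 :* (y :* y :* (y :* y))
        := κ 23 :- κ 24 :* y :- κ 12 :* (y :* y :* (y :* y)) :- κ 32 :* (y :* y)) refl y)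
      (0≤+ (0≤+ (0≤+ (0≤+ (0≤lit 2) (0≤* (0≤lit 12) 0≤u)) (0≤* (0≤lit 8) (0≤* 0≤u 0≤v))) (0≤* (0≤* 0≤u 0≤v) (0≤+ 0≤1 (0≤* (0≤lit 4) (0≤-square y))))) (0≤* (0≤lit 4) (0≤-square y²)))
      where
      0≤v : 0ℚ ≤ 1ℚ + lit 2 * y
      0≤v = 0≤+ 0≤1 (0≤* (0≤lit 2) 0≤y)
    gap = 1ℚ + (rest + (lit 288 * y³ + lit 72 * y² + lit 36 * (y² * y³) + lit 72 * (k * y⁷)))
    0<gap : 0ℚ < gap
    0<gap = +-mono-<-≤ {0ℚ} {1ℚ} {0ℚ} 0<1 (0≤+ 0≤rest (0≤+ (0≤+ (0≤+ (0≤* (0≤lit 288) 0≤y³) (0≤* (0≤lit 72) (0≤-square y)))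
      (0≤* (0≤lit 36) (0≤* (0≤-square y) 0≤y³))) (0≤* (0≤lit 72) (0≤* 0≤k (0≤* (0≤* 0≤y³ 0≤y) 0≤y³)))))
    strict : R < L
    strict = <-by gap 0<gap (trans L≡ (trans (solve 3 (λ n y k →
        let y² = y :* y ; y³ = y :* y :* y ; y⁷ = y :* y :* y :* y :* (y :* y :* y) in
        κ 4 :* (n :- κ 3) :- (con 1ℚ :- κ 3 :* y) :* (κ 24 :* y :+ κ 12 :* (y² :* y²)) :+ κ 72 :* (k :* y⁷)
        := (κ 4 :* n :+ con 1ℚ :* (κ 32 :* y² :- κ 100 :- κ 800 :* y³) :+ κ 64 :+ κ 512 :* y³)
           :+ (con 1ℚ :+ ((κ 23 :- κ 24 :* y :- κ 12 :* (y² :* y²) :- κ 32 :* y²)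
               :+ (κ 288 :* y³ :+ κ 72 :* y² :+ κ 36 :* (y² :* y³) :+ κ 72 :* (k :* y⁷))))) refl ν y k)
      (cong (_+ gap) (sym R≡))))

-- The path estimate applied to a graph whose spectrum is scaled to start at 1.

module GapEstimate where

  open Rationals
  open R using (WeightedGraph; HasCycle)
  open Determinants using (Mat)
  open QuadraticForms
  open Descent using (∑-δ-row)
  open RayleighBounds using (lap; lap-⊛)
  open ListSums using (out; ∑-out≥)
  open LevelTest
  open WeightedPaths
  open Estimates

  adjacency : ∀ {n} (G : WeightedGraph n) → Mat n
  adjacency G u v = if does (WeightedGraph._∼?_ G u v) then 1ℚ else 0ℚ

  dot-δ : ∀ {n} (u : Fin n) x → dot (δ u) x ≡ x u
  dot-δ u x = ∑-δ x u

  -- Read `y` as d^(-1/8), with λ₂ scaled to 1. Then `n-large` says n ≥ d^(5/8), `edges` says that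
  -- the average degree is at most y^(-8), and `b-small` is the violated bound, λₙ ≤ 1 + 4/√d -
  -- 100/d^(5/8).
  module Contradiction {m} (G : WeightedGraph (suc (suc m))) (W : Mat (suc (suc m)))
    (W-sym : Sym W) (0≤W : ∀ u v → 0ℚ ≤ W u v) (W-edge : ∀ u v → ¬ WeightedGraph._∼_ G u v → W u v ≡ 0ℚ)
    (K : ℕ) (acyclic : ∀ k → k ℕ.≤ suc K ℕ.+ suc K → ¬ HasCycle G k)
    (b : ℚ) (rayleigh : ∀ x → sum x ≡ 0ℚ → normSq x ≤ quad (lap W) x × quad (lap W) x ≤ b * normSq x)
    (y : ℚ) (0<y : 0ℚ < y) (12y≤1 : lit 12 * y ≤ 1ℚ) (νy≡1 : ι (3 ℕ.+ K) * y ≡ 1ℚ)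
    (n-large : 1ℚ ≤ ι (suc (suc m)) * (y * y * (y * y) * y))
    (edges : sum (λ u → sum (adjacency G u)) * (y * y * (y * y) * (y * y * (y * y))) ≤ ι (suc (suc m)))
    (b-small : b - 1ℚ ≤ (lit 4 - lit 100 * y) * (y * y * (y * y))) where

    open WeightedGraph G using (_∼?_; ∼-irrefl)

    private
      n = ι (suc (suc m))
      ν = ι (3 ℕ.+ K)
      V = Fin (suc (suc m))
      0<n : 0ℚ < n
      0<n = 0<ι-suc (suc m)
      0≤n : 0ℚ ≤ n
      0≤n = <⇒≤ 0<n
      0≤y : 0ℚ ≤ y
      0≤y = <⇒≤ 0<y
      0≤ν : 0ℚ ≤ ν
      0≤ν = 0≤ι (3 ℕ.+ K)
      y³ = y * y * y
      y⁴ = y * y * (y * y)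
      y⁵ = y⁴ * y
      0≤y³ : 0ℚ ≤ y³
      0≤y³ = 0≤* (0≤-square y) 0≤y
      0≤y⁴ : 0ℚ ≤ y⁴
      0≤y⁴ = 0≤-square (y * y)
      0≤y⁵ : 0ℚ ≤ y⁵
      0≤y⁵ = 0≤* 0≤y⁴ 0≤y
      0≤1-12y : 0ℚ ≤ 1ℚ - lit 12 * y
      0≤1-12y = 0≤Δ 12y≤1
      y≤1 : y ≤ 1ℚ
      y≤1 = ≤-by ((1ℚ - lit 12 * y) + lit 11 * y) (0≤+ 0≤1-12y (0≤* (0≤lit 11) 0≤y))
        (solve 1 (λ y → con 1ℚ := y :+ ((con 1ℚ :- κ 12 :* y) :+ κ 11 :* y)) refl y)
      2y≤1 : lit 2 * y ≤ 1ℚ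
      2y≤1 = ≤-by ((1ℚ - lit 12 * y) + lit 10 * y) (0≤+ 0≤1-12y (0≤* (0≤lit 10) 0≤y))
        (solve 1 (λ y → con 1ℚ := κ 2 :* y :+ ((con 1ℚ :- κ 12 :* y) :+ κ 10 :* y)) refl y)
      y²≤y : y * y ≤ y
      y²≤y = ≤-trans (*-monoˡ y 0≤y y≤1) (≤-reflexive (*-identityʳ y))
      y³≤y : y³ ≤ y
      y³≤y = ≤-trans (*-monoʳ y 0≤y (≤-trans y²≤y y≤1)) (≤-reflexive (*-identityˡ y))
      y⁵≤y³ : y⁵ ≤ y³
      y⁵≤y³ = ≤-by (y³ * (1ℚ - y * y)) (0≤* 0≤y³ (0≤Δ (≤-trans y²≤y y≤1)))
        (solve 1 (λ y → y :* y :* y := y :* y :* (y :* y) :* y :+ y :* y :* y :* (con 1ℚ :- y :* y)) refl y)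
      6y³≤½ : lit 6 * y³ ≤ ½
      6y³≤½ = ≤-trans (*-monoˡ (lit 6) (0≤lit 6) y³≤y) (≤-by (½ * (1ℚ - lit 12 * y)) (0≤* 0≤½ 0≤1-12y)
        (solve 1 (λ y → con ½ := κ 6 :* y :+ con ½ :* (con 1ℚ :- κ 12 :* y)) refl y))

      1≤b : 1ℚ ≤ b
      1≤b = *-cancelʳ-≤ (normSq x) 0<normSq (≤-trans (≤-reflexive (*-identityˡ (normSq x))) (≤-trans (proj₁ (rayleigh x x⊥1)) (proj₂ (rayleigh x x⊥1))))
        where
        x : Vect (suc (suc m))
        x v = δ zero v - δ (suc zero) v
        x⊥1 : sum x ≡ 0ℚ
        x⊥1 = trans (∑-distrib-- (δ {suc (suc m)} zero) (δ (suc zero))) (cong₂ _-_ (∑-δ-row {suc (suc m)} zero) (∑-δ-row {suc (suc m)} (suc zero)))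
        0<normSq : 0ℚ < normSq x
        0<normSq = <-≤-trans 0<1 (term≤∑ (λ v → 0≤-square (x v)) zero)
      0≤b : 0ℚ ≤ b
      0≤b = ≤-trans 0≤1 1≤b
      b≤ : b ≤ 1ℚ + lit 4 * y⁴
      b≤ = ≤-by (((lit 4 - lit 100 * y) * y⁴ - (b - 1ℚ)) + lit 100 * y⁵) (0≤+ (0≤Δ b-small) (0≤* (0≤lit 100) 0≤y⁵))
        (solve 2 (λ b y → con 1ℚ :+ κ 4 :* (y :* y :* (y :* y)) := b :+ (((κ 4 :- κ 100 :* y) :* (y :* y :* (y :* y)) :- (b :- con 1ℚ)) :+ κ 100 :* (y :* y :* (y :* y) :* y))) refl b y)

      η = proj₁ (inverse n 0<n)
      0<η : 0ℚ < η
      0<η = proj₁ (proj₂ (inverse n 0<n))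
      nη≡1 : n * η ≡ 1ℚ
      nη≡1 = proj₂ (proj₂ (inverse n 0<n))
      η≤y⁵ : η ≤ y⁵
      η≤y⁵ = *-cancelˡ-≤ n 0<n (≤-trans (≤-reflexive nη≡1) n-large)

      W-loop : ∀ u → W u u ≡ 0ℚ
      W-loop u = W-edge u u (∼-irrefl refl)

      quad-δ : ∀ u → quad (lap W) (δ u) ≡ sum (W u)
      quad-δ u = trans (dot-δ u (lap W ⊛ δ u)) (trans (lap-⊛ W (δ u) u) (trans
        (cong₂ (λ d w → sum (W u) * d + - 1ℚ * w) (δ-refl u) (trans (dot-comm (W u) (δ u)) (trans (dot-δ u (W u)) (W-loop u))))
        (solve 1 (λ s → s :* con 1ℚ :+ con (- 1ℚ) :* con 0ℚ := s) refl (sum (W u)))))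

      normSq-δ : ∀ u → normSq (δ {suc (suc m)} u) ≡ 1ℚ
      normSq-δ u = trans (dot-δ u (δ u)) (δ-refl u)

      centred-δ : ∀ u → n * 1ℚ - 1ℚ * 1ℚ ≤ n * sum (W u) × n * sum (W u) ≤ b * (n * 1ℚ - 1ℚ * 1ℚ)
      centred-δ u = subst (λ q → n * 1ℚ - 1ℚ * 1ℚ ≤ n * q × n * q ≤ b * (n * 1ℚ - 1ℚ * 1ℚ)) (quad-δ u)
        (subst₂ (λ p s → n * p - s * s ≤ n * quad (lap W) (δ u) × n * quad (lap W) (δ u) ≤ b * (n * p - s * s)) (normSq-δ u) (∑-δ-row u)
          (centred W W-sym 0≤W b 0≤b rayleigh (δ u)))

      degree≥ : ∀ u → 1ℚ - η ≤ sum (W u)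
      degree≥ u = *-cancelˡ-≤ n 0<n (≤-trans (≤-reflexive (trans (solve 2 (λ n e → n :* (con 1ℚ :- e) := n :* con 1ℚ :- n :* e) refl n η)
        (cong (λ z → n * 1ℚ - z) nη≡1))) (proj₁ (centred-δ u)))

      degree≤ : ∀ u → sum (W u) ≤ b
      degree≤ u = *-cancelˡ-≤ n 0<n (≤-trans (proj₂ (centred-δ u)) (≤-by b 0≤b (solve 2 (λ n b → n :* b := b :* (n :* con 1ℚ :- con 1ℚ :* con 1ℚ) :+ b) refl n b)))

      -- `disjoint-test` at two point masses gives 4 n w ≤ 2 n (b - 1) + 4, that is w ≤ (b - 1)/2 +
      -- 1/n.
      W≤ : ∀ u v → W u v ≤ lit 3 * y⁴
      W≤ u v with u Fin.≟ v
      ... | yes refl = ≤-trans (≤-reflexive (W-loop u)) (0≤* (0≤lit 3) 0≤y⁴)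
      ... | no u≢v = *-cancelˡ-≤ (4ℚ * n) (0<* {4ℚ} (*<* (ℤ.+<+ (s≤s z≤n))) 0<n) (begin
        4ℚ * n * W u v
          ≡⟨ cong (4ℚ * n *_) (sym (trans (dot-δ u (W ⊛ δ v)) (trans (dot-comm (W u) (δ v)) (dot-δ v (W u))))) ⟩
        4ℚ * n * dot (δ u) (W ⊛ δ v)
          ≤⟨ disjoint-test W W-sym 0≤W b 0≤b rayleigh (δ u) (δ v) disjoint ⟩
        n * (b - 1ℚ) * (normSq (δ u) + normSq (δ v)) + (sum (δ u) + sum (δ v)) * (sum (δ u) + sum (δ v))
          ≡⟨ cong₂ (λ p q → n * (b - 1ℚ) * p + q * q) (cong₂ _+_ (normSq-δ u) (normSq-δ v)) (cong₂ _+_ (∑-δ-row u) (∑-δ-row v)) ⟩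
        n * (b - 1ℚ) * (1ℚ + 1ℚ) + (1ℚ + 1ℚ) * (1ℚ + 1ℚ)
          ≤⟨ ≤-by (lit 2 * n * ((lit 4 - lit 100 * y) * y⁴ - (b - 1ℚ)) + lit 4 * (n * y⁵ - 1ℚ) + n * (lit 4 * y⁴ + lit 196 * y⁵))
               (0≤+ (0≤+ (0≤* (0≤* (0≤lit 2) 0≤n) (0≤Δ b-small)) (0≤* (0≤lit 4) (0≤Δ n-large))) (0≤* 0≤n (0≤+ (0≤* (0≤lit 4) 0≤y⁴) (0≤* (0≤lit 196) 0≤y⁵))))
               (solve 3 (λ n b y → let y⁴ = y :* y :* (y :* y) in
                 con 4ℚ :* n :* (κ 3 :* y⁴) := n :* (b :- con 1ℚ) :* (con 1ℚ :+ con 1ℚ) :+ (con 1ℚ :+ con 1ℚ) :* (con 1ℚ :+ con 1ℚ)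
                 :+ (κ 2 :* n :* ((κ 4 :- κ 100 :* y) :* y⁴ :- (b :- con 1ℚ)) :+ κ 4 :* (n :* (y⁴ :* y) :- con 1ℚ) :+ n :* (κ 4 :* y⁴ :+ κ 196 :* (y⁴ :* y)))) refl n b y) ⟩
        4ℚ * n * (lit 3 * y⁴) ∎)
        where
        open ≤-Reasoning
        disjoint : ∀ w → δ u w * δ v w ≡ 0ℚ
        disjoint w with u Fin.≟ w
        ... | yes refl = trans (*-identityˡ (δ v u)) (δ-≢ (u≢v ∘ sym))
        ... | no _ = *-zeroˡ (δ v w)

      -- With this accuracy the `n` errors in one row add up to `η`, which is 1/n.
      ε = η * η
      0<ε : 0ℚ < ε
      0<ε = 0<* 0<η 0<η
      g : Mat (suc (suc m))
      g u v = proj₁ (sqrt-approx ε 0<ε (W u v))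
      0≤g : ∀ u v → 0ℚ ≤ g u v
      0≤g u v = proj₁ (proj₂ (sqrt-approx ε 0<ε (W u v)))
      g²≤W : ∀ u v → g u v * g u v ≤ W u v
      g²≤W u v = proj₁ (proj₂ (proj₂ (sqrt-approx ε 0<ε (W u v))) (0≤W u v))
      W≤g²+ε : ∀ u v → W u v ≤ g u v * g u v + ε
      W≤g²+ε u v = proj₂ (proj₂ (proj₂ (sqrt-approx ε 0<ε (W u v))) (0≤W u v))
      g-sym : Sym g
      g-sym u v = cong (λ w → proj₁ (sqrt-approx ε 0<ε w)) (W-sym u v)
      g-edge : ∀ u v → ¬ WeightedGraph._∼_ G u v → g u v ≡ 0ℚ
      g-edge u v u≁v = p*p≡0 (g u v) (≤-antisym (≤-trans (g²≤W u v) (≤-reflexive (W-edge u v u≁v))) (0≤-square (g u v)))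

      g² : V → V → ℚ
      g² u v = g u v * g u v
      g²≤4y⁴ : ∀ u v → g² u v ≤ lit 4 * y⁴
      g²≤4y⁴ u v = ≤-trans (g²≤W u v) (≤-trans (W≤ u v) (≤-by y⁴ 0≤y⁴ (solve 1 (λ y → κ 4 :* y := κ 3 :* y :+ y) refl y⁴)))
      ḡ = lit 2 * (y * y)
      g≤ḡ : ∀ u v → g u v ≤ ḡ
      g≤ḡ u v = square-≤⁻¹ (0≤* (0≤lit 2) (0≤-square y)) (≤-trans (g²≤4y⁴ u v) (≤-reflexive
        (solve 1 (λ y → κ 4 :* (y :* y :* (y :* y)) := κ 2 :* (y :* y) :* (κ 2 :* (y :* y))) refl y)))

      D = 1ℚ + lit 4 * y⁴
      1≤D : 1ℚ ≤ D
      1≤D = ≤-by (lit 4 * y⁴) (0≤* (0≤lit 4) 0≤y⁴) refl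
      ∑g²≤D : ∀ v → sum (g² v) ≤ D
      ∑g²≤D v = ≤-trans (∑-mono (g²≤W v)) (≤-trans (degree≤ v) b≤)
      ∑g²≥ : ∀ v → 1ℚ - lit 2 * η ≤ sum (g² v)
      ∑g²≥ v = ≤-by ((sum (W v) - (1ℚ - η)) + (sum (g² v) + η - sum (W v)))
        (0≤+ (0≤Δ (degree≥ v)) (0≤Δ (≤-trans (∑-mono (W≤g²+ε v)) (≤-reflexive (trans (∑-distrib-+ (g² v) (λ _ → ε)) (cong (sum (g² v) +_)
          (trans (∑-const (suc (suc m)) ε) (trans (sym (*-assoc n η η)) (trans (cong (_* η) nη≡1) (*-identityˡ η))))))))))
        (solve 3 (λ w s e → s := con 1ℚ :- κ 2 :* e :+ ((w :- (con 1ℚ :- e)) :+ (s :+ e :- w))) refl (sum (W v)) (sum (g² v)) η)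

      -- The 6 is 2 + 4: a row sum of g² is short of 1 by at most 2 η ≤ 2 y³, and excluding at most
      -- ν vertices of weight at most 4 y⁴ costs 4 y³, because ν y = 1.
      θ = 1ℚ - lit 6 * y³
      ½≤θ : ½ ≤ θ
      ½≤θ = ≤-by (½ - lit 6 * y³) (0≤Δ 6y³≤½) (solve 1 (λ z → con 1ℚ :- z := con ½ :+ (con ½ :- z)) refl (lit 6 * y³))
      0≤6y³ : 0ℚ ≤ lit 6 * y³
      0≤6y³ = 0≤* (0≤lit 6) 0≤y³
      θ≤1 : θ ≤ 1ℚ
      θ≤1 = ≤-by (lit 6 * y³) 0≤6y³ (solve 1 (λ z → con 1ℚ := con 1ℚ :- z :+ z) refl (lit 6 * y³))
      θ≤ : ∀ v us → length us ℕ.≤ suc K → θ ≤ sum (λ z → g v z * g v z * out z us)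
      θ≤ v us ∣us∣ = ≤-trans (≤-by ((sum (g² v) - (1ℚ - lit 2 * η)) + lit 2 * (y³ - η) + lit 4 * (y³ - ι (length us) * y⁴))
        (0≤+ (0≤+ (0≤Δ (∑g²≥ v)) (0≤* (0≤lit 2) (0≤Δ (≤-trans η≤y⁵ y⁵≤y³)))) (0≤* (0≤lit 4) (0≤Δ few)))
        (solve 5 (λ s e z l w → s :- l :* (κ 4 :* w) := con 1ℚ :- κ 6 :* z :+ ((s :- (con 1ℚ :- κ 2 :* e)) :+ κ 2 :* (z :- e) :+ κ 4 :* (z :- l :* w)))
          refl (sum (g² v)) η y³ (ι (length us)) y⁴))
        (∑-out≥ (g² v) (lit 4 * y⁴) (λ z → 0≤-square (g v z)) (g²≤4y⁴ v) us)
        where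
        few : ι (length us) * y⁴ ≤ y³
        few = ≤-trans (*-monoʳ y⁴ 0≤y⁴ (ι-mono (ℕ.≤-trans ∣us∣ (ℕ.m≤n+m (suc K) 2)))) (≤-reflexive
          (trans (solve 2 (λ n y → n :* (y :* y :* (y :* y)) := n :* y :* (y :* y :* y)) refl ν y) (trans (cong (_* y³) νy≡1) (*-identityˡ y³))))

      ¼ = ½ * ½
      -- Chosen so that `γ * ḡ` equals ½, which is at most `θ`.
      γ = ¼ * (ν * ν)
      12≤ν : lit 12 ≤ ν
      12≤ν = ≤-by (ν * (1ℚ - lit 12 * y)) (0≤* 0≤ν 0≤1-12y) (trans (solve 2 (λ n y → n := κ 12 :* (n :* y) :+ n :* (con 1ℚ :- κ 12 :* y)) refl ν y)
        (cong (λ z → lit 12 * z + ν * (1ℚ - lit 12 * y)) νy≡1))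
      2≤γ : 2ℚ ≤ γ
      2≤γ = ≤-trans {2ℚ} {¼ * (lit 12 * lit 12)} (*≤* (ℤ.+≤+ (ℕ.m≤m+n 2 34))) (*-monoˡ ¼ (*≤* (ℤ.+≤+ z≤n)) (*-mono (0≤lit 12) 12≤ν (0≤lit 12) 12≤ν))
      γḡ≤θ : γ * ḡ ≤ θ
      γḡ≤θ = ≤-trans (≤-reflexive (trans (solve 2 (λ n y → con ½ :* con ½ :* (n :* n) :* (κ 2 :* (y :* y)) := con ½ :* (n :* y :* (n :* y))) refl ν y)
        (cong (λ z → ½ * (z * z)) νy≡1))) ½≤θ

      module P = PathSums G W g W-sym 0≤W g-sym 0≤g g-edge K acyclic D 1≤D ∑g²≤D θ (≤-trans {0ℚ} {½} (*≤* (ℤ.+≤+ z≤n)) ½≤θ) θ≤1 θ≤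
        ḡ (0<* {lit 2} (*<* (ℤ.+<+ (s≤s z≤n))) (0<* 0<y 0<y)) g≤ḡ γ 2≤γ γḡ≤θ

      -- The tangent line of t ↦ t³ in t², taken at t = y⁴ ≈ 1/√d: the extremal case is that of all weights equal to 1/d.
      H = sum (λ u → sum (λ v → W u v * g u v))
      E = sum (λ u → sum (adjacency G u))
      tangent : ∀ u v → lit 3 * ½ * y⁴ * g² u v + - (½ * (y⁴ * y⁴ * y⁴)) * adjacency G u v ≤ W u v * g u v
      tangent u v with u ∼? v
      ... | yes _ = ≤-by ((W u v - g² u v) * g u v + (g u v - y⁴) * (g u v - y⁴) * (g u v + ½ * y⁴))
        (0≤+ (0≤* (0≤Δ (g²≤W u v)) (0≤g u v)) (0≤* (0≤-square (g u v - y⁴)) (0≤+ (0≤g u v) (0≤* 0≤½ 0≤y⁴))))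
        (solve 3 (λ w g a → w :* g := (con (lit 3 * ½) :* a :* (g :* g) :+ (:- (con ½ :* (a :* a :* a))) :* con 1ℚ) :+ ((w :- g :* g) :* g :+ (g :- a) :* (g :- a) :* (g :+ con ½ :* a))) refl (W u v) (g u v) y⁴)
      ... | no u≁v = ≤-reflexive (trans (cong (λ z → lit 3 * ½ * y⁴ * (z * z) + - (½ * (y⁴ * y⁴ * y⁴)) * 0ℚ) (g-edge u v u≁v))
        (trans (solve 2 (λ a w → con (lit 3 * ½) :* a :* (con 0ℚ :* con 0ℚ) :+ (:- (con ½ :* (a :* a :* a))) :* con 0ℚ := w :* con 0ℚ) refl y⁴ (W u v)) (cong (W u v *_) (sym (g-edge u v u≁v)))))
      -- Summed over all pairs, the tangent lines give (3/2) y⁴ times the sum of g², which is at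
      -- least n (1 - 2 η), minus (1/2) y¹² for every ordered adjacent pair. By `edges` the second
      -- part is at most (1/2) y⁴ n, so n y⁴ (1 - 3 η) remains.
      H≥ : n * (y⁴ * (1ℚ - lit 3 * y⁵)) ≤ H
      H≥ = begin
        n * (y⁴ * (1ℚ - lit 3 * y⁵))
          ≤⟨ ≤-by (n * y⁴ * (lit 3 * (y⁵ - η)) + lit 3 * ½ * y⁴ * (S - n * (1ℚ - lit 2 * η)) + ½ * y⁴ * (n - E * (y⁴ * y⁴)))
               (0≤+ (0≤+ (0≤* (0≤* 0≤n 0≤y⁴) (0≤* (0≤lit 3) (0≤Δ η≤y⁵))) (0≤* (0≤* {lit 3 * ½} (*≤* (ℤ.+≤+ z≤n)) 0≤y⁴) (0≤Δ S≥)))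
                     (0≤* (0≤* 0≤½ 0≤y⁴) (0≤Δ edges)))
               (solve 6 (λ n a c e s d → con (lit 3 * ½) :* a :* s :+ (:- (con ½ :* (a :* a :* a))) :* d := n :* (a :* (con 1ℚ :- κ 3 :* c)) :+
                 (n :* a :* (κ 3 :* (c :- e)) :+ con (lit 3 * ½) :* a :* (s :- n :* (con 1ℚ :- κ 2 :* e)) :+ con ½ :* a :* (n :- d :* (a :* a)))) refl n y⁴ y⁵ η S E) ⟩
        lit 3 * ½ * y⁴ * S + - (½ * (y⁴ * y⁴ * y⁴)) * E
          ≡⟨ sym (trans (sum-cong-≗ (λ u → ∑-linear (lit 3 * ½ * y⁴) (- (½ * (y⁴ * y⁴ * y⁴))) (g² u) (adjacency G u)))
               (∑-linear (lit 3 * ½ * y⁴) (- (½ * (y⁴ * y⁴ * y⁴))) (λ u → sum (g² u)) (λ u → sum (adjacency G u)))) ⟩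
        sum (λ u → sum (λ v → lit 3 * ½ * y⁴ * g² u v + - (½ * (y⁴ * y⁴ * y⁴)) * adjacency G u v))
          ≤⟨ ∑-mono (λ u → ∑-mono (tangent u)) ⟩
        H ∎
        where
        open ≤-Reasoning
        S = sum (λ u → sum (g² u))
        S≥ : n * (1ℚ - lit 2 * η) ≤ S
        S≥ = ≤-trans (≤-reflexive (sym (∑-const (suc (suc m)) (1ℚ - lit 2 * η)))) (∑-mono ∑g²≥)

      k = ι K
      0≤k = 0≤ι K
      k+3≡ν : k + lit 3 ≡ ν
      k+3≡ν = sym (trans (ι-+ 3 K) (trans (+-comm (ι 3) k) (cong (k +_) (ι-def 3))))
      θ^K≥ : 1ℚ - lit 6 * (y * y) ≤ θ ^ K
      θ^K≥ = ≤-trans (≤-by (lit 6 * (y * y * (1ℚ - k * y))) (0≤* (0≤lit 6) (0≤* (0≤-square y) (0≤Δ ky≤1)))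
        (solve 2 (λ k y → con 1ℚ :- k :* (κ 6 :* (y :* y :* y)) := con 1ℚ :- κ 6 :* (y :* y) :+ κ 6 :* (y :* y :* (con 1ℚ :- k :* y))) refl k y))
        (bernoulli (lit 6 * y³) K 0≤6y³ (≤-trans 6y³≤½ (*≤* (ℤ.+≤+ (s≤s z≤n)))))
        where
        ky≤1 : k * y ≤ 1ℚ
        ky≤1 = ≤-trans (*-monoʳ y 0≤y (ι-mono (ℕ.m≤n+m K 3))) (≤-reflexive νy≡1)
      D^≤ : ∀ l → l ℕ.≤ 3 ℕ.+ K → D ^ l ≤ 1ℚ + lit 8 * y³
      D^≤ l l≤ = ≤-trans (^≤1+2kz (lit 4 * y⁴) l (0≤* (0≤lit 4) 0≤y⁴) (≤-trans bound 8y³≤1)) (+-monoʳ-≤ 1ℚ bound)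
        where
        bound : lit 2 * (ι l * (lit 4 * y⁴)) ≤ lit 8 * y³
        bound = ≤-trans (≤-reflexive (solve 2 (λ l y → κ 2 :* (l :* (κ 4 :* (y :* y :* (y :* y)))) := κ 8 :* y :* y :* y :* (l :* y)) refl (ι l) y))
          (≤-trans (*-monoˡ (lit 8 * y * y * y) (0≤* (0≤* (0≤* (0≤lit 8) 0≤y) 0≤y) 0≤y) (≤-trans (*-monoʳ y 0≤y (ι-mono l≤)) (≤-reflexive νy≡1)))
            (≤-reflexive (solve 1 (λ y → κ 8 :* y :* y :* y :* con 1ℚ := κ 8 :* (y :* y :* y)) refl y)))
        8y³≤1 : lit 8 * y³ ≤ 1ℚ
        8y³≤1 = ≤-trans (*-monoˡ (lit 8) (0≤lit 8) y³≤y) (≤-by ((1ℚ - lit 12 * y) + lit 4 * y) (0≤+ 0≤1-12y (0≤* (0≤lit 4) 0≤y))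
          (solve 1 (λ y → con 1ℚ := κ 8 :* y :+ ((con 1ℚ :- κ 12 :* y) :+ κ 4 :* y)) refl y))

      [νy]⁴ : ν * y * (ν * y) * (ν * y * (ν * y)) ≡ 1ℚ
      [νy]⁴ = cong (λ z → z * z * (z * z)) νy≡1

      P₁ = (1ℚ - lit 6 * (y * y)) * (1ℚ - lit 3 * y⁵)
      Q = 1ℚ + lit 8 * y³

      0≤1-6y² : 0ℚ ≤ 1ℚ - lit 6 * (y * y)
      0≤1-6y² = 0≤Δ (≤-trans (*-monoˡ (lit 6) (0≤lit 6) y²≤y) (≤-by ((1ℚ - lit 12 * y) + lit 6 * y) (0≤+ 0≤1-12y (0≤* (0≤lit 6) 0≤y))
          (solve 1 (λ y → con 1ℚ := κ 6 :* y :+ ((con 1ℚ :- κ 12 :* y) :+ κ 6 :* y)) refl y)))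
      0≤1-3y⁵ : 0ℚ ≤ 1ℚ - lit 3 * y⁵
      0≤1-3y⁵ = 0≤Δ (≤-trans (*-monoˡ (lit 3) (0≤lit 3) (≤-trans y⁵≤y³ y³≤y)) (≤-by ((1ℚ - lit 12 * y) + lit 9 * y) (0≤+ 0≤1-12y (0≤* (0≤lit 9) 0≤y))
          (solve 1 (λ y → con 1ℚ := κ 3 :* y :+ ((con 1ℚ :- κ 12 :* y) :+ κ 9 :* y)) refl y)))

      -- As `γ * γ` is ν⁴/16 and ν y = 1, all factors y⁴ disappear and a common factor n/16 can be
      -- cancelled. The term 4 n Q of the level sums thereby becomes 64 Q.
      inequality : lit 4 * (k * P₁) ≤ (lit 4 - lit 100 * y) * ν * Q + lit 64 * Q
      inequality = *-cancelˡ-≤ (n * (¼ * ¼)) (0<* 0<n (*<* (ℤ.+<+ (s≤s z≤n)))) (begin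
        n * (¼ * ¼) * (lit 4 * (k * P₁))
          ≡⟨ trans (solve 4 (λ n k a b → n :* con (¼ * ¼) :* (κ 4 :* (k :* (a :* b))) := con 1ℚ :* (con (¼ * ¼) :* (κ 4 :* (k :* (a :* (n :* b)))))) refl n k (1ℚ - lit 6 * (y * y)) (1ℚ - lit 3 * y⁵))
               (cong (_* (¼ * ¼ * (lit 4 * (k * ((1ℚ - lit 6 * (y * y)) * (n * (1ℚ - lit 3 * y⁵))))))) (sym [νy]⁴)) ⟩
        ν * y * (ν * y) * (ν * y * (ν * y)) * (¼ * ¼ * (lit 4 * (k * ((1ℚ - lit 6 * (y * y)) * (n * (1ℚ - lit 3 * y⁵))))))
          ≡⟨ solve 6 (λ x n k a b y → x :* y :* (x :* y) :* (x :* y :* (x :* y)) :* (con (¼ * ¼) :* (κ 4 :* (k :* (a :* (n :* b)))))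
               := con ¼ :* (x :* x) :* (con ¼ :* (x :* x)) :* (con 4ℚ :* (k :* (a :* (n :* (y :* y :* (y :* y) :* b)))))) refl ν n k (1ℚ - lit 6 * (y * y)) (1ℚ - lit 3 * y⁵) y ⟩
        γ * γ * (4ℚ * (k * ((1ℚ - lit 6 * (y * y)) * (n * (y⁴ * (1ℚ - lit 3 * y⁵))))))
          ≤⟨ *-monoˡ (γ * γ) (0≤-square γ) (*-monoˡ 4ℚ (0≤lit 4) (*-monoˡ k 0≤k (*-mono 0≤1-6y² θ^K≥ (0≤* 0≤n (0≤* 0≤y⁴ 0≤1-3y⁵)) H≥))) ⟩
        γ * γ * (4ℚ * (k * (θ ^ K * H)))
          ≤⟨ P.spectral-gap≥ b 1≤b rayleigh ⟩
        γ * γ * ((b - 1ℚ) * (n * (ι (suc K) * D ^ K))) + 4ℚ * (n * D ^ suc K)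
          ≤⟨ +-mono-≤ (*-monoˡ (γ * γ) (0≤-square γ) (*-mono (0≤Δ 1≤b) b-small (0≤* 0≤n (0≤* (0≤ι (suc K)) (0≤^ K 0≤D)))
               (*-monoˡ n 0≤n (*-mono (0≤ι (suc K)) (ι-mono (ℕ.m≤n+m (suc K) 2)) (0≤^ K 0≤D) (D^≤ K (ℕ.m≤n+m K 3))))))
               (*-monoˡ 4ℚ (0≤lit 4) (*-monoˡ n 0≤n (D^≤ (suc K) (ℕ.m≤n+m (suc K) 2)))) ⟩
        γ * γ * ((lit 4 - lit 100 * y) * y⁴ * (n * (ν * Q))) + 4ℚ * (n * Q)
          ≡⟨ solve 4 (λ x n q y → con ¼ :* (x :* x) :* (con ¼ :* (x :* x)) :* ((κ 4 :- κ 100 :* y) :* (y :* y :* (y :* y)) :* (n :* (x :* q))) :+ con 4ℚ :* (n :* q)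
               := x :* y :* (x :* y) :* (x :* y :* (x :* y)) :* (n :* con (¼ * ¼) :* ((κ 4 :- κ 100 :* y) :* x :* q)) :+ n :* con (¼ * ¼) :* (κ 64 :* q)) refl ν n Q y ⟩
        ν * y * (ν * y) * (ν * y * (ν * y)) * (n * (¼ * ¼) * ((lit 4 - lit 100 * y) * ν * Q)) + n * (¼ * ¼) * (lit 64 * Q)
          ≡⟨ cong (λ z → z * (n * (¼ * ¼) * ((lit 4 - lit 100 * y) * ν * Q)) + n * (¼ * ¼) * (lit 64 * Q)) [νy]⁴ ⟩
        1ℚ * (n * (¼ * ¼) * ((lit 4 - lit 100 * y) * ν * Q)) + n * (¼ * ¼) * (lit 64 * Q)
          ≡⟨ solve 3 (λ c a b → con 1ℚ :* (c :* a) :+ c :* b := c :* (a :+ b)) refl (n * (¼ * ¼)) ((lit 4 - lit 100 * y) * ν * Q) (lit 64 * Q) ⟩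
        n * (¼ * ¼) * ((lit 4 - lit 100 * y) * ν * Q + lit 64 * Q) ∎)
        where
        open ≤-Reasoning
        0≤D = ≤-trans 0≤1 1≤D

    absurd : ⊥
    absurd = final-contradiction ν y k 0<y 2y≤1 νy≡1 k+3≡ν 0≤k inequality

-- Counting edges through the adjacency matrix, and an exactly symmetric copy of the weights.

module EdgesAndWeights where

  open Rationals
  open R using (module ℝ; mk<; WeightedGraph; edgeCount; laplacian; IsSpectrum)
  open ℝ using (seq)
  open RealSequences
  open RayleighBounds using (weightLaplacian)
  open GapEstimate using (adjacency)

  indicator : ∀ {A : Set} → Dec A → ℚ
  indicator p = if does p then 1ℚ else 0ℚ

  listSum : ∀ {A : Set} → (A → ℚ) → List A → ℚ
  listSum f [] = 0ℚ
  listSum f (x ∷ xs) = f x + listSum f xs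

  length-filter : ∀ {A : Set} {P : A → Set} (P? : ∀ x → Dec (P x)) xs → ι (length (filter P? xs)) ≡ listSum (λ x → indicator (P? x)) xs
  length-filter P? [] = ι-def 0
  length-filter P? (x ∷ xs) with does (P? x)
  ... | true = trans (ι-suc (length (filter P? xs))) (cong (1ℚ +_) (length-filter P? xs))
  ... | false = trans (length-filter P? xs) (sym (+-identityˡ _))

  listSum-++ : ∀ {A : Set} (f : A → ℚ) xs ys → listSum f (xs ++ ys) ≡ listSum f xs + listSum f ys
  listSum-++ f [] ys = sym (+-identityˡ (listSum f ys))
  listSum-++ f (x ∷ xs) ys = trans (cong (f x +_) (listSum-++ f xs ys)) (sym (+-assoc (f x) (listSum f xs) (listSum f ys)))

  listSum-map : ∀ {A B : Set} (f : B → ℚ) (h : A → B) xs → listSum f (map h xs) ≡ listSum (f ∘ h) xs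
  listSum-map f h [] = refl
  listSum-map f h (x ∷ xs) = cong (f (h x) +_) (listSum-map f h xs)

  listSum-product : ∀ {A B : Set} (f : A × B → ℚ) xs ys → listSum f (cartesianProduct xs ys) ≡ listSum (λ x → listSum (λ y → f (x , y)) ys) xs
  listSum-product f [] ys = refl
  listSum-product f (x ∷ xs) ys = trans (listSum-++ f (map (x ,_) ys) (cartesianProduct xs ys))
    (cong₂ _+_ (listSum-map f (x ,_) ys) (listSum-product f xs ys))

  listSum-tabulate : ∀ {A : Set} {n} (f : A → ℚ) (h : Fin n → A) → listSum f (tabulate h) ≡ sum (f ∘ h)
  listSum-tabulate {n = zero} f h = refl
  listSum-tabulate {n = suc n} f h = cong (f (h zero) +_) (listSum-tabulate f (h ∘ suc))

  ∑-adjacency : ∀ {n} (G : WeightedGraph n) → sum (λ u → sum (adjacency G u)) ≡ ι (edgeCount G) + ι (edgeCount G)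
  ∑-adjacency {n} G = begin
    sum (λ u → sum (adjacency G u))  ≡⟨ sum-cong-≗ (λ u → trans (sum-cong-≗ (split u)) (∑-distrib-+ (forward u) (λ v → forward v u))) ⟩
    sum (λ u → sum (forward u) + sum (λ v → forward v u))        ≡⟨ ∑-distrib-+ (λ u → sum (forward u)) (λ u → sum (λ v → forward v u)) ⟩
    sum (λ u → sum (forward u)) + sum (λ u → sum (λ v → forward v u))
                                ≡⟨ cong (sum (λ u → sum (forward u)) +_) (∑-comm (λ u v → forward v u)) ⟩
    sum (λ u → sum (forward u)) + sum (λ u → sum (forward u))    ≡⟨ cong₂ _+_ count count ⟩
    ι (edgeCount G) + ι (edgeCount G)  ∎
    where
    open ≡-Reasoning
    open WeightedGraph G using (_∼_; _∼?_; ∼-sym; ∼-irrefl)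
    forward : Fin n → Fin n → ℚ
    forward u v = indicator ((u Fin.<? v) ×-dec (u ∼? v))
    count : sum (λ u → sum (forward u)) ≡ ι (edgeCount G)
    count = sym (trans (length-filter (λ (u , v) → (u Fin.<? v) ×-dec (u ∼? v)) (cartesianProduct (allFin n) (allFin n)))
      (trans (listSum-product (λ (u , v) → forward u v) (allFin n) (allFin n))
        (trans (listSum-tabulate (λ u → listSum (forward u) (allFin n)) id) (sum-cong-≗ (λ u → listSum-tabulate (forward u) id)))))
    split : ∀ u v → adjacency G u v ≡ forward u v + forward v u
    split u v with u ∼? v | v ∼? u | Fin.<-cmp u v
    ... | yes _ | yes _ | tri< p _ q rewrite dec-true (u Fin.<? v) p | dec-false (v Fin.<? u) q = refl
    ... | yes _ | yes _ | tri> p _ q rewrite dec-false (u Fin.<? v) p | dec-true (v Fin.<? u) q = refl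
    ... | yes e | yes _ | tri≈ _ u≡v _ = contradiction e (∼-irrefl u≡v)
    ... | yes e | no ¬e | _ = contradiction (∼-sym e) ¬e
    ... | no ¬e | yes e | _ = contradiction (∼-sym e) ¬e
    ... | no ¬e | no ¬e′ | _ rewrite ∧-zeroʳ (does (u Fin.<? v)) | ∧-zeroʳ (does (v Fin.<? u)) = refl

  -- In terms of the average degree this is d ≤ n; it is what makes `n` large along with d.
  ∑-adjacency≤ : ∀ {n} (G : WeightedGraph n) → sum (λ u → sum (adjacency G u)) ≤ ι n * ι n
  ∑-adjacency≤ {n} G = ≤-trans (∑-mono (λ u → ≤-trans (∑-mono (entry u)) (≤-reflexive (trans (∑-const n 1ℚ) (*-identityʳ (ι n)))))) (≤-reflexive (∑-const n (ι n)))
    where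
    entry : ∀ u v → adjacency G u v ≤ 1ℚ
    entry u v with WeightedGraph._∼?_ G u v
    ... | yes _ = ≤-refl
    ... | no _ = 0≤1

  -- The weights are symmetric only up to ≈; this copy is symmetric and supported on the edges on the nose, hence so are all terms of its sequences.
  symmetrized : ∀ {n} → WeightedGraph n → R.Matrix n
  symmetrized G u v = if does (u ∼? v) then (if does (u Fin.<? v) then weight u v else weight v u) else R.0ℝ
    where open WeightedGraph G

  symmetrized-sym : ∀ {n} (G : WeightedGraph n) u v → symmetrized G u v ≡ symmetrized G v u
  symmetrized-sym G u v with WeightedGraph._∼?_ G u v | WeightedGraph._∼?_ G v u | Fin.<-cmp u v
  ... | yes _ | yes _ | tri< p _ q rewrite dec-true (u Fin.<? v) p | dec-false (v Fin.<? u) q = refl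
  ... | yes _ | yes _ | tri> p _ q rewrite dec-false (u Fin.<? v) p | dec-true (v Fin.<? u) q = refl
  ... | yes e | yes _ | tri≈ _ u≡v _ = contradiction e (WeightedGraph.∼-irrefl G u≡v)
  ... | yes e | no ¬e | _ = contradiction (WeightedGraph.∼-sym G e) ¬e
  ... | no ¬e | yes e | _ = contradiction (WeightedGraph.∼-sym G e) ¬e
  ... | no _ | no _ | _ = refl

  symmetrized-≈ : ∀ {n} (G : WeightedGraph n) u v → WeightedGraph.weight G u v R.≈ symmetrized G u v
  symmetrized-≈ G u v with WeightedGraph._∼?_ G u v | does (u Fin.<? v)
  ... | yes _ | true = ≈-refl {WeightedGraph.weight G u v}
  ... | yes _ | false = WeightedGraph.weight-sym G u v
  ... | no ¬e | _ = WeightedGraph.weight-nonEdge G ¬e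

  symmetrized-nonEdge : ∀ {n} (G : WeightedGraph n) u v → ¬ WeightedGraph._∼_ G u v → ∀ j → seq (symmetrized G u v) j ≡ 0ℚ
  symmetrized-nonEdge G u v ¬e j with WeightedGraph._∼?_ G u v
  ... | yes e = contradiction e ¬e
  ... | no _ = refl

  eventually-pos : ∀ {x} → (0<x : R.0ℝ R.< x) → 0ℚ < R._<_.gap 0<x × Eventually (λ j → R._<_.gap 0<x ≤ seq x j)
  eventually-pos {x} (mk< g g>0 N h) = g>0 , N , λ j N≤j → subst (_≤ seq x j) (+-identityˡ g) (h j N≤j)

  symmetrized-nonNeg : ∀ {n} (G : WeightedGraph n) → Eventually (λ j → ∀ u v → 0ℚ ≤ seq (symmetrized G u v) j)
  symmetrized-nonNeg G = ev-Fin (λ u → ev-Fin (λ v → entry u v))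
    where
    open WeightedGraph G
    positive-eventually : ∀ x → R.0ℝ R.< x → Eventually (λ j → 0ℚ ≤ seq x j)
    positive-eventually x 0<x = ev-map (λ j → ≤-trans (<⇒≤ (proj₁ (eventually-pos 0<x)))) (proj₂ (eventually-pos 0<x))
    entry : ∀ u v → Eventually (λ j → 0ℚ ≤ seq (symmetrized G u v) j)
    entry u v with u ∼? v | does (u Fin.<? v)
    ... | yes e | true = positive-eventually (weight u v) (weight-edge e)
    ... | yes e | false = positive-eventually (weight v u) (weight-edge (∼-sym e))
    ... | no _ | _ = 0 , λ _ _ → ≤-refl

  symmetrized-spectrum : ∀ {n} (G : WeightedGraph n) {μ} → IsSpectrum (laplacian G) μ → IsSpectrum (weightLaplacian (symmetrized G)) μ
  symmetrized-spectrum {n} G spectrum = record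
    { nondecreasing = IsSpectrum.nondecreasing spectrum
    ; charpoly = λ t → ≈-trans (det-cong-≈ (λ i k → +-cong (≈-refl {R.diagonal (λ _ → t) i k}) (neg-cong (+-cong (≈-sym (diagonal-cong i k)) (neg-cong (≈-sym (symmetrized-≈ G i k)))))))
        (IsSpectrum.charpoly spectrum t) }
    where
    diagonal-cong : ∀ i k → R.diagonal (R.weightedDegree G) i k R.≈ R.diagonal (λ u → R.sum (symmetrized G u)) i k
    diagonal-cong i k with i Fin.≟ k
    ... | yes _ = sum-cong (symmetrized-≈ G i)
    ... | no _ = ≈-refl {R.0ℝ}

  recip-inverse : ∀ x (0<x : R.0ℝ R.< x) → Eventually (λ j → seq x j * seq (R.recip x 0<x) j ≡ 1ℚ × 0ℚ < seq (R.recip x 0<x) j)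
  recip-inverse x (mk< g g>0 N h) = N , λ j N≤j →
    trans (cong (_* seq (R.recip x (mk< g g>0 N h)) j) (sym (p≥q⇒p⊔q≡p (subst (_≤ seq x j) (+-identityˡ g) (h j N≤j)))))
      (*-inverseʳ (seq x j ⊔ g) {{pos⇒nonZero (seq x j ⊔ g) {{⊔-pos j}}}}) ,
    positive⁻¹ _ {{1/pos⇒pos (seq x j ⊔ g) {{⊔-pos j}}}}
    where
    ⊔-pos : ∀ j → Positive (seq x j ⊔ g)
    ⊔-pos j = positive (<-≤-trans g>0 (p≤q⊔p (seq x j) g))

-- Choice of the path length and numerical consequences of the powers of d.

module RootEstimates where

  open Rationals
  open RealSequences using (∣-∣<⇒)
  open Estimates using (lit; 0≤lit; κ; bernoulli)

  ^-^ : ∀ p m k → (p ^ m) ^ k ≡ p ^ (k ℕ.* m)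
  ^-^ p m zero = refl
  ^-^ p m (suc k) = trans (cong (p ^ m *_) (^-^ p m k)) (sym (^-+ p m (k ℕ.* m)))

  0<lit : ∀ k → 0ℚ < lit (suc k)
  0<lit k = subst (0ℚ <_) (ι-def (suc k)) (0<ι-suc k)

  ¼ ⅛ ⅓ : ℚ
  ⅓ = ℤ.+ 1 / 3
  ¼ = ½ * ½
  ⅛ = ½ * ¼

  0<½ : 0ℚ < ½
  0<½ = *<* (ℤ.+<+ (s≤s z≤n))

  0<¼ : 0ℚ < ¼
  0<¼ = *<* (ℤ.+<+ (s≤s z≤n))

  0<⅛ : 0ℚ < ⅛
  0<⅛ = *<* (ℤ.+<+ (s≤s z≤n))

  1≤^ : ∀ {p} k → 1ℚ ≤ p → 1ℚ ≤ p ^ k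
  1≤^ zero h = ≤-refl
  1≤^ {p} (suc k) h = ≤-trans (≤-reflexive (sym (*-identityˡ 1ℚ))) (*-mono 0≤1 h 0≤1 (1≤^ k h))

  -- The unit windows are shifted by ¼ so that a number within ⅛ of `q` still exceeds `ι (suc K)` by
  -- ⅛, and stays more than ½ below `ι (3 + K)`.
  locate : ∀ F q → 1ℚ + ¼ ≤ q → q < ι F + ¼ → ∃[ K ] ι (suc K) + ¼ ≤ q × q < ι (suc (suc K)) + ¼
  locate zero q h k = contradiction (≤-<-trans h (subst (λ z → q < z + ¼) (ι-def 0) k)) (<-asym (+-monoˡ-< ¼ 0<1))
  locate (suc F) q h k with q <? ι F + ¼
  ... | yes q< = locate F q h q<
  locate (suc zero) q h k | no q≮ = contradiction (≤-<-trans h (subst (λ z → q < z + ¼) (ι-def 1) k)) (<-irrefl refl)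
  locate (suc (suc K)) q h k | no q≮ = K , ≮⇒≥ q≮ , k

  -- Since r ≈ √d and f ≈ d^⅝, the inequality C / f ≤ 4 / r holds only when d^⅛ is large.
  large-root : ∀ Z s r f d d₀ iʳ iᶠ → 0ℚ < Z → 0ℚ ≤ s → 0ℚ < r → 0ℚ < f → 0ℚ < d₀ → d₀ ≤ d →
    ∣ s ^ 8 - d ∣ < ½ * d₀ → ∣ r ^ 2 - d ∣ < ½ * d₀ → ∣ f ^ 8 - d ^ 5 ∣ < ½ * d₀ ^ 5 →
    r * iʳ ≡ 1ℚ → f * iᶠ ≡ 1ℚ → lit 8 * Z * iᶠ ≤ lit 4 * iʳ → Z ≤ s
  large-root Z s r f d d₀ iʳ iᶠ 0<Z 0≤s 0<r 0<f 0<d₀ d₀≤d s-close r-close f-close r/r f/f h = ^-cancel-≤ 7 0≤s (≤-by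
    ((s ^ 8 + ½ * d₀ - d) + ½ * (d - d₀) + ⅓ * ((lit 3 * ½) * d - lit 16 * Z ^ 8) + lit 13 * ⅓ * Z ^ 8)
    (0≤+ (0≤+ (0≤+ (0≤Δ (proj₂ (∣-∣<⇒ (s ^ 8) d s-close))) (0≤* 0≤½ (0≤Δ d₀≤d)))
      (0≤* {⅓} (*≤* (ℤ.+≤+ z≤n)) (0≤Δ d-large))) (0≤* {lit 13 * ⅓} (*≤* (ℤ.+≤+ z≤n)) (0≤^ 8 (<⇒≤ 0<Z))))
    (solve 4 (λ s d e z → s := z :+ ((s :+ con ½ :* e :- d) :+ con ½ :* (d :- e) :+ con (⅓) :* (con (lit 3 * ½) :* d :- κ 16 :* z) :+ con (lit 13 * ⅓) :* z)) refl (s ^ 8) d d₀ (Z ^ 8)))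
    where
    0≤d : 0ℚ ≤ d
    0≤d = ≤-trans (<⇒≤ 0<d₀) d₀≤d
    2Zr≤f : lit 2 * Z * r ≤ f
    2Zr≤f = *-cancelˡ-≤ (lit 4) (0<lit 3) (subst₂ _≤_
      (trans (solve 4 (λ z r f i → κ 8 :* z :* i :* (r :* f) := κ 4 :* (κ 2 :* z :* r) :* (f :* i)) refl Z r f iᶠ) (trans (cong (lit 4 * (lit 2 * Z * r) *_) f/f) (*-identityʳ _)))
      (trans (solve 3 (λ r f i → κ 4 :* i :* (r :* f) := κ 4 :* f :* (r :* i)) refl r f iʳ) (trans (cong (lit 4 * f *_) r/r) (*-identityʳ _)))
      (*-monoʳ (r * f) (0≤* (<⇒≤ 0<r) (<⇒≤ 0<f)) h))
    d/2≤r² : ½ * d ≤ r ^ 2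
    d/2≤r² = ≤-by ((r ^ 2 + ½ * d₀ - d) + ½ * (d - d₀)) (0≤+ (0≤Δ (proj₂ (∣-∣<⇒ (r ^ 2) d r-close))) (0≤* 0≤½ (0≤Δ d₀≤d)))
      (solve 3 (λ r d e → r := con ½ :* d :+ ((r :+ con ½ :* e :- d) :+ con ½ :* (d :- e))) refl (r ^ 2) d d₀)
    f⁸≤ : f ^ 8 ≤ (lit 3 * ½) * d ^ 5
    f⁸≤ = ≤-trans (proj₁ (∣-∣<⇒ (f ^ 8) (d ^ 5) f-close)) (≤-by (½ * (d ^ 5 - d₀ ^ 5)) (0≤* 0≤½ (0≤Δ (^-mono 5 (<⇒≤ 0<d₀) d₀≤d)))
      (solve 2 (λ a b → con (lit 3 * ½) :* a := a :+ con ½ :* b :+ con ½ :* (a :- b)) refl (d ^ 5) (d₀ ^ 5)))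
    0<d : 0ℚ < d
    0<d = <-≤-trans 0<d₀ d₀≤d
    0≤2Zr : 0ℚ ≤ lit 2 * Z * r
    0≤2Zr = 0≤* (0≤* (0≤lit 2) (<⇒≤ 0<Z)) (<⇒≤ 0<r)
    d-large : lit 16 * Z ^ 8 ≤ (lit 3 * ½) * d
    d-large = *-cancelʳ-≤ (d ^ 4) (0<^ 4 0<d) (begin
      lit 16 * Z ^ 8 * d ^ 4
        ≡⟨ solve 2 (λ z d → let p = κ 4 :* (z :* z) :* (con ½ :* d) in
             κ 16 :* (z :* (z :* (z :* (z :* (z :* (z :* (z :* (z :* con 1ℚ)))))))) :* (d :* (d :* (d :* (d :* con 1ℚ)))) := p :* (p :* (p :* (p :* con 1ℚ)))) refl Z d ⟩
      (lit 4 * (Z * Z) * (½ * d)) ^ 4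
        ≤⟨ ^-mono 4 (0≤* 0≤4Z² (0≤* 0≤½ 0≤d)) (*-monoˡ (lit 4 * (Z * Z)) 0≤4Z² d/2≤r²) ⟩
      (lit 4 * (Z * Z) * r ^ 2) ^ 4
        ≡⟨ cong (_^ 4) (solve 2 (λ z r → κ 4 :* (z :* z) :* (r :* (r :* con 1ℚ)) := κ 2 :* z :* r :* (κ 2 :* z :* r :* con 1ℚ)) refl Z r) ⟩
      ((lit 2 * Z * r) ^ 2) ^ 4
        ≡⟨ ^-^ (lit 2 * Z * r) 2 4 ⟩
      (lit 2 * Z * r) ^ 8
        ≤⟨ ^-mono 8 0≤2Zr 2Zr≤f ⟩
      f ^ 8
        ≤⟨ f⁸≤ ⟩
      (lit 3 * ½) * (d * d ^ 4)
        ≡⟨ sym (*-assoc (lit 3 * ½) d (d ^ 4)) ⟩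
      (lit 3 * ½) * d * d ^ 4 ∎)
      where
      open ≤-Reasoning
      0≤4Z² : 0ℚ ≤ lit 4 * (Z * Z)
      0≤4Z² = 0≤* (0≤lit 4) (0≤-square Z)

  -- In use x = K + 1 and ν = K + 3 lie below and above d^(1/8), with margins ⅛ and ½, and y = 1/ν.
  module Numerics (x ν y : ℚ) (ν≡ : ν ≡ x + lit 2) (νy≡1 : ν * y ≡ 1ℚ) (16≤x : lit 16 ≤ x) where

    1≤x : 1ℚ ≤ x
    1≤x = ≤-trans (*≤* (ℤ.+≤+ (s≤s z≤n))) 16≤x
    0≤x : 0ℚ ≤ x
    0≤x = ≤-trans 0≤1 1≤x
    x≤ν : x ≤ ν
    x≤ν = ≤-by (lit 2) (0≤lit 2) ν≡
    1≤ν : 1ℚ ≤ ν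
    1≤ν = ≤-trans 1≤x x≤ν
    0<ν : 0ℚ < ν
    0<ν = <-≤-trans 0<1 1≤ν
    0≤ν : 0ℚ ≤ ν
    0≤ν = <⇒≤ 0<ν
    0<y : 0ℚ < y
    0<y = *-cancelʳ-< ν 0≤ν (subst₂ _<_ (sym (*-zeroˡ ν)) (trans (sym νy≡1) (*-comm ν y)) 0<1)
    0≤y : 0ℚ ≤ y
    0≤y = <⇒≤ 0<y
    16y≤1 : lit 16 * y ≤ 1ℚ
    16y≤1 = ≤-trans (*-monoʳ y 0≤y (≤-trans 16≤x x≤ν)) (≤-reflexive νy≡1)
    y⁴ = y * y * (y * y)
    y⁵ = y⁴ * y
    0≤y⁴ : 0ℚ ≤ y⁴
    0≤y⁴ = 0≤-square (y * y)
    0≤y⁵ : 0ℚ ≤ y⁵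
    0≤y⁵ = 0≤* 0≤y⁴ 0≤y

    -- For large `x` a margin of ⅛ in the root is worth at least 1 in the eighth power. That absorbs
    -- the error made by reading s⁸ = d at a single index.
    power≥ : ∀ {s} → x + ⅛ ≤ s → x ^ 8 + 1ℚ ≤ s ^ 8
    power≥ {s} h = ≤-trans (≤-by (⅛ * (x * x ^ 6 - lit 8 * 1ℚ)) (0≤* {⅛} (*≤* (ℤ.+≤+ z≤n)) (0≤Δ (*-mono (0≤lit 8) (≤-trans {lit 8} {lit 16} (*≤* (ℤ.+≤+ (ℕ.m≤m+n 8 8))) 16≤x) 0≤1 (1≤^ 6 1≤x))))
        (solve 2 (λ x z → (x :+ con ⅛) :* (x :* z) := x :* (x :* z) :+ con 1ℚ :+ con ⅛ :* (x :* z :- κ 8 :* con 1ℚ)) refl x (x ^ 6)))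
      (*-mono (0≤+ 0≤x (*≤* (ℤ.+≤+ z≤n))) h (0≤^ 7 0≤x) (^-mono 7 0≤x (≤-trans (≤-by ⅛ (*≤* (ℤ.+≤+ z≤n)) refl) h)))

    power≤ : ∀ {s} → 0ℚ ≤ s → s + ½ ≤ ν → s ^ 8 + lit 2 ≤ ν ^ 8
    power≤ {s} 0≤s h = ≤-trans (+-monoˡ-≤ (lit 2) (*-mono 0≤s s≤ (0≤^ 7 0≤s) (^-mono 7 0≤s (≤-trans s≤ (≤-by ½ (*≤* (ℤ.+≤+ z≤n)) (solve 1 (λ n → n := n :- con ½ :+ con ½) refl ν))))))
      (≤-by (½ * (ν * ν ^ 6 - lit 4 * 1ℚ)) (0≤* 0≤½ (0≤Δ (*-mono (0≤lit 4) (≤-trans (≤-trans {lit 4} {lit 16} (*≤* (ℤ.+≤+ (ℕ.m≤m+n 4 12))) 16≤x) x≤ν) 0≤1 (1≤^ 6 1≤ν))))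
        (solve 2 (λ n z → n :* (n :* z) := (n :- con ½) :* (n :* z) :+ κ 2 :+ con ½ :* (n :* z :- κ 4 :* con 1ℚ)) refl ν (ν ^ 6)))
      where
      s≤ : s ≤ ν - ½
      s≤ = ≤-by (ν - (s + ½)) (0≤Δ h) (solve 2 (λ s n → n :- con ½ := s :+ (n :- (s :+ con ½))) refl s ν)

    module Excess (s r f d : ℚ) (s≥ : x + ⅛ ≤ s) (s≤ : s + ½ ≤ ν) (0≤r : 0ℚ ≤ r)
      (s-close : ∣ s ^ 8 - d ∣ < ½) (r-close : ∣ r ^ 2 - d ∣ < ½) (f-close : ∣ f ^ 8 - d ^ 5 ∣ < 1ℚ) where

      d≥ : x ^ 8 + ½ ≤ d
      d≥ = ≤-by ((s ^ 8 - (x ^ 8 + 1ℚ)) + (d + ½ - s ^ 8)) (0≤+ (0≤Δ (power≥ s≥)) (0≤Δ (proj₁ (∣-∣<⇒ (s ^ 8) d s-close))))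
        (solve 3 (λ d s x → d := x :+ con ½ :+ ((s :- (x :+ con 1ℚ)) :+ (d :+ con ½ :- s))) refl d (s ^ 8) (x ^ 8))

      d≤ : d + 1ℚ ≤ ν ^ 8
      d≤ = ≤-by ((ν ^ 8 - (s ^ 8 + lit 2)) + (s ^ 8 + ½ - d) + ½) (0≤+ (0≤+ (0≤Δ (power≤ 0≤s s≤)) (0≤Δ (proj₂ (∣-∣<⇒ (s ^ 8) d s-close)))) (*≤* (ℤ.+≤+ z≤n)))
        (solve 3 (λ d s n → n := d :+ con 1ℚ :+ ((n :- (s :+ κ 2)) :+ (s :+ con ½ :- d) :+ con ½)) refl d (s ^ 8) (ν ^ 8))
        where
        0≤s : 0ℚ ≤ s
        0≤s = ≤-trans (0≤+ 0≤x (*≤* (ℤ.+≤+ z≤n))) s≥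

      0≤d : 0ℚ ≤ d
      0≤d = ≤-trans (0≤+ (0≤^ 8 0≤x) (*≤* (ℤ.+≤+ z≤n))) d≥

      r≥ : x ^ 4 ≤ r
      r≥ = ^-cancel-≤ 1 0≤r (≤-trans (≤-reflexive (^-^ x 4 2)) (≤-by ((d - (x ^ 8 + ½)) + (r ^ 2 + ½ - d)) (0≤+ (0≤Δ d≥) (0≤Δ (proj₂ (∣-∣<⇒ (r ^ 2) d r-close))))
        (solve 3 (λ r d x → r := x :+ ((d :- (x :+ con ½)) :+ (r :+ con ½ :- d))) refl (r ^ 2) d (x ^ 8))))

      f≤ : f ≤ ν ^ 5
      f≤ = ^-cancel-≤ 7 (0≤^ 5 0≤ν) (begin
        f ^ 8  ≤⟨ proj₁ (∣-∣<⇒ (f ^ 8) (d ^ 5) f-close) ⟩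
        d * d ^ 4 + 1ℚ  ≤⟨ +-monoˡ-≤ 1ℚ (*-mono 0≤d d≤z-1 (0≤^ 4 0≤d) (^-mono 4 0≤d (≤-trans d≤z-1 (≤-by 1ℚ 0≤1 (solve 1 (λ z → z := z :- con 1ℚ :+ con 1ℚ) refl z))))) ⟩
        (z - 1ℚ) * z ^ 4 + 1ℚ     ≤⟨ ≤-by (z ^ 4 - 1ℚ) (0≤Δ (1≤^ 4 (1≤^ 8 1≤ν))) (solve 2 (λ z w → z :* w := (z :- con 1ℚ) :* w :+ con 1ℚ :+ (w :- con 1ℚ)) refl z (z ^ 4)) ⟩
        z ^ 5  ≡⟨ ^-^ ν 8 5 ⟩
        ν ^ 40  ≡⟨ sym (^-^ ν 5 8) ⟩
        (ν ^ 5) ^ 8  ∎)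
        where
        open ≤-Reasoning
        z = ν ^ 8
        d≤z-1 : d ≤ z - 1ℚ
        d≤z-1 = ≤-by (z - (d + 1ℚ)) (0≤Δ d≤) (solve 2 (λ d z → z :- con 1ℚ := d :+ (z :- (d :+ con 1ℚ))) refl d z)

      [νy]⁵ : ν ^ 5 * y⁵ ≡ 1ℚ
      [νy]⁵ = trans (solve 2 (λ n y → n :* (n :* (n :* (n :* (n :* con 1ℚ)))) :* (y :* y :* (y :* y) :* y) := n :* y :* (n :* y) :* (n :* y :* (n :* y)) :* (n :* y)) refl ν y)
        (cong (λ z → z * z * (z * z) * z) νy≡1)

      module _ (iʳ iᶠ : ℚ) (0<iʳ : 0ℚ < iʳ) (0<iᶠ : 0ℚ < iᶠ) (r/r : r * iʳ ≡ 1ℚ) (f/f : f * iᶠ ≡ 1ℚ) where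

        -- From r ≥ x⁴ and x y = 1 - 2 y the reciprocal is at most y⁴ / (1 - 2 y)⁴. Bernoulli
        -- replaces the denominator by 1 - 8 y, and (1 - 8 y)(1 + 16 y) ≥ 1 as long as 16 y ≤ 1.
        iʳ≤ : iʳ ≤ y⁴ * (1ℚ + lit 16 * y)
        iʳ≤ = ≤-trans (≤-by (iʳ * (lit 8 * y * (1ℚ - lit 16 * y))) (0≤* (<⇒≤ 0<iʳ) (0≤* (0≤* (0≤lit 8) 0≤y) (0≤Δ 16y≤1)))
            (solve 2 (λ i y → i :* (con 1ℚ :- κ 8 :* y) :* (con 1ℚ :+ κ 16 :* y) := i :+ i :* (κ 8 :* y :* (con 1ℚ :- κ 16 :* y))) refl iʳ y))
          (*-monoʳ (1ℚ + lit 16 * y) (0≤+ 0≤1 (0≤* (0≤lit 16) 0≤y)) (begin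
            iʳ * (1ℚ - lit 8 * y)  ≤⟨ *-monoˡ iʳ (<⇒≤ 0<iʳ) (subst (_≤ (1ℚ - lit 2 * y) ^ 4) (trans (cong (λ z → 1ℚ - z * (lit 2 * y)) (ι-def 4))
                                (solve 1 (λ y → con 1ℚ :- κ 4 :* (κ 2 :* y) := con 1ℚ :- κ 8 :* y) refl y))
                                (bernoulli (lit 2 * y) 4 (0≤* (0≤lit 2) 0≤y) (≤-trans (*-monoʳ {lit 2} {lit 16} y 0≤y (*≤* (ℤ.+≤+ (ℕ.m≤m+n 2 14)))) 16y≤1))) ⟩
            iʳ * (1ℚ - lit 2 * y) ^ 4        ≡⟨ cong (λ z → iʳ * z ^ 4) (sym xy≡) ⟩
            iʳ * (x * y) ^ 4  ≡⟨ solve 3 (λ i x y → i :* (x :* y :* (x :* y :* (x :* y :* (x :* y :* con 1ℚ)))) := x :* (x :* (x :* (x :* con 1ℚ))) :* i :* (y :* y :* (y :* y))) refl iʳ x y ⟩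
            x ^ 4 * iʳ * y⁴  ≤⟨ *-monoʳ y⁴ 0≤y⁴ (≤-trans (*-monoʳ iʳ (<⇒≤ 0<iʳ) r≥) (≤-reflexive r/r)) ⟩
            1ℚ * y⁴  ≡⟨ *-identityˡ y⁴ ⟩
            y⁴  ∎))
          where
          open ≤-Reasoning
          xy≡ : x * y ≡ 1ℚ - lit 2 * y
          xy≡ = trans (solve 2 (λ x y → x :* y := (x :+ κ 2) :* y :- κ 2 :* y) refl x y) (cong (_- lit 2 * y) (trans (cong (_* y) (sym ν≡)) νy≡1))

        iᶠ≥ : y⁵ ≤ iᶠ
        iᶠ≥ = begin
          y⁵  ≡⟨ sym (trans (cong (y⁵ *_) f/f) (*-identityʳ y⁵)) ⟩
          y⁵ * (f * iᶠ)        ≤⟨ *-monoˡ y⁵ 0≤y⁵ (*-monoʳ iᶠ (<⇒≤ 0<iᶠ) f≤) ⟩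
          y⁵ * (ν ^ 5 * iᶠ)    ≡⟨ solve 3 (λ y n i → y :* (n :* i) := n :* y :* i) refl y⁵ (ν ^ 5) iᶠ ⟩
          ν ^ 5 * y⁵ * iᶠ      ≡⟨ trans (cong (_* iᶠ) [νy]⁵) (*-identityˡ iᶠ) ⟩
          iᶠ  ∎
          where open ≤-Reasoning

        -- Of the 2000 y⁵ available, 4 * 16 = 64 pay for the bound on `iʳ` and 100 are demanded by
        -- `Contradiction`; the other 1836 are surplus.
        excess≤ : lit 4 * iʳ - lit 2000 * iᶠ ≤ (lit 4 - lit 100 * y) * y⁴
        excess≤ = ≤-by (lit 4 * (y⁴ * (1ℚ + lit 16 * y) - iʳ) + lit 2000 * (iᶠ - y⁵) + lit 1836 * y⁵)
          (0≤+ (0≤+ (0≤* (0≤lit 4) (0≤Δ iʳ≤)) (0≤* (0≤lit 2000) (0≤Δ iᶠ≥))) (0≤* (0≤lit 1836) 0≤y⁵))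
          (solve 4 (λ i j a y → (κ 4 :- κ 100 :* y) :* a := (κ 4 :* i :- κ 2000 :* j) :+
            (κ 4 :* (a :* (con 1ℚ :+ κ 16 :* y) :- i) :+ κ 2000 :* (j :- a :* y) :+ κ 1836 :* (a :* y))) refl iʳ iᶠ y⁴ y)

      module _ (n e : ℚ) (1≤n : 1ℚ ≤ n) (e≤n² : e ≤ n * n) (e≤ : e ≤ d * n + 1ℚ) (dn≤ : d * n ≤ e + 1ℚ) where

        -- The average degree of a simple graph is at most n, so d ≤ n + 1 up to the error of the
        -- index, and n ≥ x⁸ - 1. For x ≥ 16 this exceeds (2 x)⁵ ≥ ν⁵. Errors of order 1/n are
        -- therefore at most y⁵.
        n-large : 1ℚ ≤ n * y⁵
        n-large = ≤-trans (≤-reflexive (sym [νy]⁵)) (*-monoʳ y⁵ 0≤y⁵ ν⁵≤n)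
          where
          open ≤-Reasoning
          d≤n+1 : d ≤ n + 1ℚ
          d≤n+1 = *-cancelʳ-≤ n (<-≤-trans 0<1 1≤n) (≤-by ((e + 1ℚ - d * n) + (n * n - e) + (n - 1ℚ)) (0≤+ (0≤+ (0≤Δ dn≤) (0≤Δ e≤n²)) (0≤Δ 1≤n))
            (solve 3 (λ n d e → (n :+ con 1ℚ) :* n := d :* n :+ ((e :+ con 1ℚ :- d :* n) :+ (n :* n :- e) :+ (n :- con 1ℚ))) refl n d e))
          ν⁵≤n : ν ^ 5 ≤ n
          ν⁵≤n = begin
            ν ^ 5  ≤⟨ ^-mono 5 0≤ν (≤-trans (≤-reflexive ν≡) (≤-by (x - lit 2) (0≤Δ (≤-trans {lit 2} {lit 16} (*≤* (ℤ.+≤+ (ℕ.m≤m+n 2 14))) 16≤x))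
                                (solve 1 (λ x → κ 2 :* x := x :+ κ 2 :+ (x :- κ 2)) refl x))) ⟩
            (lit 2 * x) ^ 5  ≡⟨ solve 1 (λ x → let z = κ 2 :* x in z :* (z :* (z :* (z :* (z :* con 1ℚ)))) := κ 32 :* (x :* (x :* (x :* (x :* (x :* con 1ℚ)))))) refl x ⟩
            lit 32 * x ^ 5  ≤⟨ ≤-by ((lit 33 * x ^ 5 + - 1ℚ * (lit 32 * x ^ 5)) - 1ℚ) (0≤Δ (subst (1ℚ ≤_) (solve 1 (λ z → z := κ 33 :* z :+ con (- 1ℚ) :* (κ 32 :* z)) refl (x ^ 5)) (1≤^ 5 1≤x)))
                                (solve 1 (λ z → κ 33 :* z :- con 1ℚ := κ 32 :* z :+ ((κ 33 :* z :+ con (- 1ℚ) :* (κ 32 :* z)) :- con 1ℚ)) refl (x ^ 5)) ⟩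
            lit 33 * x ^ 5 - 1ℚ       ≤⟨ +-monoˡ-≤ (- 1ℚ) (*-monoʳ (x ^ 5) (0≤^ 5 0≤x) (≤-trans {lit 33} {lit 16 * (lit 16 * lit 1)} (*≤* (ℤ.+≤+ (ℕ.m≤m+n 33 223)))
                                (*-mono (0≤lit 16) 16≤x (0≤* (0≤lit 16) (0≤lit 1)) (*-mono (0≤lit 16) 16≤x (0≤lit 1) 1≤x)))) ⟩
            x * (x * x) * x ^ 5 - 1ℚ  ≡⟨ cong (_- 1ℚ) (solve 2 (λ x z → x :* (x :* x) :* z := x :* (x :* (x :* z))) refl x (x ^ 5)) ⟩
            x ^ 8 - 1ℚ  ≤⟨ ≤-by ((n + 1ℚ - d) + (d - (x ^ 8 + ½)) + ½) (0≤+ (0≤+ (0≤Δ d≤n+1) (0≤Δ d≥)) (*≤* (ℤ.+≤+ z≤n)))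
                                (solve 3 (λ n d x → n := x :- con 1ℚ :+ ((n :+ con 1ℚ :- d) :+ (d :- (x :+ con ½)) :+ con ½)) refl n d (x ^ 8)) ⟩
            n  ∎

        edges≤ : e * (y⁴ * y⁴) ≤ n
        edges≤ = ≤-trans (*-monoʳ (y⁴ * y⁴) (0≤-square y⁴) (≤-trans e≤ (≤-by ((ν ^ 8 - (d + 1ℚ)) * n + (n - 1ℚ)) (0≤+ (0≤* (0≤Δ d≤) (≤-trans 0≤1 1≤n)) (0≤Δ 1≤n))
          (solve 3 (λ z d n → z :* n := d :* n :+ con 1ℚ :+ ((z :- (d :+ con 1ℚ)) :* n :+ (n :- con 1ℚ))) refl (ν ^ 8) d n))))
          (≤-reflexive (trans (solve 3 (λ v y n → let m = v :* y in v :* (v :* (v :* (v :* (v :* (v :* (v :* (v :* con 1ℚ))))))) :* n :* (y :* y :* (y :* y) :* (y :* y :* (y :* y)))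
              := m :* m :* (m :* m) :* (m :* m :* (m :* m)) :* n) refl ν y n) (trans (cong (λ z → z * z * (z * z) * (z * z * (z * z)) * n) νy≡1) (*-identityˡ n))))

-- Assembling the contradiction from a strict violation of the bound.

module Assembly where

  open Rationals hiding (positive)
  open R using (ℝ; module ℝ; toℝ; recip; WeightedGraph; HasCycle; IsGirth; edgeCount; laplacian; IsSpectrum; RationalPower; half-pos)
  open ℝ using (seq; cauchy)
  open RationalPower using (value; positive; power)
  open Determinants using (Mat)
  open QuadraticForms
  open RealSequences
  open RayleighBounds
  open Estimates using (lit; 0≤lit; κ)
  open GapEstimate
  open EdgesAndWeights
  open RootEstimates

  eventually-power : ∀ {d p q} .{{_ : ℕ.NonZero q}} (ρ : RationalPower d p q) ε → 0ℚ < ε →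
    Eventually (λ j → ∣ seq (value ρ) j ^ q - seq d j ^ p ∣ < ε)
  eventually-power {d} {p} {q} ρ ε ε>0 = ev-map (λ j → subst₂ (λ a b → ∣ a - b ∣ < ε) (seq-^ (value ρ) q j) (seq-^ d p j)) (eventually-close (power ρ) ε ε>0)

  witness : ∀ {P : ℕ → Set} → Eventually P → ∃[ j ] P j
  witness (N , h) = N , h N ℕ.≤-refl

  lap-scale : ∀ {n} c (W : Mat n) i k → lap (λ u v → c * W u v) i k ≡ c * lap W i k
  lap-scale c W i k = trans (cong (λ s → δ i k * s - c * W i k) (sym (*-distribˡ-sum c (W i))))
    (solve 4 (λ d c s w → d :* (c :* s) :- c :* w := c :* (d :* s :- w)) refl (δ i k) c (sum (W i)) (W i k))

  quad-scale : ∀ {n} c (A B : Mat n) → (∀ i k → B i k ≡ c * A i k) → ∀ x → quad B x ≡ c * quad A x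
  quad-scale c A B h x = trans (sum-cong-≗ (λ i → trans (cong (x i *_) (trans (sum-cong-≗ (λ k → trans (cong (_* x k) (h i k)) (*-assoc c (A i k) (x k))))
      (sym (*-distribˡ-sum c (λ k → A i k * x k))))) (solve 3 (λ x c y → x :* (c :* y) := c :* (x :* y)) refl (x i) c ((A ⊛ x) i))))
    (sym (*-distribˡ-sum c (λ i → x i * (A ⊛ x) i)))

  module Final {m} (G : WeightedGraph (suc (suc m))) (d : ℝ) (0<d : R.0ℝ R.< d)
    (edges : toℝ (edgeCount G) R.≈ d R.* toℝ (suc (suc m)) R./ toℝ 2 ⟨ R.toℝ-pos 1 ⟩)
    (μ : Fin (suc (suc m)) → ℝ) (spectrum : IsSpectrum (laplacian G) μ)
    (S : RationalPower d 1 8) (T : RationalPower d 1 2) (F : RationalPower d 5 8)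
    (girth : ℕ ⁺) (isGirth : IsGirth G girth) (girth≥ : toℝ 2 R.* value S R.+ R.1ℝ R.≤⁺ girth)
    (μ₂>0 : R.0ℝ R.< μ (suc zero))
    (violation : μ (fromℕ (suc m)) R./ μ (suc zero) ⟨ μ₂>0 ⟩ R.<
      R.1ℝ R.+ toℝ 4 R./ value T ⟨ positive T ⟩ R.- toℝ 2000 R./ value F ⟨ positive F ⟩ R.- toℝ 2000 R./ toℝ (suc (suc m)) ⟨ R.toℝ-pos (suc m) ⟩) where

    private
      u v s r f dⱼ iᵘ iʳ iᶠ iⁿ : ℕ → ℚ
      u = seq (μ (suc zero))
      v = seq (μ (fromℕ (suc m)))
      s = seq (value S)
      r = seq (value T)
      f = seq (value F)
      dⱼ = seq d
      iᵘ = seq (recip (μ (suc zero)) μ₂>0)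
      iʳ = seq (recip (value T) (positive T))
      iᶠ = seq (recip (value F) (positive F))
      iⁿ = seq (recip (toℝ (suc (suc m))) (R.toℝ-pos (suc m)))

      -- Capped at 1, so that the tolerance `τ` below is at most a third of `u₀` and the bounds `a`
      -- and `b` come out positive.
      gap = R._<_.gap violation ⊓ 1ℚ
      gap≤1 : gap ≤ 1ℚ
      gap≤1 = p⊓q≤q (R._<_.gap violation) 1ℚ
      gap>0 : 0ℚ < gap
      gap>0 with ⊓-sel (R._<_.gap violation) 1ℚ
      ... | inj₁ eq = subst (0ℚ <_) (sym eq) (R._<_.gap>0 violation)
      ... | inj₂ eq = subst (0ℚ <_) (sym eq) 0<1

      ratio : Eventually (λ j → v j * iᵘ j + gap ≤ 1ℚ + lit 4 * iʳ j - lit 2000 * iᶠ j - lit 2000 * iⁿ j)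
      ratio = R._<_.threshold violation , λ j le → ≤-trans (+-monoʳ-≤ (v j * iᵘ j) (p⊓q≤p (R._<_.gap violation) 1ℚ)) (R._<_.separated violation j le)

      u₀ = R._<_.gap μ₂>0
      u₀>0 = proj₁ (eventually-pos μ₂>0)
      d₀ = R._<_.gap 0<d
      d₀>0 = proj₁ (eventually-pos 0<d)
      gap*u₀>0 : 0ℚ < gap * u₀
      gap*u₀>0 = 0<* gap>0 u₀>0

      eventually-positive : ∀ {x} → R.0ℝ R.< x → Eventually (λ j → 0ℚ < seq x j)
      eventually-positive 0<x = ev-map (λ j → <-≤-trans (proj₁ (eventually-pos 0<x))) (proj₂ (eventually-pos 0<x))

      μ₂≤μₙ : Eventually (λ j → u j ≤ v j + gap * u₀)
      μ₂≤μₙ = eventually-≤ (IsSpectrum.nondecreasing spectrum {suc zero} {fromℕ (suc m)} (s≤s z≤n)) (gap * u₀) gap*u₀>0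

      Basic : ℕ → Set
      Basic j = v j + gap * u j ≤ u j * (1ℚ + (lit 4 * iʳ j - lit 2000 * iᶠ j)) × u₀ ≤ u j × u j ≤ v j + gap * u₀ ×
        (r j * iʳ j ≡ 1ℚ × 0ℚ < iʳ j) × (f j * iᶠ j ≡ 1ℚ × 0ℚ < iᶠ j) × 0ℚ < r j

      basic : Eventually Basic
      basic = ev-map conclude (ratio ⊓ᵉ recip-inverse (μ (suc zero)) μ₂>0 ⊓ᵉ recip-inverse (toℝ (suc (suc m))) (R.toℝ-pos (suc m)) ⊓ᵉ proj₂ (eventually-pos μ₂>0) ⊓ᵉ μ₂≤μₙ
        ⊓ᵉ recip-inverse (value T) (positive T) ⊓ᵉ recip-inverse (value F) (positive F) ⊓ᵉ eventually-positive (positive T))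
        where
        conclude : ∀ j → _ → Basic j
        conclude j (ratioⱼ , (u/u , 0<iᵘ) , (_ , 0<iⁿ) , u₀≤u , u≤v , r/r , f/f , 0<r) = key , u₀≤u , u≤v , r/r , f/f , 0<r
          where
          0≤u : 0ℚ ≤ u j
          0≤u = ≤-trans (<⇒≤ u₀>0) u₀≤u
          key : v j + gap * u j ≤ u j * (1ℚ + (lit 4 * iʳ j - lit 2000 * iᶠ j))
          key = begin
            v j + gap * u j  ≡⟨ cong (_+ gap * u j) (sym (trans (cong (v j *_) u/u) (*-identityʳ (v j)))) ⟩
            v j * (u j * iᵘ j) + gap * u j        ≡⟨ solve 4 (λ v u i g → v :* (u :* i) :+ g :* u := u :* (v :* i :+ g)) refl (v j) (u j) (iᵘ j) gap ⟩
            u j * (v j * iᵘ j + gap)  ≤⟨ *-monoˡ (u j) 0≤u (≤-trans ratioⱼ (≤-by (lit 2000 * iⁿ j) (0≤* (0≤lit 2000) (<⇒≤ 0<iⁿ))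
                                (solve 3 (λ a b c → con 1ℚ :+ (a :- b) := con 1ℚ :+ a :- b :- c :+ c) refl (lit 4 * iʳ j) (lit 2000 * iᶠ j) (lit 2000 * iⁿ j)))) ⟩
            u j * (1ℚ + (lit 4 * iʳ j - lit 2000 * iᶠ j)) ∎
            where open ≤-Reasoning

      -- Since λ₂ ≤ λₙ, a violated bound must exceed 1, so 2000 / d^(5/8) is less than 4 / √d, and d
      -- cannot be small.
      root-large : Eventually (λ j → lit 250 ≤ s j)
      root-large = ev-map conclude (basic ⊓ᵉ eventually-positive (positive S) ⊓ᵉ eventually-positive (positive F) ⊓ᵉ proj₂ (eventually-pos 0<d)
        ⊓ᵉ eventually-power S (½ * d₀) (half-pos d₀>0) ⊓ᵉ eventually-power T (½ * d₀) (half-pos d₀>0) ⊓ᵉ eventually-power F (½ * d₀ ^ 5) (half-pos (0<^ 5 d₀>0)))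
        where
        conclude : ∀ j → _ → lit 250 ≤ s j
        conclude j ((key , u₀≤u , u≤v , (r/r , 0<iʳ) , (f/f , 0<iᶠ) , 0<r) , 0<s , 0<f , d₀≤d , S-close , T-close , F-close) =
          -- The number 250 is 2000 divided by the 8 in `large-root`.
          large-root (lit 250) (s j) (r j) (f j) (dⱼ j) d₀ (iʳ j) (iᶠ j) (0<lit 249) (<⇒≤ 0<s) 0<r 0<f d₀>0 d₀≤d
            (subst (λ z → ∣ s j ^ 8 - z ∣ < ½ * d₀) (*-identityʳ (dⱼ j)) S-close) (subst (λ z → ∣ r j ^ 2 - z ∣ < ½ * d₀) (*-identityʳ (dⱼ j)) T-close) F-close r/r f/f
            (*-cancelˡ-≤ (u j) 0<u (≤-by ((u j * (1ℚ + (lit 4 * iʳ j - lit 2000 * iᶠ j)) - (v j + gap * u j)) + (v j + gap * u₀ - u j) + gap * (u j - u₀))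
              (0≤+ (0≤+ (0≤Δ key) (0≤Δ u≤v)) (0≤* (<⇒≤ gap>0) (0≤Δ u₀≤u)))
              (solve 6 (λ u v g e i k → u :* (κ 4 :* i) := u :* (κ 2000 :* k) :+ ((u :* (con 1ℚ :+ (κ 4 :* i :- κ 2000 :* k)) :- (v :+ g :* u)) :+ (v :+ g :* e :- u) :+ g :* (u :- e)))
                refl (u j) (v j) gap u₀ (iʳ j) (iᶠ j))))
          where
          0<u : 0ℚ < u j
          0<u = <-≤-trans u₀>0 u₀≤u

      RootBounds : ℕ → Set
      RootBounds K = lit 16 ≤ ι (suc K) × Eventually (λ j → ι (suc K) + ⅛ ≤ s j × s j + ½ ≤ ι (suc K) + lit 2)

      root-bounds-at : ∀ K s₁ → lit 250 ≤ s₁ → ι (suc K) + ¼ ≤ s₁ → s₁ < ι (suc (suc K)) + ¼ →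
        Eventually (λ j → ∣ s j - s₁ ∣ < ⅛) → RootBounds K
      root-bounds-at K s₁ 250≤s₁ s₁≥ s₁< (N , close) = 16≤x , N , λ j le →
        ≤-by ((s j + ⅛ - s₁) + (s₁ - (x + ¼))) (0≤+ (0≤Δ (proj₂ (∣-∣<⇒ (s j) s₁ (close j le)))) (0≤Δ s₁≥))
          (solve 3 (λ s t x → s := x :+ con ⅛ :+ ((s :+ con ⅛ :- t) :+ (t :- (x :+ con ¼)))) refl (s j) s₁ x) ,
        ≤-by ((s₁ + ⅛ - s j) + (1ℚ + x + ¼ - s₁) + ⅛) (0≤+ (0≤+ (0≤Δ (proj₁ (∣-∣<⇒ (s j) s₁ (close j le)))) (0≤Δ s₁≤)) (<⇒≤ 0<⅛))
          (solve 3 (λ s t x → x :+ κ 2 := s :+ con ½ :+ ((t :+ con ⅛ :- s) :+ (con 1ℚ :+ x :+ con ¼ :- t) :+ con ⅛)) refl (s j) s₁ x)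
        where
        x = ι (suc K)
        s₁≤ : s₁ ≤ 1ℚ + x + ¼
        s₁≤ = subst (λ z → s₁ ≤ z + ¼) (ι-suc (suc K)) (<⇒≤ s₁<)
        16≤x : lit 16 ≤ x
        16≤x = ≤-by ((1ℚ + x + ¼ - s₁) + (s₁ - lit 250) + (lit 233 - ¼)) (0≤+ (0≤+ (0≤Δ s₁≤) (0≤Δ 250≤s₁)) (*≤* (ℤ.+≤+ z≤n)))
          (solve 2 (λ x s → x := κ 16 :+ ((con 1ℚ :+ x :+ con ¼ :- s) :+ (s :- κ 250) :+ con (lit 233 - ¼))) refl x s₁)

      root-bounds : ∃[ K ] RootBounds K
      root-bounds = from-cauchy (cauchy (value S) ⅛ 0<⅛) root-large
        where
        from-cauchy : (∃[ M ] ∀ i j → M ℕ.≤ i → M ℕ.≤ j → ∣ s i - s j ∣ < ⅛) → Eventually (λ j → lit 250 ≤ s j) → ∃[ K ] RootBounds K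
        from-cauchy (M , close) (N , large) = from-located (s (M ℕ.⊔ N)) (large _ (ℕ.m≤n⊔m M N)) (M , λ j le → close j _ le (ℕ.m≤m⊔n M N))
          where
          from-located : ∀ s₁ → lit 250 ≤ s₁ → Eventually (λ j → ∣ s j - s₁ ∣ < ⅛) → ∃[ K ] RootBounds K
          from-located s₁ 250≤s₁ ev = from-scale (locate (proj₁ (archimedean s₁)) s₁ 1¼≤s₁ s₁<)
            where
            1¼≤s₁ : 1ℚ + ¼ ≤ s₁
            1¼≤s₁ = ≤-trans {1ℚ + ¼} {lit 250} (*≤* (ℤ.+≤+ (ℕ.m≤m+n 5 995))) 250≤s₁
            s₁< : s₁ < ι (proj₁ (archimedean s₁)) + ¼
            s₁< = ≤-<-trans (proj₂ (archimedean s₁)) (<-by ¼ 0<¼ refl)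
            from-scale : (∃[ K ] ι (suc K) + ¼ ≤ s₁ × s₁ < ι (suc (suc K)) + ¼) → ∃[ K ] RootBounds K
            from-scale (K , s₁≥ , s₁<) = K , root-bounds-at K s₁ 250≤s₁ s₁≥ s₁< ev

      n = ι (suc (suc m))
      e = sum (λ p → sum (adjacency G p))
      1≤n : 1ℚ ≤ n
      1≤n = subst (_≤ n) (ι-def 1) (ι-mono {1} {suc (suc m)} (s≤s z≤n))

      edge-bounds : Eventually (λ j → e ≤ dⱼ j * n + 1ℚ × dⱼ j * n ≤ e + 1ℚ)
      edge-bounds = ev-map conclude (eventually-close edges ½ 0<½ ⊓ᵉ recip-inverse (toℝ 2) (R.toℝ-pos 1))
        where
        E = ι (edgeCount G)
        conclude : ∀ j → _ → e ≤ dⱼ j * n + 1ℚ × dⱼ j * n ≤ e + 1ℚ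
        conclude j (close , 2i , _) = upper , lower
          where
          i = seq (recip (toℝ 2) (R.toℝ-pos 1)) j
          close′ : ∣ E - dⱼ j * n * i ∣ < ½
          close′ = subst₂ (λ a b → ∣ a - dⱼ j * b * i ∣ < ½) (sym (ι-def (edgeCount G))) (sym (ι-def (suc (suc m)))) close
          dn : dⱼ j * n ≡ lit 2 * (dⱼ j * n * i)
          dn = trans (sym (*-identityʳ (dⱼ j * n))) (trans (cong (dⱼ j * n *_) (sym 2i)) (solve 2 (λ a i → a :* (κ 2 :* i) := κ 2 :* (a :* i)) refl (dⱼ j * n) i))
          e≡ : e ≡ lit 2 * E
          e≡ = trans (∑-adjacency G) (solve 1 (λ e → e :+ e := κ 2 :* e) refl E)
          upper : e ≤ dⱼ j * n + 1ℚ
          upper = subst₂ _≤_ (sym e≡) (trans (solve 1 (λ a → κ 2 :* (a :+ con ½) := κ 2 :* a :+ con 1ℚ) refl (dⱼ j * n * i)) (cong (_+ 1ℚ) (sym dn)))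
            (*-monoˡ (lit 2) (0≤lit 2) (proj₁ (∣-∣<⇒ E (dⱼ j * n * i) close′)))
          lower : dⱼ j * n ≤ e + 1ℚ
          lower = subst₂ _≤_ (sym dn) (trans (solve 1 (λ a → κ 2 :* (a :+ con ½) := κ 2 :* a :+ con 1ℚ) refl E) (cong (_+ 1ℚ) (sym e≡)))
            (*-monoˡ (lit 2) (0≤lit 2) (proj₂ (∣-∣<⇒ E (dⱼ j * n * i) close′)))

      -- Widening the spectrum to a = U - τ and b = V + τ changes b - a (1 + β) by τ (2 + β), at
      -- most 3 τ = gap * u₀ as β ≤ 1. The strictness of the violation provides this much.
      τ = ⅓ * (gap * u₀)
      τ>0 : 0ℚ < τ
      τ>0 = 0<* {⅓} (*<* (ℤ.+<+ (s≤s z≤n))) gap*u₀>0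
      γ = ½ * τ
      γ>0 = half-pos τ>0

    module AtScale (K : ℕ) (bounds : RootBounds K) (y : ℚ) (νy≡1 : ι (3 ℕ.+ K) * y ≡ 1ℚ) where

      private
        x = ι (suc K)
        ν = ι (3 ℕ.+ K)
        ν≡ : ν ≡ x + lit 2
        ν≡ = trans (ι-+ 2 (suc K)) (trans (+-comm (ι 2) x) (cong (x +_) (ι-def 2)))
        module N = Numerics x ν y ν≡ νy≡1 (proj₁ bounds)
        β = (lit 4 - lit 100 * y) * (y * y * (y * y))

      -- The girth is at least 2 d^(1/8) + 1, and d^(1/8) exceeds K + 1. So the girth is above 2 (K
      -- + 1) by more than the error ⅛ allowed when the inequality is read at one index.
      acyclic : ∀ k → k ℕ.≤ suc K ℕ.+ suc K → ¬ HasCycle G k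
      acyclic k k≤ = from girth isGirth girth≥
        where
        from : ∀ g → IsGirth G g → toℝ 2 R.* value S R.+ R.1ℝ R.≤⁺ g → ¬ HasCycle G k
        from ⊤⁺ none _ = none k
        from [ g ] (_ , shortest) bound cycle = too-short (witness (proj₂ bounds ⊓ᵉ eventually-≤ bound ⅛ 0<⅛))
          where
          g≤ : ℤ.+ g / 1 ≤ x + x
          g≤ = subst₂ _≤_ (ι-def g) (ι-+ (suc K) (suc K)) (ι-mono (ℕ.≤-trans (shortest k cycle) k≤))
          too-short : ¬ (∃[ j ] (x + ⅛ ≤ s j × s j + ½ ≤ x + lit 2) × lit 2 * s j + 1ℚ ≤ ℤ.+ g / 1 + ⅛)
          too-short (j , (s≥ , _) , le) = <-irrefl refl (≤-<-trans le (<-by (1ℚ + (⅛ + (x + x - (ℤ.+ g / 1)) + lit 2 * (s j - (x + ⅛))))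
            (+-mono-<-≤ {0ℚ} {1ℚ} {0ℚ} 0<1 (0≤+ (0≤+ (<⇒≤ 0<⅛) (0≤Δ g≤)) (0≤* (0≤lit 2) (0≤Δ s≥))))
            (solve 3 (λ s x g → κ 2 :* s :+ con 1ℚ := g :+ con ⅛ :+ (con 1ℚ :+ (con ⅛ :+ (x :+ x :- g) :+ κ 2 :* (s :- (x :+ con ⅛))))) refl (s j) x (ℤ.+ g / 1))))

      Constants : ℚ → ℚ → Set
      Constants U V = V + gap * U ≤ U * (1ℚ + β) × u₀ ≤ U × U ≤ V + gap * u₀ × 1ℚ ≤ n * (y * y * (y * y) * y) ×
        e * (y * y * (y * y) * (y * y * (y * y))) ≤ n

      constants : Eventually (λ j → Constants (u j) (v j))
      constants = ev-map (λ j (basicⱼ , (s≥ , s≤) , (e≤ , dn≤) , S-close , T-close , F-close) →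
          conclude j basicⱼ s≥ s≤ e≤ dn≤ (subst (λ z → ∣ s j ^ 8 - z ∣ < ½) (*-identityʳ (dⱼ j)) S-close) (subst (λ z → ∣ r j ^ 2 - z ∣ < ½) (*-identityʳ (dⱼ j)) T-close) F-close)
        (basic ⊓ᵉ proj₂ bounds ⊓ᵉ edge-bounds ⊓ᵉ eventually-power S ½ 0<½ ⊓ᵉ eventually-power T ½ 0<½ ⊓ᵉ eventually-power F 1ℚ 0<1)
        where
        conclude : ∀ j → Basic j → x + ⅛ ≤ s j → s j + ½ ≤ x + lit 2 → e ≤ dⱼ j * n + 1ℚ → dⱼ j * n ≤ e + 1ℚ →
          ∣ s j ^ 8 - dⱼ j ∣ < ½ → ∣ r j ^ 2 - dⱼ j ∣ < ½ → ∣ f j ^ 8 - dⱼ j ^ 5 ∣ < 1ℚ → Constants (u j) (v j)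
        conclude j (key , u₀≤u , u≤v , (r/r , 0<iʳ) , (f/f , 0<iᶠ) , 0<r) s≥ s≤ e≤ dn≤ S-close T-close F-close =
          ≤-trans key (*-monoˡ (u j) (≤-trans (<⇒≤ u₀>0) u₀≤u) (+-monoʳ-≤ 1ℚ excess)) , u₀≤u , u≤v , n-large , edges≤
          where
          s≤ν = ≤-trans s≤ (≤-reflexive (sym ν≡))
          excess : lit 4 * iʳ j - lit 2000 * iᶠ j ≤ β
          excess = N.Excess.excess≤ (s j) (r j) (f j) (dⱼ j) s≥ s≤ν (<⇒≤ 0<r) S-close T-close F-close (iʳ j) (iᶠ j) 0<iʳ 0<iᶠ r/r f/f
          n-large : 1ℚ ≤ n * (y * y * (y * y) * y)
          n-large = N.Excess.n-large (s j) (r j) (f j) (dⱼ j) s≥ s≤ν (<⇒≤ 0<r) S-close T-close F-close n e 1≤n (∑-adjacency≤ G) e≤ dn≤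
          edges≤ : e * (y * y * (y * y) * (y * y * (y * y))) ≤ n
          edges≤ = N.Excess.edges≤ (s j) (r j) (f j) (dⱼ j) s≥ s≤ν (<⇒≤ 0<r) S-close T-close F-close n e 1≤n (∑-adjacency≤ G) e≤ dn≤

      -- `U` and `V` are the terms of the sequences of λ₂ and λₙ at one index, now frozen:
      -- `rayleigh` needs fixed rational bounds and chooses its own index. The hypotheses `below`
      -- and `above` say that later terms respect the bounds with `γ` to spare.
      module AtIndex (U V : ℚ) (C : Constants U V)
        (below : Eventually (λ j → U - τ + γ ≤ u j)) (above : Eventually (λ j → v j + γ ≤ V + τ)) where

        private
          u₀≤U = proj₁ (proj₂ C)
          U≤V = proj₁ (proj₂ (proj₂ C))
          a b : ℚ
          a = U - τ
          b = V + τ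

        a>0 : 0ℚ < U - τ
        a>0 = subst (0ℚ <_) (solve 3 (λ u g e → con (lit 2 * ⅓) :* e :+ ((u :- e) :+ con ⅓ :* ((con 1ℚ :- g) :* e)) := u :- con ⅓ :* (g :* e)) refl U gap u₀)
          (+-mono-<-≤ {0ℚ} {lit 2 * ⅓ * u₀} {0ℚ} (0<* {lit 2 * ⅓} (*<* (ℤ.+<+ (s≤s z≤n))) u₀>0)
            (0≤+ (0≤Δ u₀≤U) (0≤* {⅓} (*≤* (ℤ.+≤+ z≤n)) (0≤* (0≤Δ gap≤1) (<⇒≤ u₀>0)))))
        b>0 : 0ℚ < V + τ
        b>0 = subst (0ℚ <_) (solve 5 (λ v t u g e → t :+ ((v :+ g :* e :- u) :+ (u :- e) :+ (con 1ℚ :- g) :* e) := v :+ t) refl V τ U gap u₀)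
          (+-mono-<-≤ {0ℚ} {τ} {0ℚ} τ>0 (0≤+ (0≤+ (0≤Δ U≤V) (0≤Δ u₀≤U)) (0≤* (0≤Δ gap≤1) (<⇒≤ u₀>0))))
        β≤1 : β ≤ 1ℚ
        β≤1 = ≤-by (lit 100 * (y * y * (y * y) * y) + lit 4 * (y * (1ℚ - y * y * y)) + (1ℚ - lit 16 * y) + lit 12 * y)
          (0≤+ (0≤+ (0≤+ (0≤* (0≤lit 100) N.0≤y⁵) (0≤* (0≤lit 4) (0≤* N.0≤y (0≤Δ y³≤1)))) (0≤Δ N.16y≤1)) (0≤* (0≤lit 12) N.0≤y))
          (solve 1 (λ y → con 1ℚ := (κ 4 :- κ 100 :* y) :* (y :* y :* (y :* y)) :+
            (κ 100 :* (y :* y :* (y :* y) :* y) :+ κ 4 :* (y :* (con 1ℚ :- y :* y :* y)) :+ (con 1ℚ :- κ 16 :* y) :+ κ 12 :* y)) refl y)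
          where
          y≤1 : y ≤ 1ℚ
          y≤1 = ≤-trans (≤-by (lit 15 * y) (0≤* (0≤lit 15) N.0≤y) (solve 1 (λ y → κ 16 :* y := y :+ κ 15 :* y) refl y)) N.16y≤1
          y³≤1 : y * y * y ≤ 1ℚ
          y³≤1 = *-mono (0≤-square y) (*-mono N.0≤y y≤1 N.0≤y y≤1) N.0≤y y≤1
        b≤ : V + τ ≤ (U - τ) * (1ℚ + β)
        b≤ = ≤-by ((U * (1ℚ + β) - (V + gap * U)) + gap * (U - u₀) + τ * (1ℚ - β))
          (0≤+ (0≤+ (0≤Δ (proj₁ C)) (0≤* (<⇒≤ gap>0) (0≤Δ u₀≤U))) (0≤* (<⇒≤ τ>0) (0≤Δ β≤1)))
          (solve 5 (λ u v g e b → let t = con ⅓ :* (g :* e) in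
            (u :- t) :* (con 1ℚ :+ b) := v :+ t :+ ((u :* (con 1ℚ :+ b) :- (v :+ g :* u)) :+ g :* (u :- e) :+ t :* (con 1ℚ :- b))) refl U V gap u₀ β)

        -- The weights are divided by `a`, which turns the lower Rayleigh bound into the 1 that
        -- `Contradiction` expects and the upper one into b / a, at most 1 + β.
        finish : ∀ a⁻¹ → 0ℚ ≤ a⁻¹ → a⁻¹ * a ≡ 1ℚ → ∀ (A : Mat (suc (suc m))) → Sym A → (∀ p q → 0ℚ ≤ A p q) → (∀ p q → ¬ WeightedGraph._∼_ G p q → A p q ≡ 0ℚ) →
          (∀ z → sum z ≡ 0ℚ → a * normSq z ≤ quad (lap A) z × quad (lap A) z ≤ b * normSq z) → ⊥
        finish a⁻¹ 0≤a⁻¹ a⁻¹a≡1 A A-sym 0≤A A-edge window = Contradiction.absurd G W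
          (λ p q → cong (a⁻¹ *_) (A-sym p q)) (λ p q → 0≤* 0≤a⁻¹ (0≤A p q))
          (λ p q p≁q → trans (cong (a⁻¹ *_) (A-edge p q p≁q)) (*-zeroʳ a⁻¹))
          K acyclic (a⁻¹ * b) rayleigh′ y N.0<y (≤-trans (*-monoʳ {lit 12} {lit 16} y N.0≤y (*≤* (ℤ.+≤+ (ℕ.m≤m+n 12 4)))) N.16y≤1) νy≡1
          (proj₁ (proj₂ (proj₂ (proj₂ C)))) (proj₂ (proj₂ (proj₂ (proj₂ C)))) b-small
          where
          W : Mat (suc (suc m))
          W p q = a⁻¹ * A p q
          rayleigh′ : ∀ z → sum z ≡ 0ℚ → normSq z ≤ quad (lap W) z × quad (lap W) z ≤ a⁻¹ * b * normSq z
          rayleigh′ z z⊥1 = subst (λ q → normSq z ≤ q × q ≤ a⁻¹ * b * normSq z) (sym (quad-scale a⁻¹ (lap A) (lap W) (lap-scale a⁻¹ A) z))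
            ( ≤-trans (≤-reflexive (trans (sym (*-identityˡ (normSq z))) (trans (cong (_* normSq z) (sym a⁻¹a≡1)) (*-assoc a⁻¹ a (normSq z))))) (*-monoˡ a⁻¹ 0≤a⁻¹ (proj₁ (window z z⊥1)))
            , ≤-trans (*-monoˡ a⁻¹ 0≤a⁻¹ (proj₂ (window z z⊥1))) (≤-reflexive (sym (*-assoc a⁻¹ b (normSq z)))))
          b-small : a⁻¹ * b - 1ℚ ≤ β
          b-small = ≤-by (a⁻¹ * (a * (1ℚ + β) - b)) (0≤* 0≤a⁻¹ (0≤Δ b≤)) (trans (solve 1 (λ β → β := con 1ℚ :* (con 1ℚ :+ β) :- con 1ℚ) refl β)
            (trans (cong (λ o → o * (1ℚ + β) - 1ℚ) (sym a⁻¹a≡1)) (solve 4 (λ i a β b → i :* a :* (con 1ℚ :+ β) :- con 1ℚ := i :* b :- con 1ℚ :+ i :* (a :* (con 1ℚ :+ β) :- b)) refl a⁻¹ a β b)))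

        absurd : ⊥
        absurd = from-witness (witness (symmetrized-nonNeg G ⊓ᵉ
            rayleigh (symmetrized G) (symmetrized-sym G) (symmetrized-nonNeg G) μ (symmetrized-spectrum G spectrum) a b γ a>0 b>0 γ>0 below above))
          where
          from-witness : ¬ (∃[ j ] (∀ p q → 0ℚ ≤ seq (symmetrized G p q) j) ×
            (∀ z → sum z ≡ 0ℚ → a * normSq z ≤ quad (lap (at (symmetrized G) j)) z × quad (lap (at (symmetrized G) j)) z ≤ b * normSq z))
          from-witness (j , nonNeg , window) = finish (proj₁ (inverse a a>0)) (<⇒≤ (proj₁ (proj₂ (inverse a a>0))))
            (trans (*-comm (proj₁ (inverse a a>0)) a) (proj₂ (proj₂ (inverse a a>0)))) (at (symmetrized G) j)
            (λ p q → cong (λ z → seq z j) (symmetrized-sym G p q)) nonNeg (λ p q p≁q → symmetrized-nonEdge G p q p≁q j) window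

      at-scale : ⊥
      at-scale = from-cauchy constants (cauchy (μ (suc zero)) γ γ>0) (cauchy (μ (fromℕ (suc m))) γ γ>0)
        where
        from-cauchy : Eventually (λ j → Constants (u j) (v j)) → (∃[ M ] ∀ i j → M ℕ.≤ i → M ℕ.≤ j → ∣ u i - u j ∣ < γ) →
          (∃[ M ] ∀ i j → M ℕ.≤ i → M ℕ.≤ j → ∣ v i - v j ∣ < γ) → ⊥
        from-cauchy (M , C) (Mᵘ , closeᵘ) (Mᵛ , closeᵛ) = AtIndex.absurd (u top) (v top) (C top (ℕ.m≤m⊔n M (Mᵘ ℕ.⊔ Mᵛ)))
          (Mᵘ , λ j le → ≤-by (u j + γ - u top) (0≤Δ (proj₂ (∣-∣<⇒ (u j) (u top) (closeᵘ j top le (ℕ.≤-trans (ℕ.m≤m⊔n Mᵘ Mᵛ) (ℕ.m≤n⊔m M _))))))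
            (solve 3 (λ u w t → w := u :- t :+ con ½ :* t :+ (w :+ con ½ :* t :- u)) refl (u top) (u j) τ))
          (Mᵛ , λ j le → ≤-by (v top + γ - v j) (0≤Δ (proj₁ (∣-∣<⇒ (v j) (v top) (closeᵛ j top le (ℕ.≤-trans (ℕ.m≤n⊔m Mᵘ Mᵛ) (ℕ.m≤n⊔m M _))))))
            (solve 3 (λ v w t → v :+ t := w :+ con ½ :* t :+ (v :+ con ½ :* t :- w)) refl (v top) (v j) τ))
          where top = M ℕ.⊔ (Mᵘ ℕ.⊔ Mᵛ)

    impossible : ⊥
    impossible = from-scale root-bounds
      where
      from-scale : ¬ (∃[ K ] RootBounds K)
      from-scale (K , bounds) = AtScale.at-scale K bounds (proj₁ i) (proj₂ (proj₂ i))
        where i = inverse (ι (3 ℕ.+ K)) (0<ι-suc (2 ℕ.+ K))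

open import Data.Nat using () renaming (_+_ to _+ℕ_)
open import Defs
open RationalPower using (value; positive)

theorem1p1 :
  ∃[ C ] 0ℝ < C × (∀ (m : ℕ) → let n = 2 +ℕ m in
    (G : WeightedGraph n) (d : ℝ) → 0ℝ < d →
    toℝ (edgeCount G) ≈ d * toℝ n / toℝ 2 ⟨ toℝ-pos 1 ⟩ →
    (μ : Fin n → ℝ) → IsSpectrum (laplacian G) μ →
    let μ₂ = μ (suc zero)
        μₙ = μ (fromℕ (1 +ℕ m)) in
    (d^⅛ : RationalPower d 1 8) (√d : RationalPower d 1 2) (d^⅝ : RationalPower d 5 8) →
    (girth : ℕ ⁺) → IsGirth G girth →
    toℝ 2 * value d^⅛ + 1ℝ ≤⁺ girth →
    (μ₂>0 : 0ℝ < μ₂) →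
    1ℝ + toℝ 4 / value √d ⟨ positive √d ⟩ - C / value d^⅝ ⟨ positive d^⅝ ⟩ - C / toℝ n ⟨ toℝ-pos (1 +ℕ m) ⟩
      ≤ μₙ / μ₂ ⟨ μ₂>0 ⟩)
-- As `_≤_` is the negation of `_<_`, the last argument is a strict violation, which `impossible`
-- refutes.
theorem1p1 = toℝ 2000 , toℝ-pos 1999 , λ m → Assembly.Final.impossible
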